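{- Let $q$ be a prime power, let $n\ge 2$ be an integer, and let $C=\{\mathcal A_1,\ldots,\mathcal A_n\}$ be a set of $\mathbb F_q$-affine hyperplanes of $\mathbb F_{q^n}$ in general position. Let $\mathcal S_C^*=\bigcap_{i=1}^n\left(\mathbb F_{q^n}\setminus \mathcal A_i\right)$. Then $\mathcal S_C^*$ contains a primitive element of $\mathbb F_{q^n}$ provided that one of the following holds: (i) $q\ge 16$; (ii) $q=13$ and $n\ne 4$; (iii) $q=11$ and $n\ne 4,6,12$; (iv) $q\in\{7,8,9\}$ and $n$ is large enough (i.e., for each such $q$ there is $N(q)$ such that the conclusion holds for all $n\ge N(q)$).
   Context: $\mathbb F_{q^n}$ is regarded as an $n$-dimensional vector space over $\mathbb F_q$. An $\mathbb F_q$-affine space of dimension $t$ in $\mathbb F_{q^n}$ is a set $u+V$ with $u\in\mathbb F_{q^n}$ and $V$ an $\mathbb F_q$-linear subspace of dimension $t$; an $\mathbb F_q$-affine hyperplane is one of dimension $n-1$. A set $C=\{\mathcal A_1,\ldots,\mathcal A_n\}$ of $\mathbb F_q$-affine hyperplanes is in general position if for each $1\le k\le n$ the intersection of any $k$ distinct elements of $C$ is an $\mathbb F_q$-affine space of dimension $n-k$. A primitive element of $\mathbb F_{q^n}$ is a generator of the cyclic group $\mathbb F_{q^n}^*$. -}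

module Defs where

open import Data.Nat using (ℕ; zero; suc; _≤_; _∸_)
open import Data.Fin using (Fin)
import Data.Fin.Subset as Sub
open import Data.List using (List; length)
open import Data.List.Relation.Unary.Unique.Propositional using (Unique)
import Data.List.Membership.Propositional as L
open import Data.Product using (Σ; ∃; ∃₂; _×_; _,_)
open import Relation.Binary.PropositionalEquality using (_≡_; _≢_)
open import Relation.Nullary using (¬_)
open import Algebra.Core using (Op₁; Op₂)
open import Algebra.Structures using (IsCommutativeRing)
open import Function.Base using (_∘_)
open import Function.Bundles using (_⇔_)

record FiniteField : Set₁ where
  infixl 6 _+_
  infixl 7 _*_
  field
    Carrier  : Set
    _+_ _*_  : Op₂ Carrier
    -_       : Op₁ Carrier
    0# 1#    : Carrier
    isCommutativeRing : IsCommutativeRing _≡_ _+_ _*_ -_ 0# 1#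
    0≢1      : 0# ≢ 1#
    inverse  : ∀ x → x ≢ 0# → ∃ λ y → x * y ≡ 1#
    elements : List Carrier
    unique   : Unique elements
    complete : ∀ x → x L.∈ elements

  card : ℕ
  card = length elements

module _ (K : FiniteField) where
  open FiniteField K

  Pred : Set₁
  Pred = Carrier → Set

  pow : Carrier → ℕ → Carrier
  pow x zero    = 1#
  pow x (suc k) = x * pow x k

  IsPrimitive : Carrier → Set
  IsPrimitive g = (g ≢ 0#) × (∀ y → y ≢ 0# → ∃ λ k → y ≡ pow g k)

  HasSize : Pred → ℕ → Set
  HasSize P m = ∃ λ (l : List Carrier) →
    (length l ≡ m) × Unique l × (∀ x → P x ⇔ (x L.∈ l))

  record IsSubfield (F : Pred) : Set where
    field
      has-0 : F 0#
      has-1 : F 1#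
      +-closed : ∀ {x y} → F x → F y → F (x + y)
      *-closed : ∀ {x y} → F x → F y → F (x * y)
      neg-closed : ∀ {x} → F x → F (- x)
      inv-closed : ∀ {x y} → F x → x * y ≡ 1# → F y

  lincomb : ∀ {t} → (Fin t → Carrier) → (Fin t → Carrier) → Carrier
  lincomb {zero}  c b = 0#
  lincomb {suc t} c b = c Fin.zero * b Fin.zero + lincomb (c ∘ Fin.suc) (b ∘ Fin.suc)
    where import Data.Fin as Fin

  IsSubspaceOfDim : Pred → Pred → ℕ → Set
  IsSubspaceOfDim F V t = ∃ λ (b : Fin t → Carrier) →
    (∀ x → V x ⇔ (∃ λ (c : Fin t → Carrier) → (∀ i → F (c i)) × (x ≡ lincomb c b)))
    × (∀ (c : Fin t → Carrier) → (∀ i → F (c i)) → lincomb c b ≡ 0# → ∀ i → c i ≡ 0#)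

  IsAffineOfDim : Pred → Pred → ℕ → Set₁
  IsAffineOfDim F A t = ∃₂ λ (u : Carrier) (V : Pred) →
    IsSubspaceOfDim F V t × (∀ x → A x ⇔ (∃ λ v → V v × (x ≡ u + v)))

  ⋂ : ∀ {n} → (Fin n → Pred) → Sub.Subset n → Pred
  ⋂ A S x = ∀ i → i Sub.∈ S → A i x

  -- general position of n affine hyperplanes (K has dimension n over F)
  GeneralPosition : Pred → (n : ℕ) → (Fin n → Pred) → Set₁
  GeneralPosition F n A = ∀ (S : Sub.Subset n) (k : ℕ) → 1 ≤ k → Sub.∣ S ∣ ≡ k →
    IsAffineOfDim F (⋂ A S) (n ∸ k)

open import Data.Nat using (_^_)

IsPrimePower : ℕ → Set
IsPrimePower q = ∃₂ λ p k → Prime p × 1 ≤ k × q ≡ p ^ k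
  where open import Data.Nat.Primality using (Prime)

PrimitiveInComplement : ℕ → ℕ → Set₁
PrimitiveInComplement q n =
  ∀ (K : FiniteField) (F : Pred K) (A : Fin n → Pred K) →
  FiniteField.card K ≡ q ^ n →
  IsSubfield K F → HasSize K F q →
  (∀ i → IsAffineOfDim K F (A i) (n ∸ 1)) →
  GeneralPosition K F n A →
  ∃ λ g → IsPrimitive K g × (∀ i → ¬ A i g)

{-# OPTIONS --safe #-}
module Submission where

-- The hyperplanes meet in one point u, and the intersections of all but one of them give a basis b
-- with S* ⊇ {u + Σ cᵢbᵢ : all cᵢ ≠ 0}.  Let m = qⁿ − 1.  The indicator of the primitive elements is a
-- combination of the Ramanujan sums c_d(log x), d ∣ rad m, which play the part of the characters of
-- order d: they satisfy Σ_g c_d(gw) c_d(g) = m c_d(w), so the translates of c_d are almost orthogonal,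
-- and no complex numbers are needed.  The indicator of F* in F is a convolution α * β; applying
-- Cauchy–Schwarz to it in each of the n coordinates bounds the sum of c_d over the box by
-- φ(d) ((q−1)(q−1+r²)²/(q r²))^(n/2), where the optimum r² = q − 1 gives φ(d) (2(q−1)/√q)ⁿ.
-- This is the character criterion: 4^ω(m) (q−1+r²)^(2n) ≤ ((q−1) q r²)ⁿ suffices.  For small n it is
-- enough to count: there are φ(m) primitive elements and qⁿ − (q−1)ⁿ points outside the box.
-- One of the two criteria applies to every pair (q, n) claimed; ω(m) and m/φ(m) are bounded through
-- trial division for q < 53 and through the primes below 16 or 22 for q ≥ 53.

open import Defs
open import Algebra.Bundles using (CommutativeRing)
open import Data.Bool.Base using (Bool; true; false; T; not; _∧_; _∨_)
open import Data.Bool.ListAction using (all; any)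
open import Data.Bool.Properties using (T?; T-∧; T-∨)
open import Data.Empty using (⊥-elim)
open import Data.Fin.Base using (Fin)
import Data.Fin.Base as Fin
import Data.Fin.Properties as Fin
import Data.Fin.Subset as Sub
import Data.Fin.Subset.Properties as Sub
open import Data.Integer.Base using (ℤ; +_; 0ℤ; 1ℤ; _+_; _*_; -_; _-_; _≤_; _<_; +≤+)
import Data.Integer.Base as ℤ
import Data.Integer.Properties as ℤ
open import Data.Integer.Tactic.RingSolver using (solve-∀)
open import Data.List.Base using (List; []; _∷_; _++_; length; map; filter; foldr; upTo; applyUpTo; applyDownFrom)
import Data.List.Properties as List
open import Data.List.Membership.Propositional using (_∈_; _∉_; find)
import Data.List.Membership.Propositional.Properties as Mem
open import Data.List.Membership.Propositional.Properties.WithK using (unique∧set⇒bag)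
open import Data.List.Relation.Binary.BagAndSetEquality using (∼bag⇒↭)
open import Data.List.Relation.Binary.Permutation.Propositional using (_↭_; ↭-sym; ↭⇒↭ₛ)
import Data.List.Relation.Binary.Permutation.Propositional as Perm
import Data.List.Relation.Binary.Permutation.Propositional.Properties as Perm
import Data.List.Relation.Binary.Permutation.Setoid.Properties as SetoidPerm
open import Data.List.Relation.Unary.All using (All; []; _∷_)
import Data.List.Relation.Unary.All as All
import Data.List.Relation.Unary.All.Properties as All
open import Data.List.Relation.Unary.AllPairs using ([]; _∷_)
open import Data.List.Relation.Unary.Any using (here; there)
import Data.List.Relation.Unary.Any as Any
import Data.List.Relation.Unary.Any.Properties as Any
open import Data.List.Relation.Unary.Unique.Propositional using (Unique)
import Data.List.Relation.Unary.Unique.Propositional.Properties as Unique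
open import Data.Nat.Base using (ℕ; zero; suc; pred; NonZero; z≤n; s≤s; _∸_; _^_; _≤ᵇ_; _<ᵇ_; _≡ᵇ_) renaming (_*_ to _·_)
import Data.Nat.Base as ℕ
open import Data.Nat.Coprimality using (Coprime)
import Data.Nat.Coprimality as Coprime
open import Data.Nat.Divisibility using (_∣_; _∤_; _∣?_; divides)
import Data.Nat.Divisibility as ℕ
import Data.Nat.DivMod as ℕ
open import Data.Nat.Induction using (<-rec)
open import Data.Nat.ListAction using (product)
open import Data.Nat.ListAction.Properties using (product-↭; ∈⇒∣product)
open import Data.Nat.Primality using (Prime; prime?; euclidsLemma; prime⇒nonZero; prime⇒nonTrivial)
import Data.Nat.Primality as Prime
import Data.Nat.Properties as ℕ
open import Data.Nat.Tactic.RingSolver using () renaming (solve-∀ to ℕ-solve)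
open import Data.Product.Base using (∃; _×_; _,_; proj₁; proj₂)
open import Data.Sum.Base using (_⊎_; inj₁; inj₂)
open import Function.Base using (_∘_; id)
open import Function.Bundles using (mk⇔; module Equivalence)
open import Relation.Binary.Definitions using (DecidableEquality)
open import Relation.Binary.PropositionalEquality
  using (_≡_; _≢_; refl; sym; trans; cong; cong₂; subst; subst₂; setoid; module ≡-Reasoning)
open import Relation.Nullary using (¬_; Dec; yes; no)
open import Relation.Nullary.Decidable using (from-yes; _×-dec_; ¬?)
import Algebra.Properties.Ring
open import Level using (0ℓ)
open import Data.Nat.GCD using (GCD; gcd; gcd-GCD; module Bézout)
open import Data.Nat.Primality.Factorisation using (PrimeFactorisation; factorise)

-- With Gauss sums, a character sum over the box is at most q^(n/2) times the ℓ¹ norm of the Fourier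
-- transform of the box, (2(q - 1)/q)ⁿ. The factorisation α * β reaches the same value through ℓ²
-- norms: the Fourier coefficients of F* are q - 1 once and -1 for the q - 1 nontrivial characters,
-- α and β share each coefficient between them, and Cauchy-Schwarz is sharp when both have
-- coefficients in the same proportion, r : 1 = (q - 1) : r. Since all arithmetic is in ℤ, r is an
-- integer near √(q - 1), and bounds are stated for squares.
--
-- With R = rad m, every d ∣ R enters the indicator with the weight φ(R/d) φ(d) = φ(R). The 2^ω - 1
-- errors are therefore equally large, and only ω is needed. At the optimum the character criterion
-- reads 4^ω ≤ (q/4)ⁿ. For fixed q, ω grows more slowly than n, so this holds eventually; for small
-- n it can fail, and the count takes over.
--
-- The threshold 53 is the first prime power q with ⌊√(q - 1)⌋ ≥ 7.

-- Finite sums of integers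

infixr 8 Σ

Σ : {A : Set} → List A → (A → ℤ) → ℤ
Σ []       f = 0ℤ
Σ (x ∷ xs) f = f x + Σ xs f

syntax Σ xs (λ x → e) = Σ[ x ∈ xs ] e

𝟙 : {P : Set} → Dec P → ℤ
𝟙 (yes _) = 1ℤ
𝟙 (no _)  = 0ℤ

𝟙-yes : {P : Set} (d : Dec P) → P → 𝟙 d ≡ 1ℤ
𝟙-yes (yes _) p = refl
𝟙-yes (no ¬p) p = ⊥-elim (¬p p)

𝟙-no : {P : Set} (d : Dec P) → ¬ P → 𝟙 d ≡ 0ℤ
𝟙-no (yes p) ¬p = ⊥-elim (¬p p)
𝟙-no (no _)  ¬p = refl

𝟙-cong : {P Q : Set} (d : Dec P) (e : Dec Q) → (P → Q) → (Q → P) → 𝟙 d ≡ 𝟙 e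
𝟙-cong (yes p) e f g = sym (𝟙-yes e (f p))
𝟙-cong (no ¬p) e f g = sym (𝟙-no e (¬p ∘ g))

private variable
  A B : Set

Σ-cong-∈ : (xs : List A) {f g : A → ℤ} → (∀ {x} → x ∈ xs → f x ≡ g x) → Σ xs f ≡ Σ xs g
Σ-cong-∈ []       h = refl
Σ-cong-∈ (x ∷ xs) h = cong₂ _+_ (h (here refl)) (Σ-cong-∈ xs (h ∘ there))

Σ-cong : (xs : List A) {f g : A → ℤ} → (∀ x → f x ≡ g x) → Σ xs f ≡ Σ xs g
Σ-cong xs h = Σ-cong-∈ xs (λ {x} _ → h x)

+-interchange : ∀ a b c d → (a + b) + (c + d) ≡ (a + c) + (b + d)
+-interchange = solve-∀

Σ-+ : (xs : List A) (f g : A → ℤ) → Σ[ x ∈ xs ] (f x + g x) ≡ Σ xs f + Σ xs g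
Σ-+ []       f g = refl
Σ-+ (x ∷ xs) f g = trans (cong (λ s → f x + g x + s) (Σ-+ xs f g)) (+-interchange (f x) (g x) _ _)

Σ-*ˡ : (xs : List A) (k : ℤ) (f : A → ℤ) → Σ[ x ∈ xs ] (k * f x) ≡ k * Σ xs f
Σ-*ˡ []       k f = sym (ℤ.*-zeroʳ k)
Σ-*ˡ (x ∷ xs) k f = trans (cong (λ s → k * f x + s) (Σ-*ˡ xs k f)) (sym (ℤ.*-distribˡ-+ k (f x) (Σ xs f)))

Σ-*ʳ : (xs : List A) (k : ℤ) (f : A → ℤ) → Σ[ x ∈ xs ] (f x * k) ≡ Σ xs f * k
Σ-*ʳ xs k f = trans (Σ-cong xs (λ x → ℤ.*-comm (f x) k)) (trans (Σ-*ˡ xs k f) (ℤ.*-comm k _))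

Σ-neg : (xs : List A) (f : A → ℤ) → Σ[ x ∈ xs ] (- f x) ≡ - Σ xs f
Σ-neg []       f = refl
Σ-neg (x ∷ xs) f = trans (cong (λ s → - f x + s) (Σ-neg xs f)) (sym (ℤ.neg-distrib-+ (f x) (Σ xs f)))

Σ-minus : (xs : List A) (f g : A → ℤ) → Σ[ x ∈ xs ] (f x - g x) ≡ Σ xs f - Σ xs g
Σ-minus xs f g = trans (Σ-+ xs f (λ x → - g x)) (cong (λ s → Σ xs f + s) (Σ-neg xs g))

Σ-0 : (xs : List A) → Σ[ x ∈ xs ] 0ℤ ≡ 0ℤ
Σ-0 []       = refl
Σ-0 (x ∷ xs) = trans (ℤ.+-identityˡ _) (Σ-0 xs)

Σ-const : (xs : List A) (k : ℤ) → Σ[ x ∈ xs ] k ≡ + length xs * k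
Σ-const []       k = sym (ℤ.*-zeroˡ k)
Σ-const (x ∷ xs) k = trans (cong (λ s → k + s) (Σ-const xs k)) (sym (ℤ.suc-* (+ length xs) k))

Σ-1 : (xs : List A) → Σ[ x ∈ xs ] 1ℤ ≡ + length xs
Σ-1 xs = trans (Σ-const xs 1ℤ) (ℤ.*-identityʳ _)

Σ-swap : (xs : List A) (ys : List B) (f : A → B → ℤ) →
  Σ[ x ∈ xs ] Σ[ y ∈ ys ] f x y ≡ Σ[ y ∈ ys ] Σ[ x ∈ xs ] f x y
Σ-swap []       ys f = sym (Σ-0 ys)
Σ-swap (x ∷ xs) ys f = trans (cong (λ s → Σ ys (f x) + s) (Σ-swap xs ys f)) (sym (Σ-+ ys (f x) _))

Σ-map : (h : A → B) (xs : List A) (f : B → ℤ) → Σ (map h xs) f ≡ Σ xs (f ∘ h)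
Σ-map h []       f = refl
Σ-map h (x ∷ xs) f = cong (λ s → f (h x) + s) (Σ-map h xs f)

Σ-mono-∈ : (xs : List A) {f g : A → ℤ} → (∀ {x} → x ∈ xs → f x ≤ g x) → Σ xs f ≤ Σ xs g
Σ-mono-∈ []       h = ℤ.≤-refl
Σ-mono-∈ (x ∷ xs) h = ℤ.+-mono-≤ (h (here refl)) (Σ-mono-∈ xs (h ∘ there))

Σ-mono : (xs : List A) {f g : A → ℤ} → (∀ x → f x ≤ g x) → Σ xs f ≤ Σ xs g
Σ-mono xs h = Σ-mono-∈ xs (λ {x} _ → h x)

Σ-nonneg : (xs : List A) {f : A → ℤ} → (∀ x → 0ℤ ≤ f x) → 0ℤ ≤ Σ xs f
Σ-nonneg xs {f} h = subst (_≤ Σ xs f) (Σ-0 xs) (Σ-mono xs h)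

Σ-term≤ : (xs : List A) {f : A → ℤ} → (∀ x → 0ℤ ≤ f x) → ∀ {a} → a ∈ xs → f a ≤ Σ xs f
Σ-term≤ (x ∷ xs) {f} h (here refl) =
  subst (_≤ f x + Σ xs f) (ℤ.+-identityʳ (f x)) (ℤ.+-monoʳ-≤ (f x) (Σ-nonneg xs h))
Σ-term≤ (x ∷ xs) {f} h {a} (there a∈) =
  subst (_≤ f x + Σ xs f) (ℤ.+-identityˡ (f a)) (ℤ.+-mono-≤ (h x) (Σ-term≤ xs h a∈))

Σ≢0⇒∃ : (xs : List A) (f : A → ℤ) → Σ xs f ≢ 0ℤ → ∃ λ x → x ∈ xs × f x ≢ 0ℤ
Σ≢0⇒∃ []       f h = ⊥-elim (h refl)
Σ≢0⇒∃ (x ∷ xs) f h with f x ℤ.≟ 0ℤ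
... | no fx≢0 = x , here refl , fx≢0
... | yes fx≡0 with y , y∈ , fy≢0 ← Σ≢0⇒∃ xs f (λ s → h (cong₂ _+_ fx≡0 s)) = y , there y∈ , fy≢0

Σ-vanish : (xs : List A) {f : A → ℤ} → (∀ {x} → x ∈ xs → f x ≡ 0ℤ) → Σ xs f ≡ 0ℤ
Σ-vanish xs h = trans (Σ-cong-∈ xs h) (Σ-0 xs)

≢-of-Unique : {x y : A} {xs : List A} → Unique (x ∷ xs) → y ∈ xs → x ≢ y
≢-of-Unique (x∉ ∷ _) y∈ = All.lookup x∉ y∈

Σ-only : {xs : List A} → Unique xs → {f : A → ℤ} {a : A} → a ∈ xs →
  (∀ {x} → x ∈ xs → x ≢ a → f x ≡ 0ℤ) → Σ xs f ≡ f a
Σ-only {xs = x ∷ xs} u {f} (here refl) h =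
  trans (cong (λ s → f x + s) (Σ-vanish xs (λ y∈ → h (there y∈) (≢-of-Unique u y∈ ∘ sym)))) (ℤ.+-identityʳ _)
Σ-only {xs = x ∷ xs} u@(_ ∷ u′) {f} (there a∈) h =
  trans (cong₂ _+_ (h (here refl) (≢-of-Unique u a∈)) (Σ-only u′ a∈ (h ∘ there))) (ℤ.+-identityˡ _)

Σ-at-most-one : {xs : List A} → Unique xs → {f : A → ℤ} →
  (∀ x → f x ≤ 1ℤ) →
  (∀ {x y} → x ∈ xs → y ∈ xs → f x ≢ 0ℤ → f y ≢ 0ℤ → x ≡ y) → Σ xs f ≤ 1ℤ
Σ-at-most-one {xs = []} u h₁ h = +≤+ z≤n
Σ-at-most-one {xs = x ∷ xs} u@(_ ∷ u′) {f} h₁ h with f x ℤ.≟ 0ℤ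
... | yes fx≡0 = subst (_≤ 1ℤ) (sym (trans (cong (_+ Σ xs f) fx≡0) (ℤ.+-identityˡ _)))
      (Σ-at-most-one u′ h₁ (λ x∈ y∈ → h (there x∈) (there y∈)))
... | no fx≢0 = subst (_≤ 1ℤ) (sym (trans (cong (λ s → f x + s) (Σ-vanish xs rest)) (ℤ.+-identityʳ _))) (h₁ x)
  where
  rest : ∀ {y} → y ∈ xs → f y ≡ 0ℤ
  rest {y} y∈ with f y ℤ.≟ 0ℤ
  ... | yes fy≡0 = fy≡0
  ... | no  fy≢0 = ⊥-elim (≢-of-Unique u y∈ (h (here refl) (there y∈) fx≢0 fy≢0))

Σ-↭ : {xs ys : List A} → xs ↭ ys → (f : A → ℤ) → Σ xs f ≡ Σ ys f
Σ-↭ Perm.refl f = refl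
Σ-↭ (Perm.prep x p) f = cong (λ s → f x + s) (Σ-↭ p f)
Σ-↭ (Perm.swap {xs} {ys} x y p) f = trans (cong (λ s → f x + (f y + s)) (Σ-↭ p f)) (swap-+ (f x) (f y) (Σ ys f))
  where
  swap-+ : ∀ a b c → a + (b + c) ≡ b + (a + c)
  swap-+ = solve-∀
Σ-↭ (Perm.trans p q) f = trans (Σ-↭ p f) (Σ-↭ q f)

unique-set⇒↭ : {xs ys : List A} → Unique xs → Unique ys →
  (∀ {x} → x ∈ xs → x ∈ ys) → (∀ {x} → x ∈ ys → x ∈ xs) → xs ↭ ys
unique-set⇒↭ u v f g = ∼bag⇒↭ (unique∧set⇒bag u v (mk⇔ f g))

-- The maps have to be inverse to each other on the two lists only, because `inv` obeys its laws
-- only away from 0.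
module Reindex {xs : List A} {ys : List B} (ux : Unique xs) (uy : Unique ys)
  (h : A → B) (k : B → A) (kh : ∀ x → x ∈ xs → k (h x) ≡ x) (hk : ∀ y → y ∈ ys → h (k y) ≡ y)
  (h∈ : ∀ {x} → x ∈ xs → h x ∈ ys) (k∈ : ∀ {y} → y ∈ ys → k y ∈ xs) where

  map-unique : ∀ {zs} → (∀ {x} → x ∈ zs → x ∈ xs) → Unique zs → Unique (map h zs)
  map-unique {[]} _ [] = []
  map-unique {z ∷ zs} ⊆ (z∉ ∷ u) = All.tabulate fresh ∷ map-unique (⊆ ∘ there) u
    where
    fresh : ∀ {y} → y ∈ map h zs → h z ≢ y
    fresh y∈ eq with z′ , z′∈ , refl ← Mem.∈-map⁻ h y∈ =
      All.lookup z∉ z′∈ (trans (sym (kh z (⊆ (here refl)))) (trans (cong k eq) (kh z′ (⊆ (there z′∈)))))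

  map↭ : map h xs ↭ ys
  map↭ = unique-set⇒↭ (map-unique id ux) uy to from
    where
    to : ∀ {y} → y ∈ map h xs → y ∈ ys
    to y∈ with x , x∈ , refl ← Mem.∈-map⁻ h y∈ = h∈ x∈
    from : ∀ {y} → y ∈ ys → y ∈ map h xs
    from {y} y∈ = subst (_∈ map h xs) (hk y y∈) (Mem.∈-map⁺ h (k∈ y∈))

  Σ-reindex : (f : B → ℤ) → Σ xs (f ∘ h) ≡ Σ ys f
  Σ-reindex f = trans (sym (Σ-map h xs f)) (Σ-↭ map↭ f)

infix 9 _²
_² : ℤ → ℤ
x ² = x * x

0≤² : ∀ x → 0ℤ ≤ x ²
0≤² (+ n)       = subst (0ℤ ≤_) (ℤ.pos-* n n) (+≤+ z≤n)
0≤² (ℤ.-[1+ n ]) = +≤+ z≤n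

0≤* : ∀ {x y} → 0ℤ ≤ x → 0ℤ ≤ y → 0ℤ ≤ x * y
0≤* {+ m} {+ n} _ _ = subst (0ℤ ≤_) (ℤ.pos-* m n) (+≤+ z≤n)

*-mono-≤ : ∀ {a b c d} → 0ℤ ≤ a → 0ℤ ≤ c → a ≤ b → c ≤ d → a * c ≤ b * d
*-mono-≤ {+ a} {+ b} {+ c} {+ d} _ _ (+≤+ p) (+≤+ q) =
  subst₂ _≤_ (ℤ.pos-* a c) (ℤ.pos-* b d) (+≤+ (ℕ.*-mono-≤ p q))

square-cancel-≤ : ∀ {x y} → 0ℤ ≤ y → x ² ≤ y ² → x ≤ y
square-cancel-≤ {x} {y} 0≤y h with x ℤ.≤? y
... | yes x≤y = x≤y
... | no  x≰y = ⊥-elim (ℤ.<-irrefl refl (ℤ.<-≤-trans y²<x² h))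
  where
  y<x : y < x
  y<x = ℤ.≰⇒> x≰y
  instance _ = ℤ.positive (ℤ.≤-<-trans 0≤y y<x)
  instance _ = ℤ.nonNegative 0≤y
  y²<x² : y ² < x ²
  y²<x² = ℤ.≤-<-trans (ℤ.*-monoˡ-≤-nonNeg y (ℤ.<⇒≤ y<x)) (ℤ.*-monoʳ-<-pos x y<x)

-- Lagrange's identity: twice the defect is Σᵢⱼ (fᵢ gⱼ − fⱼ gᵢ)².
cauchy-schwarz : (xs : List A) (f g : A → ℤ) →
  (Σ[ x ∈ xs ] (f x * g x)) ² ≤ Σ[ x ∈ xs ] f x ² * Σ[ x ∈ xs ] g x ²
cauchy-schwarz xs f g = ℤ.*-cancelˡ-≤-pos _ _ (+ 2) (ℤ.0≤i-j⇒j≤i (subst (0ℤ ≤_) lagrange nonneg))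
  where
  S = Σ[ x ∈ xs ] (f x * g x)
  F = Σ[ x ∈ xs ] f x ²
  G = Σ[ x ∈ xs ] g x ²
  term : _ → _ → ℤ
  term x y = (f x * g y - f y * g x) ²
  nonneg : 0ℤ ≤ Σ[ x ∈ xs ] Σ[ y ∈ xs ] term x y
  nonneg = Σ-nonneg xs (λ x → Σ-nonneg xs (λ y → 0≤² (f x * g y - f y * g x)))
  expand : ∀ a b c d → (a * d - c * b) * (a * d - c * b) ≡
    (a * a * (d * d) + b * b * (c * c)) - (+ 2) * (a * b) * (c * d)
  expand = solve-∀
  inner : ∀ x → Σ[ y ∈ xs ] term x y ≡ (f x ² * G + g x ² * F) - (+ 2) * (f x * g x) * S
  inner x = begin
    Σ[ y ∈ xs ] term x y
      ≡⟨ Σ-cong xs (λ y → expand (f x) (g x) (f y) (g y)) ⟩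
    Σ[ y ∈ xs ] ((f x ² * g y ² + g x ² * f y ²) - (+ 2) * (f x * g x) * (f y * g y))
      ≡⟨ Σ-minus xs (λ y → f x ² * g y ² + g x ² * f y ²) (λ y → (+ 2) * (f x * g x) * (f y * g y)) ⟩
    Σ[ y ∈ xs ] (f x ² * g y ² + g x ² * f y ²) - Σ[ y ∈ xs ] ((+ 2) * (f x * g x) * (f y * g y))
      ≡⟨ cong₂ _-_ (trans (Σ-+ xs (λ y → f x ² * g y ²) (λ y → g x ² * f y ²))
                              (cong₂ _+_ (Σ-*ˡ xs (f x ²) (λ y → g y ²)) (Σ-*ˡ xs (g x ²) (λ y → f y ²))))
                   (Σ-*ˡ xs ((+ 2) * (f x * g x)) (λ y → f y * g y)) ⟩
    (f x ² * G + g x ² * F) - (+ 2) * (f x * g x) * S ∎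
    where open ≡-Reasoning
  collect : ∀ F G S → (F * G + G * F) - (+ 2) * S * S ≡ (+ 2) * (F * G) - (+ 2) * (S * S)
  collect = solve-∀
  lagrange : Σ[ x ∈ xs ] Σ[ y ∈ xs ] term x y ≡ (+ 2) * (F * G) - (+ 2) * S ²
  lagrange = begin
    Σ[ x ∈ xs ] Σ[ y ∈ xs ] term x y
      ≡⟨ Σ-cong xs inner ⟩
    Σ[ x ∈ xs ] ((f x ² * G + g x ² * F) - (+ 2) * (f x * g x) * S)
      ≡⟨ Σ-minus xs (λ x → f x ² * G + g x ² * F) (λ x → (+ 2) * (f x * g x) * S) ⟩
    Σ[ x ∈ xs ] (f x ² * G + g x ² * F) - Σ[ x ∈ xs ] ((+ 2) * (f x * g x) * S)
      ≡⟨ cong₂ _-_ (trans (Σ-+ xs (λ x → f x ² * G) (λ x → g x ² * F))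
                              (cong₂ _+_ (Σ-*ʳ xs G (λ x → f x ²)) (Σ-*ʳ xs F (λ x → g x ²))))
                   (trans (Σ-*ʳ xs S (λ x → (+ 2) * (f x * g x)))
                          (cong (_* S) (Σ-*ˡ xs (+ 2) (λ x → f x * g x)))) ⟩
    (F * G + G * F) - (+ 2) * S * S
      ≡⟨ collect F G S ⟩
    (+ 2) * (F * G) - (+ 2) * S ² ∎
    where open ≡-Reasoning

-- Finite fields

module FieldBasics (K : FiniteField) where
  open FiniteField K public renaming (_+_ to _⊕_; _*_ to _⊗_; -_ to ⊖_)

  ring : CommutativeRing 0ℓ 0ℓ
  ring = record { isCommutativeRing = isCommutativeRing }

  private
    module R = CommutativeRing ring
    module RP = Algebra.Properties.Ring R.ring
  open import Algebra.Solver.Ring.NaturalCoefficients.Default R.commutativeSemiring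
    using (solve; _:=_; _:+_; _:*_)

  infix 4 _≟_
  -- The enumeration decides equality: two elements agree exactly when `complete` finds them at the
  -- same position of `elements`.
  _≟_ : DecidableEquality Carrier
  x ≟ y with Any.index (complete x) Fin.≟ Any.index (complete y)
  ... | yes eq = yes (trans (Any.lookup-index (complete x))
                       (trans (cong (Data.List.Base.lookup elements) eq) (sym (Any.lookup-index (complete y)))))
    where import Data.List.Base
  ... | no neq = no (λ x≡y → neq (cong (Any.index ∘ complete) x≡y))

  ⊕-cancel-⊖ʳ : ∀ x a → (x ⊕ a) ⊕ ⊖ a ≡ x
  ⊕-cancel-⊖ʳ x a = trans (R.+-assoc x a (⊖ a)) (trans (cong (x ⊕_) (R.-‿inverseʳ a)) (R.+-identityʳ x))

  ⊖-cancel-⊕ʳ : ∀ x a → (x ⊕ ⊖ a) ⊕ a ≡ x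
  ⊖-cancel-⊕ʳ x a = trans (R.+-assoc x (⊖ a) a) (trans (cong (x ⊕_) (R.-‿inverseˡ a)) (R.+-identityʳ x))

  ⊖-unique : ∀ x y → x ⊕ ⊖ y ≡ 0# → x ≡ y
  ⊖-unique x y h = trans (sym (⊖-cancel-⊕ʳ x y)) (trans (cong (_⊕ y) h) (R.+-identityˡ y))

  ⊕-cancelʳ : ∀ a {x y} → x ⊕ a ≡ y ⊕ a → x ≡ y
  ⊕-cancelʳ a {x} {y} h = trans (sym (⊕-cancel-⊖ʳ x a)) (trans (cong (_⊕ ⊖ a) h) (⊕-cancel-⊖ʳ y a))

  inv : Carrier → Carrier
  inv x with x ≟ 0#
  ... | yes _   = 0#
  ... | no x≢0 = proj₁ (inverse x x≢0)

  inv-⊗ʳ : ∀ {x} → x ≢ 0# → x ⊗ inv x ≡ 1#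
  inv-⊗ʳ {x} x≢0 with x ≟ 0#
  ... | yes x≡0  = ⊥-elim (x≢0 x≡0)
  ... | no x≢0′ = proj₂ (inverse x x≢0′)

  ⊗-inv-cancelʳ : ∀ {w} x → w ≢ 0# → (x ⊗ w) ⊗ inv w ≡ x
  ⊗-inv-cancelʳ {w} x w≢0 = trans (R.*-assoc x w (inv w)) (trans (cong (x ⊗_) (inv-⊗ʳ w≢0)) (R.*-identityʳ x))

  inv-⊗-cancelʳ : ∀ {w} x → w ≢ 0# → (x ⊗ inv w) ⊗ w ≡ x
  inv-⊗-cancelʳ {w} x w≢0 = trans (R.*-assoc x (inv w) w)
    (trans (cong (x ⊗_) (trans (R.*-comm (inv w) w) (inv-⊗ʳ w≢0))) (R.*-identityʳ x))

  ⊗-cancelʳ : ∀ {w x y} → w ≢ 0# → x ⊗ w ≡ y ⊗ w → x ≡ y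
  ⊗-cancelʳ {w} {x} {y} w≢0 h =
    trans (sym (⊗-inv-cancelʳ x w≢0)) (trans (cong (_⊗ inv w) h) (⊗-inv-cancelʳ y w≢0))

  ⊗≢0 : ∀ {x y} → x ≢ 0# → y ≢ 0# → x ⊗ y ≢ 0#
  ⊗≢0 {x} {y} x≢0 y≢0 h = x≢0 (⊗-cancelʳ y≢0 (trans h (sym (R.zeroˡ y))))

  inv≢0 : ∀ {x} → x ≢ 0# → inv x ≢ 0#
  inv≢0 {x} x≢0 h = 0≢1 (trans (sym (R.zeroʳ x)) (trans (cong (x ⊗_) (sym h)) (inv-⊗ʳ x≢0)))

  ∈elements : ∀ {x} → x ∈ elements
  ∈elements {x} = complete x

  ΣK-translate : ∀ a (φ : Carrier → ℤ) → Σ[ z ∈ elements ] φ (z ⊕ a) ≡ Σ elements φ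
  ΣK-translate a = Reindex.Σ-reindex unique unique (_⊕ a) (_⊕ ⊖ a)
    (λ x _ → ⊕-cancel-⊖ʳ x a) (λ x _ → ⊖-cancel-⊕ʳ x a) (λ _ → ∈elements) (λ _ → ∈elements)

  ΣK-translateˡ : ∀ a (φ : Carrier → ℤ) → Σ[ z ∈ elements ] φ (a ⊕ z) ≡ Σ elements φ
  ΣK-translateˡ a φ = trans (Σ-cong elements (λ z → cong φ (R.+-comm a z))) (ΣK-translate a φ)

  ≢0? : ∀ x → Dec (x ≢ 0#)
  ≢0? x = ¬? (x ≟ 0#)

  units : List Carrier
  units = filter ≢0? elements

  units-unique : Unique units
  units-unique = Unique.filter⁺ ≢0? unique

  ∈units⁺ : ∀ {x} → x ≢ 0# → x ∈ units
  ∈units⁺ x≢0 = Mem.∈-filter⁺ ≢0? ∈elements x≢0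

  ∈units⁻ : ∀ {x} → x ∈ units → x ≢ 0#
  ∈units⁻ x∈ = proj₂ (Mem.∈-filter⁻ ≢0? {xs = elements} x∈)

  elements↭ : elements ↭ 0# ∷ units
  elements↭ = unique-set⇒↭ unique (All.tabulate (λ x∈ 0≡x → ∈units⁻ x∈ (sym 0≡x)) ∷ units-unique) to (λ _ → ∈elements)
    where
    to : ∀ {x} → x ∈ elements → x ∈ 0# ∷ units
    to {x} _ with x ≟ 0#
    ... | yes refl = here refl
    ... | no x≢0  = there (∈units⁺ x≢0)

  ΣK≡ΣU : (φ : Carrier → ℤ) → Σ elements φ ≡ φ 0# + Σ units φ
  ΣK≡ΣU = Σ-↭ elements↭

  m : ℕ
  m = length units

  card≡1+m : card ≡ suc m
  card≡1+m = Perm.↭-length elements↭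

  1∈units : 1# ∈ units
  1∈units = ∈units⁺ (0≢1 ∘ sym)

  m-nonZero : NonZero m
  m-nonZero with units | 1∈units
  ... | _ ∷ _ | _ = _

  ΣU-scale : ∀ {w} → w ≢ 0# → (φ : Carrier → ℤ) → Σ[ x ∈ units ] φ (x ⊗ w) ≡ Σ units φ
  ΣU-scale {w} w≢0 = Reindex.Σ-reindex units-unique units-unique (_⊗ w) (_⊗ inv w)
    (λ x _ → ⊗-inv-cancelʳ x w≢0) (λ x _ → inv-⊗-cancelʳ x w≢0)
    (λ x∈ → ∈units⁺ (⊗≢0 (∈units⁻ x∈) w≢0)) (λ x∈ → ∈units⁺ (⊗≢0 (∈units⁻ x∈) (inv≢0 w≢0)))

  ΣU-divide : ∀ {v} → v ≢ 0# → (φ : Carrier → ℤ) → Σ[ z ∈ units ] φ (v ⊗ inv z) ≡ Σ units φ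
  ΣU-divide {v} v≢0 = Reindex.Σ-reindex units-unique units-unique v/ v/ v/v/ v/v/ v/∈ v/∈
    where
    v/ : Carrier → Carrier
    v/ z = v ⊗ inv z
    v/∈ : ∀ {z} → z ∈ units → v/ z ∈ units
    v/∈ z∈ = ∈units⁺ (⊗≢0 v≢0 (inv≢0 (∈units⁻ z∈)))
    v/v/ : ∀ z → z ∈ units → v/ (v/ z) ≡ z
    v/v/ z z∈ = ⊗-cancelʳ (∈units⁻ (v/∈ z∈)) (trans (inv-⊗-cancelʳ v (∈units⁻ (v/∈ z∈)))
      (sym (trans (R.*-comm z (v/ z)) (inv-⊗-cancelʳ v (∈units⁻ z∈)))))

  pow′ : Carrier → ℕ → Carrier
  pow′ = pow K

  pow-+ : ∀ x i j → pow′ x (i ℕ.+ j) ≡ pow′ x i ⊗ pow′ x j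
  pow-+ x zero    j = sym (R.*-identityˡ _)
  pow-+ x (suc i) j = trans (cong (x ⊗_) (pow-+ x i j)) (sym (R.*-assoc x _ _))

  pow-1 : ∀ k → pow′ 1# k ≡ 1#
  pow-1 zero    = refl
  pow-1 (suc k) = trans (R.*-identityˡ _) (pow-1 k)

  pow-⊗ : ∀ x y k → pow′ (x ⊗ y) k ≡ pow′ x k ⊗ pow′ y k
  pow-⊗ x y zero    = sym (R.*-identityˡ _)
  pow-⊗ x y (suc k) = trans (cong ((x ⊗ y) ⊗_) (pow-⊗ x y k)) (interchange x y _ _)
    where
    interchange : ∀ a b c d → (a ⊗ b) ⊗ (c ⊗ d) ≡ (a ⊗ c) ⊗ (b ⊗ d)
    interchange = solve 4 (λ a b c d → (a :* b) :* (c :* d) := (a :* c) :* (b :* d)) refl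

  pow-* : ∀ x i j → pow′ x (i · j) ≡ pow′ (pow′ x i) j
  pow-* x zero    j = sym (pow-1 j)
  pow-* x (suc i) j = trans (pow-+ x j (i · j))
    (trans (cong (pow′ x j ⊗_) (pow-* x i j)) (sym (pow-⊗ x (pow′ x i) j)))

  pow≢0 : ∀ {x} k → x ≢ 0# → pow′ x k ≢ 0#
  pow≢0 zero    x≢0 = 0≢1 ∘ sym
  pow≢0 (suc k) x≢0 = ⊗≢0 x≢0 (pow≢0 k x≢0)

  pow-cancel : ∀ {x} i k → x ≢ 0# → pow′ x i ≡ pow′ x (k ℕ.+ i) → pow′ x k ≡ 1#
  pow-cancel {x} i k x≢0 h = ⊗-cancelʳ (pow≢0 i x≢0)
    (trans (sym (pow-+ x k i)) (trans (sym h) (sym (R.*-identityˡ _))))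

  pow-∣ : ∀ {x i j} → i ∣ j → pow′ x i ≡ 1# → pow′ x j ≡ 1#
  pow-∣ {x} {i} (divides q refl) h = trans (cong (pow′ x) (ℕ.*-comm q i))
    (trans (pow-* x i q) (trans (cong (λ y → pow′ y q) h) (pow-1 q)))

  -- Multiplication by x permutes the units, so their product P satisfies P = xᵐ P.
  fermat : ∀ {x} → x ≢ 0# → pow′ x m ≡ 1#
  fermat {x} x≢0 = ⊗-cancelʳ (∏≢0 units ∈units⁻)
    (trans (sym (∏-scale units)) (trans ∏-permute (sym (R.*-identityˡ _))))
    where
    ∏ : List Carrier → Carrier
    ∏ = foldr _⊗_ 1#
    ∏≢0 : ∀ ys → (∀ {y} → y ∈ ys → y ≢ 0#) → ∏ ys ≢ 0#
    ∏≢0 []       h = 0≢1 ∘ sym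
    ∏≢0 (y ∷ ys) h = ⊗≢0 (h (here refl)) (∏≢0 ys (h ∘ there))
    interchange : ∀ a b c d → (a ⊗ b) ⊗ (c ⊗ d) ≡ (b ⊗ c) ⊗ (a ⊗ d)
    interchange = solve 4 (λ a b c d → (a :* b) :* (c :* d) := (b :* c) :* (a :* d)) refl
    ∏-scale : ∀ ys → ∏ (map (_⊗ x) ys) ≡ pow′ x (length ys) ⊗ ∏ ys
    ∏-scale []       = sym (R.*-identityˡ _)
    ∏-scale (y ∷ ys) = trans (cong ((y ⊗ x) ⊗_) (∏-scale ys)) (interchange y x _ _)
    ∏-permute : ∏ (map (_⊗ x) units) ≡ ∏ units
    ∏-permute = SetoidPerm.foldr-commMonoid (setoid Carrier) R.*-isCommutativeMonoid (↭⇒↭ₛ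
      (Reindex.map↭ units-unique units-unique (_⊗ x) (_⊗ inv x)
        (λ y _ → ⊗-inv-cancelʳ y x≢0) (λ y _ → inv-⊗-cancelʳ y x≢0)
        (λ y∈ → ∈units⁺ (⊗≢0 (∈units⁻ y∈) x≢0)) (λ y∈ → ∈units⁺ (⊗≢0 (∈units⁻ y∈) (inv≢0 x≢0)))))

  -- Polynomial functions of formal degree k with leading coefficient l, through the existence of
  -- the difference quotient g at every a; f(x) − f(a) = (x − a) g(x) is written without subtraction.
  Poly : ℕ → Carrier → (Carrier → Carrier) → Set
  Poly zero    l f = ∀ x → f x ≡ l
  Poly (suc k) l f = ∀ a → ∃ λ g → Poly k l g × (∀ x → f x ⊕ a ⊗ g x ≡ f a ⊕ x ⊗ g x)

  poly-+ : ∀ k {l l′ f f′} → Poly k l f → Poly k l′ f′ → Poly k (l ⊕ l′) (λ x → f x ⊕ f′ x)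
  poly-+ zero    h h′ x = cong₂ _⊕_ (h x) (h′ x)
  poly-+ (suc k) {f = f} {f′} h h′ a with g , pg , eq ← h a | g′ , pg′ , eq′ ← h′ a =
    _ , poly-+ k pg pg′ , λ x → trans (split a (f x) (f′ x) (g x) (g′ x))
      (trans (cong₂ _⊕_ (eq x) (eq′ x)) (sym (split x (f a) (f′ a) (g x) (g′ x))))
    where
    split : ∀ a u v w z → (u ⊕ v) ⊕ a ⊗ (w ⊕ z) ≡ (u ⊕ a ⊗ w) ⊕ (v ⊕ a ⊗ z)
    split = solve 5 (λ a u v w z → (u :+ v) :+ a :* (w :+ z) := (u :+ a :* w) :+ (v :+ a :* z)) refl

  poly-scale : ∀ k c {l f} → Poly k l f → Poly k (c ⊗ l) (λ x → c ⊗ f x)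
  poly-scale zero    c h x = cong (c ⊗_) (h x)
  poly-scale (suc k) c {f = f} h a with g , pg , eq ← h a =
    _ , poly-scale k c pg , λ x → trans (pull c (f x) a (g x)) (trans (cong (c ⊗_) (eq x)) (sym (pull c (f a) x (g x))))
    where
    pull : ∀ c u a w → c ⊗ u ⊕ a ⊗ (c ⊗ w) ≡ c ⊗ (u ⊕ a ⊗ w)
    pull = solve 4 (λ c u a w → c :* u :+ a :* (c :* w) := c :* (u :+ a :* w)) refl

  poly-raise : ∀ k {l f} → Poly k l f → Poly (suc k) 0# f
  poly-raise zero    h a = (λ _ → 0#) , (λ _ → refl) , λ x →
    cong₂ _⊕_ (trans (h x) (sym (h a))) (trans (R.zeroʳ a) (sym (R.zeroʳ x)))
  poly-raise (suc k) h a with g , pg , eq ← h a = g , poly-raise k pg , eq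

  -- The difference quotient comes from x f(x) - a f(a) = (x - a) (f(x) + a g(x)).
  poly-shift : ∀ k {l f} → Poly k l f → Poly (suc k) l (λ x → x ⊗ f x)
  poly-shift zero {l} h a = (λ _ → l) , (λ _ → refl) , λ x →
    trans (cong (λ y → x ⊗ y ⊕ a ⊗ l) (h x))
      (trans (R.+-comm (x ⊗ l) (a ⊗ l)) (cong (λ y → a ⊗ y ⊕ x ⊗ l) (sym (h a))))
  poly-shift (suc k) {l} {f} h a with g , pg , eq ← h a =
    (λ x → f x ⊕ a ⊗ g x) ,
    subst (λ l′ → Poly (suc k) l′ _) (R.+-identityʳ l) (poly-+ (suc k) h (poly-raise k (poly-scale k a pg))) ,
    λ x → trans (cong (λ y → x ⊗ f x ⊕ a ⊗ y) (eq x)) (regroup x a (f x) (f a) (g x))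
    where
    regroup : ∀ x a u v w → x ⊗ u ⊕ a ⊗ (v ⊕ x ⊗ w) ≡ a ⊗ v ⊕ x ⊗ (u ⊕ a ⊗ w)
    regroup = solve 5 (λ x a u v w → x :* u :+ a :* (v :+ x :* w) := a :* v :+ x :* (u :+ a :* w)) refl

  poly-pow : ∀ k → Poly k 1# (λ x → pow′ x k)
  poly-pow zero    x = refl
  poly-pow (suc k)   = poly-shift k (poly-pow k)

  -- Without zero divisors, every root other than `a` is a root of the difference quotient at `a`,
  -- which has lower degree and the same leading coefficient.
  poly-roots : ∀ k {l f} → Poly k l f → l ≢ 0# → ∀ {xs} → Unique xs → (∀ {x} → x ∈ xs → f x ≡ 0#) → length xs ℕ.≤ k
  poly-roots k h l≢0 {[]} u roots = z≤n
  poly-roots zero h l≢0 {x ∷ xs} u roots = ⊥-elim (l≢0 (trans (sym (h x)) (roots (here refl))))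
  poly-roots (suc k) {f = f} h l≢0 {a ∷ xs} u@(_ ∷ u′) roots with g , pg , eq ← h a =
    s≤s (poly-roots k pg l≢0 u′ g-root)
    where
    g-root : ∀ {x} → x ∈ xs → g x ≡ 0#
    g-root {x} x∈ with g x ≟ 0#
    ... | yes gx≡0 = gx≡0
    ... | no  gx≢0 = ⊥-elim (≢-of-Unique u x∈ (⊗-cancelʳ gx≢0 (⊕-cancelʳ 0#
            (trans (R.+-comm _ 0#) (trans (cong (_⊕ a ⊗ g x) (sym (roots (there x∈))))
              (trans (eq x) (trans (cong (_⊕ x ⊗ g x) (roots (here refl))) (R.+-comm 0# _))))))))

  roots-of-unity≤ : ∀ k {xs} → Unique xs → (∀ {x} → x ∈ xs → pow′ x (suc k) ≡ 1#) → length xs ℕ.≤ suc k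
  roots-of-unity≤ k u h = poly-roots (suc k)
    (poly-+ (suc k) (poly-pow (suc k)) (constant k (⊖ 1#)))
    (λ e → 0≢1 (trans (sym e) (R.+-identityʳ 1#))) u
    (λ x∈ → trans (cong (_⊕ ⊖ 1#) (h x∈)) (R.-‿inverseʳ 1#))
    where
    constant : ∀ k c → Poly (suc k) 0# (λ _ → c)
    constant zero    c = poly-raise zero (λ _ → refl)
    constant (suc k) c = poly-raise (suc k) (constant k c)

-- Cyclicity of the multiplicative group

prime∤⇒coprime : ∀ {p n} → Prime p → p ∤ n → Coprime p n
prime∤⇒coprime pp p∤n {d} (d∣p , d∣n) with Prime.prime⇒irreducible pp d∣p
... | inj₁ d≡1 = d≡1
... | inj₂ refl = ⊥-elim (p∤n d∣n)

prime∣prime⇒≡ : ∀ {p r} → Prime p → Prime r → p ∣ r → p ≡ r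
prime∣prime⇒≡ pp pr p∣r with Prime.prime⇒irreducible pr p∣r
... | inj₁ refl = ⊥-elim (Prime.¬prime[1] pp)
... | inj₂ p≡r  = p≡r

prime∣product⇒∈ : ∀ {p} ps → Prime p → All Prime ps → p ∣ product ps → p ∈ ps
prime∣product⇒∈ []       pp []         p∣1 = ⊥-elim (Prime.¬prime[1] (subst Prime (ℕ.∣1⇒≡1 p∣1) pp))
prime∣product⇒∈ (r ∷ ps) pp (pr ∷ prs) p∣  with euclidsLemma r (product ps) pp p∣
... | inj₁ p∣r = here (prime∣prime⇒≡ pp pr p∣r)
... | inj₂ p∣ps = there (prime∣product⇒∈ ps pp prs p∣ps)

∃-prime-divisor : ∀ {n} → n ≢ 0 → n ≢ 1 → ∃ λ p → Prime p × p ∣ n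
∃-prime-divisor {n} n≢0 n≢1 = go (factors) isFactorisation factorsPrime
  where
  instance _ = ℕ.≢-nonZero n≢0
  open PrimeFactorisation (factorise n)
  go : ∀ ps → n ≡ product ps → All Prime ps → ∃ λ p → Prime p × p ∣ n
  go []       eq _        = ⊥-elim (n≢1 eq)
  go (p ∷ ps) eq (pp ∷ _) = p , pp , subst (p ∣_) (sym eq) (ℕ.m∣m*n (product ps))

prime-power-part : ∀ {p} → Prime p → ∀ n → n ≢ 0 → ∃ λ a → ∃ λ c → n ≡ p ^ a · c × p ∤ c
prime-power-part {p} pp = <-rec _ step
  where
  instance _ = prime⇒nonTrivial pp
  step : ∀ n → (∀ {k} → k ℕ.< n → k ≢ 0 → ∃ λ a → ∃ λ c → k ≡ p ^ a · c × p ∤ c) →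
    n ≢ 0 → ∃ λ a → ∃ λ c → n ≡ p ^ a · c × p ∤ c
  step n rec n≢0 with p ∣? n
  ... | no p∤n = 0 , n , sym (ℕ.*-identityˡ n) , p∤n
  ... | yes (divides k refl) = descend (rec k<n k≢0)
    where
    k≢0 : k ≢ 0
    k≢0 refl = n≢0 refl
    k<n : k ℕ.< k · p
    k<n = let instance _ = ℕ.≢-nonZero k≢0 in ℕ.m<m*n k p (ℕ.nonTrivial⇒n>1 p)
    rotate : ∀ x c p → x · c · p ≡ p · x · c
    rotate = ℕ-solve
    descend : (∃ λ a → ∃ λ c → k ≡ p ^ a · c × p ∤ c) → _
    descend (a , c , eq , p∤c) = suc a , c , trans (cong (_· p) eq) (rotate (p ^ a) c p) , p∤c

coprime-* : ∀ {a b n} → Coprime a n → Coprime b n → Coprime (a · b) n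
coprime-* {a} {b} {n} ca cb {d} (d∣ab , d∣n) = cb (Coprime.coprime-divisor d⊥a d∣ab , d∣n)
  where
  d⊥a : Coprime d a
  d⊥a (e∣d , e∣a) = ca (e∣a , ℕ.∣-trans e∣d d∣n)

coprime-^ : ∀ {a n} k → Coprime a n → Coprime (a ^ k) n
coprime-^ zero    c (d∣1 , _) = ℕ.∣1⇒≡1 d∣1
coprime-^ {a} {n} (suc k) c = coprime-* {a} {a ^ k} {n} c (coprime-^ k c)

extract : {x : A} {ys : List A} → x ∈ ys → ∃ λ zs → ys ↭ x ∷ zs
extract {x = x} x∈ with ys , zs , refl ← Mem.∈-∃++ x∈ = ys ++ zs , Perm.shift x ys zs

unique-⊆⇒length≤ : {xs ys : List A} → Unique xs → (∀ {x} → x ∈ xs → x ∈ ys) → length xs ℕ.≤ length ys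
unique-⊆⇒length≤ {xs = []} u ⊆ = z≤n
unique-⊆⇒length≤ {xs = x ∷ xs} {ys} u@(_ ∷ u′) ⊆ with zs , ys↭ ← extract (⊆ (here refl)) =
  subst (suc (length xs) ℕ.≤_) (sym (Perm.↭-length ys↭)) (s≤s (unique-⊆⇒length≤ u′ ⊆′))
  where
  ⊆′ : ∀ {y} → y ∈ xs → y ∈ zs
  ⊆′ y∈ with Perm.∈-resp-↭ ys↭ (⊆ (there y∈))
  ... | here y≡x = ⊥-elim (≢-of-Unique u y∈ (sym y≡x))
  ... | there y∈zs = y∈zs

primeDivisor? : ∀ n p → Dec (Prime p × p ∣ n)
primeDivisor? n p = prime? p ×-dec p ∣? n

primeDivisors : ℕ → List ℕ
primeDivisors n = filter (primeDivisor? n) (upTo (suc n))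

primeDivisors-unique : ∀ n → Unique (primeDivisors n)
primeDivisors-unique n = Unique.filter⁺ (primeDivisor? n) (Unique.upTo⁺ (suc n))

∈primeDivisors⁻ : ∀ {n p} → p ∈ primeDivisors n → Prime p × p ∣ n
∈primeDivisors⁻ {n} p∈ = proj₂ (Mem.∈-filter⁻ (primeDivisor? n) {xs = upTo (suc n)} p∈)

∈primeDivisors⁺ : ∀ {n p} .{{_ : NonZero n}} → Prime p → p ∣ n → p ∈ primeDivisors n
∈primeDivisors⁺ {n} pp p∣n =
  Mem.∈-filter⁺ (primeDivisor? n) (Mem.∈-upTo⁺ (s≤s (ℕ.∣⇒≤ p∣n))) (pp , p∣n)

module CyclicGroup (K : FiniteField) where
  open FieldBasics K public

  private
    module R = CommutativeRing ring
    instance _ = m-nonZero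

  HasFullOrder : Carrier → Set
  HasFullOrder x = ∀ k → pow′ x k ≡ 1# → m ∣ k

  pow-GCD : ∀ {x i j d} → x ≢ 0# → GCD i j d → pow′ x i ≡ 1# → pow′ x j ≡ 1# → pow′ x d ≡ 1#
  pow-GCD {x} {i} {j} {d} x≢0 g xi≡1 xj≡1 with Bézout.identity g
  ... | Bézout.+- u v eq = begin
    pow′ x d  ≡⟨ R.*-identityʳ _ ⟨
    pow′ x d ⊗ 1#  ≡⟨ cong (pow′ x d ⊗_) (pow-∣ (ℕ.n∣m*n v) xj≡1) ⟨
    pow′ x d ⊗ pow′ x (v · j)  ≡⟨ pow-+ x d (v · j) ⟨
    pow′ x (d ℕ.+ v · j)  ≡⟨ cong (pow′ x) eq ⟩
    pow′ x (u · i)  ≡⟨ pow-∣ (ℕ.n∣m*n u) xi≡1 ⟩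
    1#  ∎
    where open ≡-Reasoning
  ... | Bézout.-+ u v eq = begin
    pow′ x d  ≡⟨ R.*-identityʳ _ ⟨
    pow′ x d ⊗ 1#  ≡⟨ cong (pow′ x d ⊗_) (pow-∣ (ℕ.n∣m*n u) xi≡1) ⟨
    pow′ x d ⊗ pow′ x (u · i)  ≡⟨ pow-+ x d (u · i) ⟨
    pow′ x (d ℕ.+ u · i)  ≡⟨ cong (pow′ x) eq ⟩
    pow′ x (v · j)  ≡⟨ pow-∣ (ℕ.n∣m*n v) xj≡1 ⟩
    1#  ∎
    where open ≡-Reasoning

  -- By Bézout, x is killed by gcd(m, k). If this is not m, some prime p divides m / gcd(m, k), so
  -- the gcd divides m / p and x^(m/p) = 1.
  fullOrder : ∀ {x} → x ≢ 0# → (∀ {p e} → Prime p → m ≡ p · e → pow′ x e ≢ 1#) → HasFullOrder x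
  fullOrder {x} x≢0 noRoot k xk≡1 with GCD.commonDivisor g
    where g = gcd-GCD m k
  ... | divides h m≡h*g , g∣k with h ℕ.≟ 1
  ...   | yes refl = subst (_∣ k) (sym (trans m≡h*g (ℕ.*-identityˡ _))) g∣k
  ...   | no h≢1 with p , pp , divides h′ refl ← ∃-prime-divisor (λ { refl → ℕ.≢-nonZero⁻¹ m m≡h*g }) h≢1 =
    ⊥-elim (noRoot pp (trans m≡h*g (rotate h′ p (gcd m k)))
      (pow-∣ (ℕ.n∣m*n h′) (pow-GCD x≢0 (gcd-GCD m k) (fermat x≢0) xk≡1)))
    where
    rotate : ∀ h p g → h · p · g ≡ p · (h · g)
    rotate = ℕ-solve

  -- Makes divisibility of a logarithm by p ∣ m a property of the element, whichever exponent is
  -- chosen to represent it.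
  fullOrder⇒∣ : ∀ {x p i j} → x ≢ 0# → HasFullOrder x → p ∣ m → pow′ x i ≡ pow′ x j → p ∣ i → p ∣ j
  fullOrder⇒∣ {x} {p} {i} {j} x≢0 full p∣m eq p∣i with ℕ.≤-total i j
  ... | inj₁ i≤j = subst (p ∣_) (ℕ.m∸n+n≡m i≤j) (ℕ.∣m∣n⇒∣m+n (ℕ.∣-trans p∣m m∣) p∣i)
    where
    m∣ : m ∣ j ∸ i
    m∣ = full _ (pow-cancel i (j ∸ i) x≢0 (trans eq (cong (pow′ x) (sym (ℕ.m∸n+n≡m i≤j)))))
  ... | inj₂ j≤i = ℕ.∣m+n∣m⇒∣n (subst (p ∣_) (sym (ℕ.m∸n+n≡m j≤i)) p∣i) (ℕ.∣-trans p∣m m∣)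
    where
    m∣ : m ∣ i ∸ j
    m∣ = full _ (pow-cancel j (i ∸ j) x≢0 (trans (sym eq) (cong (pow′ x) (sym (ℕ.m∸n+n≡m j≤i)))))

  -- Pigeonhole: m distinct powers of x together with a unit outside them would be m + 1 units.
  fullOrder⇒generates : ∀ {x} → x ≢ 0# → HasFullOrder x → ∀ y → y ≢ 0# → ∃ λ k → y ≡ pow′ x k
  fullOrder⇒generates {x} x≢0 full y y≢0 with Any.any? (y ≟_) (applyUpTo (pow′ x) m)
  ... | yes found = let k , _ , eq = Mem.∈-applyUpTo⁻ (pow′ x) found in k , eq
  ... | no missing = ⊥-elim (ℕ.1+n≰n (subst (ℕ._≤ m) (cong suc (List.length-applyUpTo (pow′ x) m))
          (unique-⊆⇒length≤ (All.tabulate (λ z∈ y≡z → missing (subst (_∈ _) (sym y≡z) z∈))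
                              ∷ Unique.applyUpTo⁺₁ (pow′ x) m distinct) ⊆units)))
    where
    ⊆units : ∀ {z} → z ∈ y ∷ applyUpTo (pow′ x) m → z ∈ units
    ⊆units (here refl) = ∈units⁺ y≢0
    ⊆units (there z∈) with k , _ , refl ← Mem.∈-applyUpTo⁻ (pow′ x) z∈ = ∈units⁺ (pow≢0 k x≢0)
    distinct : ∀ {i j} → i ℕ.< j → j ℕ.< m → pow′ x i ≢ pow′ x j
    distinct {i} {j} i<j j<m eq = ℕ.<⇒≱ j<m (ℕ.≤-trans (ℕ.∣⇒≤ m∣) (ℕ.m∸n≤m j i))
      where
      instance _ = ℕ.>-nonZero (ℕ.m<n⇒0<n∸m i<j)
      m∣ : m ∣ j ∸ i
      m∣ = full _ (pow-cancel i (j ∸ i) x≢0 (trans eq (cong (pow′ x) (sym (ℕ.m∸n+n≡m (ℕ.<⇒≤ i<j))))))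

  -- Otherwise all m units would be roots of X^e - 1, although e < m.
  nonRoot : ∀ {p e} → Prime p → m ≡ p · e → ∃ λ y → y ≢ 0# × pow′ y e ≢ 1#
  nonRoot {p} {zero} pp m≡ = ⊥-elim (ℕ.≢-nonZero⁻¹ m (trans m≡ (ℕ.*-zeroʳ p)))
  nonRoot {p} {suc e} pp m≡ with Any.any? (λ y → ¬? (pow′ y (suc e) ≟ 1#)) units
  ... | yes found = let y , y∈ , y-ok = find found in y , ∈units⁻ y∈ , y-ok
  ... | no none = ⊥-elim (ℕ.<⇒≱ e<m (roots-of-unity≤ e units-unique root))
    where
    instance _ = prime⇒nonTrivial pp
    e<m : suc e ℕ.< m
    e<m = subst (suc e ℕ.<_) (trans (ℕ.*-comm (suc e) p) (sym m≡)) (ℕ.m<m*n (suc e) p (ℕ.nonTrivial⇒n>1 p))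
    root : ∀ {y} → y ∈ units → pow′ y (suc e) ≡ 1#
    root {y} y∈ with pow′ y (suc e) ≟ 1#
    ... | yes eq = eq
    ... | no neq = ⊥-elim (none (Any.map (λ { refl → neq }) y∈))

  -- Orders are observed through the exponents m / p: for a unit x, `NoRoot p x` says that the order
  -- of x contains the full power of p in m.
  NoRoot KillsOthers : ℕ → Carrier → Set
  NoRoot      p x = ∀ {e} → m ≡ p · e → pow′ x e ≢ 1#
  KillsOthers p x = ∀ {r e} → Prime r → r ≢ p → m ≡ r · e → pow′ x e ≡ 1#

  -- With m = pᵃ c and y not a p-th power, yᶜ has order pᵃ.
  localGenerator : ∀ {p} → Prime p → p ∣ m → ∃ λ x → x ≢ 0# × NoRoot p x × KillsOthers p x
  localGenerator {p} pp (divides f m≡f*p)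
    with a , c , m≡ , p∤c ← prime-power-part pp m (ℕ.≢-nonZero⁻¹ m)
    with y , y≢0 , yᶠ≢1 ← nonRoot pp (trans m≡f*p (ℕ.*-comm f p)) =
    pow′ y c , pow≢0 c y≢0 , noRoot , kills
    where
    instance _ = prime⇒nonZero pp
    noRoot : NoRoot p (pow′ y c)
    noRoot {e} m≡p*e h = yᶠ≢1 (trans (cong (pow′ y) (sym e≡f)) (trans (sym (R.*-identityʳ _)) t≡1))
      where
      e≡f : e ≡ f
      e≡f = ℕ.*-cancelˡ-≡ e f p (trans (sym m≡p*e) (trans m≡f*p (ℕ.*-comm f p)))
      -- If pow′ y c were killed by e = m / p, then t would be killed by the coprime exponents p and
      -- c, hence be 1, against the choice of y.
      t = pow′ y e
      tᵖ≡1 : pow′ t p ≡ 1#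
      tᵖ≡1 = trans (sym (pow-* y e p)) (trans (cong (pow′ y) (trans (ℕ.*-comm e p) (sym m≡p*e))) (fermat y≢0))
      tᶜ≡1 : pow′ t c ≡ 1#
      tᶜ≡1 = trans (sym (pow-* y e c)) (trans (cong (pow′ y) (ℕ.*-comm e c)) (trans (pow-* y c e) h))
      t≡1 : pow′ t 1 ≡ 1#
      t≡1 = pow-GCD (pow≢0 e y≢0) (Coprime.coprime⇒GCD≡1 (prime∤⇒coprime pp p∤c)) tᵖ≡1 tᶜ≡1
    kills : KillsOthers p (pow′ y c)
    kills {r} {e} pr r≢p m≡r*e = trans (sym (pow-* y c e)) (pow-∣ m∣c*e (fermat y≢0))
      where
      pᵃ∣e : p ^ a ∣ e
      pᵃ∣e = Coprime.coprime-divisor (coprime-^ a (prime∤⇒coprime pp (λ p∣r → r≢p (sym (prime∣prime⇒≡ pp pr p∣r)))))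
        (divides c (trans (sym m≡r*e) (trans m≡ (ℕ.*-comm (p ^ a) c))))
      m∣c*e : m ∣ c · e
      m∣c*e = subst (_∣ c · e) (trans (ℕ.*-comm c _) (sym m≡)) (ℕ.*-monoʳ-∣ c pᵃ∣e)

  -- At the exponent m / p all local factors but the one for p become 1, so nothing can cancel it.
  -- The last component carries this through the induction.
  product-of-localGenerators : ∀ ps → Unique ps → All (λ p → Prime p × p ∣ m) ps →
    ∃ λ x → x ≢ 0# × (∀ {p} → p ∈ ps → NoRoot p x) ×
      (∀ {r e} → Prime r → r ∉ ps → m ≡ r · e → pow′ x e ≡ 1#)
  product-of-localGenerators [] u [] = 1# , (0≢1 ∘ sym) , (λ ()) , λ {r} {e} _ _ _ → pow-1 e
  product-of-localGenerators (p ∷ ps) u@(_ ∷ u′) ((pp , p∣m) ∷ divs)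
    with y , y≢0 , noRoot , kills ← localGenerator pp p∣m
    with x , x≢0 , noRoots , killed ← product-of-localGenerators ps u′ divs =
    y ⊗ x , ⊗≢0 y≢0 x≢0 , noRoots′ , killed′
    where
    killed′ : ∀ {r e} → Prime r → r ∉ p ∷ ps → m ≡ r · e → pow′ (y ⊗ x) e ≡ 1#
    killed′ {r} {e} pr r∉ m≡ = trans (pow-⊗ y x e)
      (trans (cong₂ _⊗_ (kills pr (r∉ ∘ here) m≡) (killed pr (r∉ ∘ there) m≡)) (R.*-identityʳ _))
    noRoots′ : ∀ {r} → r ∈ p ∷ ps → NoRoot r (y ⊗ x)
    noRoots′ (here refl) {e} m≡ h = noRoot m≡ (trans (sym (R.*-identityʳ _))
      (trans (cong (pow′ y e ⊗_) (sym (killed pp (λ p∈ → ≢-of-Unique u p∈ refl) m≡)))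
        (trans (sym (pow-⊗ y x e)) h)))
    noRoots′ {r} (there r∈) {e} m≡ h = noRoots r∈ m≡ (trans (sym (R.*-identityˡ _))
      (trans (cong (_⊗ pow′ x e) (sym (kills (proj₁ (All.lookup divs r∈)) (λ r≡p → ≢-of-Unique u r∈ (sym r≡p)) m≡)))
        (trans (sym (pow-⊗ y x e)) h)))

  ps : List ℕ
  ps = primeDivisors m

  generator : ∃ λ γ → γ ≢ 0# × HasFullOrder γ
  generator with γ , γ≢0 , noRoots , _ ← product-of-localGenerators ps (primeDivisors-unique m)
                                            (All.tabulate (∈primeDivisors⁻ {m})) =
    γ , γ≢0 , fullOrder γ≢0 (λ {p} {e} pp m≡ → noRoots (∈primeDivisors⁺ {m} pp (subst (p ∣_) (sym m≡) (ℕ.m∣m*n e))) m≡)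

-- Ramanujan sums of the discrete logarithm

Σ-linear₃ : (xs : List A) (a b c : ℤ) (f g h : A → ℤ) →
  Σ[ x ∈ xs ] (a * f x + b * g x + c * h x) ≡ a * Σ xs f + b * Σ xs g + c * Σ xs h
Σ-linear₃ xs a b c f g h = trans (Σ-+ xs (λ x → a * f x + b * g x) (λ x → c * h x))
  (cong₂ _+_ (trans (Σ-+ xs (λ x → a * f x) (λ x → b * g x)) (cong₂ _+_ (Σ-*ˡ xs a f) (Σ-*ˡ xs b g))) (Σ-*ˡ xs c h))

𝟙-*-cong : {P Q S : Set} (d : Dec P) (e : Dec Q) (s : Dec S) → (S → P → Q) → (S → Q → P) → 𝟙 d * 𝟙 s ≡ 𝟙 e * 𝟙 s
𝟙-*-cong d e (yes s) f g = cong (_* 1ℤ) (𝟙-cong d e (f s) (g s))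
𝟙-*-cong d e (no _)  f g = trans (ℤ.*-zeroʳ (𝟙 d)) (sym (ℤ.*-zeroʳ (𝟙 e)))

-- As e is invertible modulo p, exactly one of a, a + e, ..., a + (p - 1) e is divisible by p.
module Progression {p} (pp : Prime p) {e} (p∤e : p ∤ e) (a : ℕ) where
  private instance _ = prime⇒nonZero pp

  difference : ∀ {i j} → i ℕ.≤ j → p ∣ a ℕ.+ i · e → p ∣ a ℕ.+ j · e → p ∣ j ∸ i
  difference {i} {j} i≤j hi hj with euclidsLemma (j ∸ i) e pp (ℕ.∣m+n∣m⇒∣n (subst (p ∣_) eq hj) hi)
    where
    shuffle : ∀ a k i e → a ℕ.+ (k ℕ.+ i) · e ≡ a ℕ.+ i · e ℕ.+ k · e
    shuffle = ℕ-solve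
    eq : a ℕ.+ j · e ≡ a ℕ.+ i · e ℕ.+ (j ∸ i) · e
    eq = trans (cong (λ k → a ℕ.+ k · e) (sym (ℕ.m∸n+n≡m i≤j))) (shuffle a (j ∸ i) i e)
  ... | inj₁ p∣ = p∣
  ... | inj₂ p∣e = ⊥-elim (p∤e p∣e)

  difference≡0 : ∀ {i j} → i ℕ.≤ j → j ℕ.< p → p ∣ j ∸ i → i ≡ j
  difference≡0 {i} {j} i≤j j<p p∣ with j ∸ i in eq
  ... | zero  = ℕ.≤-antisym i≤j (ℕ.m∸n≡0⇒m≤n eq)
  ... | suc k = ⊥-elim (ℕ.<⇒≱ j<p (ℕ.≤-trans (ℕ.∣⇒≤ p∣) (subst (ℕ._≤ j) eq (ℕ.m∸n≤m j i))))

  hit-unique : ∀ {i j} → i ℕ.< p → j ℕ.< p → p ∣ a ℕ.+ i · e → p ∣ a ℕ.+ j · e → i ≡ j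
  hit-unique {i} {j} i<p j<p hi hj with ℕ.≤-total i j
  ... | inj₁ i≤j = difference≡0 i≤j j<p (difference i≤j hi hj)
  ... | inj₂ j≤i = sym (difference≡0 j≤i i<p (difference j≤i hj hi))

  hit-reduce : ∀ j → p ∣ a ℕ.+ j · e → p ∣ a ℕ.+ (j ℕ.% p) · e
  hit-reduce j h = ℕ.∣m+n∣m⇒∣n (subst (p ∣_) eq h) (divides (j ℕ./ p · e) refl)
    where
    shuffle : ∀ a r d p e → a ℕ.+ (r ℕ.+ d · p) · e ≡ d · e · p ℕ.+ (a ℕ.+ r · e)
    shuffle = ℕ-solve
    eq : a ℕ.+ j · e ≡ j ℕ./ p · e · p ℕ.+ (a ℕ.+ (j ℕ.% p) · e)
    eq = trans (cong (λ k → a ℕ.+ k · e) (ℕ.m≡m%n+[m/n]*n j p)) (shuffle a (j ℕ.% p) (j ℕ./ p) p e)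

  hit : ∃ λ j → p ∣ a ℕ.+ j · e
  hit with Coprime.coprime-Bézout (prime∤⇒coprime pp p∤e)
  ... | Bézout.+- u v eq = v · a , divides (a · u) (trans (pull a v e) (trans (cong (a ·_) eq) (sym (ℕ.*-assoc a u p))))
    where
    pull : ∀ a v e → a ℕ.+ v · a · e ≡ a · (1 ℕ.+ v · e)
    pull = ℕ-solve
  -- Here v e ≡ 1 modulo p instead of -1; the missing sign is supplied by the factor p - 1.
  ... | Bézout.-+ u v eq = pred p · (v · a) , divides (a ℕ.+ pred p · (a · u)) (begin
      a ℕ.+ pred p · (v · a) · e  ≡⟨ regroup a (pred p) v e ⟩
      a ℕ.+ pred p · (a · (v · e))  ≡⟨ cong (λ z → a ℕ.+ pred p · (a · z)) eq ⟨
      a ℕ.+ pred p · (a · (1 ℕ.+ u · p))  ≡⟨ expand a (pred p) u p ⟩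
      suc (pred p) · a ℕ.+ pred p · (a · u) · p
        ≡⟨ cong (λ z → z · a ℕ.+ pred p · (a · u) · p) (ℕ.suc-pred p) ⟩
      p · a ℕ.+ pred p · (a · u) · p  ≡⟨ collect p a (pred p · (a · u)) ⟩
      (a ℕ.+ pred p · (a · u)) · p  ∎)
    where
    open ≡-Reasoning
    regroup : ∀ a t v e → a ℕ.+ t · (v · a) · e ≡ a ℕ.+ t · (a · (v · e))
    regroup = ℕ-solve
    expand : ∀ a t u p → a ℕ.+ t · (a · (1 ℕ.+ u · p)) ≡ (1 ℕ.+ t) · a ℕ.+ t · (a · u) · p
    expand = ℕ-solve
    collect : ∀ p a z → p · a ℕ.+ z · p ≡ (a ℕ.+ z) · p
    collect = ℕ-solve

  Σ-hits : Σ[ j ∈ upTo p ] 𝟙 (p ∣? a ℕ.+ j · e) ≡ 1ℤ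
  Σ-hits with j , hj ← hit = trans
    (Σ-only (Unique.upTo⁺ p) (Mem.∈-upTo⁺ (ℕ.m%n<n j p))
      (λ {i} i∈ i≢ → 𝟙-no (p ∣? a ℕ.+ i · e) (λ hi → i≢ (hit-unique (Mem.∈-upTo⁻ i∈) (ℕ.m%n<n j p) hi (hit-reduce j hj)))))
    (𝟙-yes (p ∣? a ℕ.+ (j ℕ.% p) · e) (hit-reduce j hj))

-- For D > 0 this is |e| ≤ c √(N / D), with root and quotient cleared to stay in ℤ.
record Small (D N c e : ℤ) : Set where
  constructor small
  field
    nonneg : 0ℤ ≤ c
    bound  : D * e ² ≤ c ² * N

module _ {D N : ℤ} (0≤D : 0ℤ ≤ D) (0≤N : 0ℤ ≤ N) where

  -- The triangle inequality for |e|: the cross term D e e′ is compared with c c′ N after squaring,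
  -- where it is the product of the two bounds.
  Small-+ : ∀ {c c′ e e′} → Small D N c e → Small D N c′ e′ → Small D N (c + c′) (e + e′)
  Small-+ {c} {c′} {e} {e′} (small 0≤c h) (small 0≤c′ h′) = small (ℤ.+-mono-≤ 0≤c 0≤c′)
    (subst₂ _≤_ (sym (expand D e e′)) (sym (collect c c′ N))
      (ℤ.+-mono-≤ (ℤ.+-mono-≤ h h′) (ℤ.*-monoˡ-≤-nonNeg (+ 2) cross)))
    where
    expand : ∀ D e e′ → D * ((e + e′) * (e + e′)) ≡ D * (e * e) + D * (e′ * e′) + (+ 2) * (D * (e * e′))
    expand = solve-∀
    collect : ∀ c c′ N → (c + c′) * (c + c′) * N ≡ c * c * N + c′ * c′ * N + (+ 2) * (c * c′ * N)
    collect = solve-∀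
    pair : ∀ D e e′ → D * (e * e′) * (D * (e * e′)) ≡ D * (e * e) * (D * (e′ * e′))
    pair = solve-∀
    pair′ : ∀ c c′ N → c * c * N * (c′ * c′ * N) ≡ c * c′ * N * (c * c′ * N)
    pair′ = solve-∀
    cross : D * (e * e′) ≤ c * c′ * N
    cross = square-cancel-≤ (0≤* (0≤* 0≤c 0≤c′) 0≤N)
      (subst₂ _≤_ (sym (pair D e e′)) (pair′ c c′ N) (*-mono-≤ (0≤* 0≤D (0≤² e)) (0≤* 0≤D (0≤² e′)) h h′))

  Small-scale : ∀ {c e} a → 0ℤ ≤ a → Small D N c e → Small D N (a * c) (a * e)
  Small-scale {c} {e} a 0≤a (small 0≤c h) = small (0≤* 0≤a 0≤c)
    (subst₂ _≤_ (sym (pull D a e)) (sym (pull′ c a N)) (*-mono-≤ (0≤² a) (0≤* 0≤D (0≤² e)) ℤ.≤-refl h))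
    where
    pull : ∀ D a e → D * (a * e * (a * e)) ≡ a * a * (D * (e * e))
    pull = solve-∀
    pull′ : ∀ c a N → a * c * (a * c) * N ≡ a * a * (c * c * N)
    pull′ = solve-∀

  Small-neg : ∀ {c e} → Small D N c e → Small D N c (- e)
  Small-neg {c} {e} (small 0≤c h) = small 0≤c (subst (_≤ c ² * N) (neg² D e) h)
    where
    neg² : ∀ D e → D * (e * e) ≡ D * (- e * - e)
    neg² = solve-∀

  Small-0 : Small D N 0ℤ 0ℤ
  Small-0 = small ℤ.≤-refl (ℤ.≤-reflexive (trans (ℤ.*-zeroʳ D) (sym (ℤ.*-zeroˡ N))))

module Ramanujan (K : FiniteField) (γ : FiniteField.Carrier K) (γ≢0 : γ ≢ FiniteField.0# K)
  (γ-full : CyclicGroup.HasFullOrder K γ) where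
  open CyclicGroup K public

  private
    module R = CommutativeRing ring

  open import Algebra.Solver.Ring.NaturalCoefficients.Default R.commutativeSemiring
    using (solve; _:=_; _:*_)

  log : Carrier → ℕ
  log x with x ≟ 0#
  -- A filler: `C []` vanishes at 0 and is a factor of every function that is summed.
  ... | yes _   = 0
  ... | no x≢0 = proj₁ (fullOrder⇒generates γ≢0 γ-full x x≢0)

  log-spec : ∀ {x} → x ≢ 0# → pow′ γ (log x) ≡ x
  log-spec {x} x≢0 with x ≟ 0#
  ... | yes x≡0  = ⊥-elim (x≢0 x≡0)
  ... | no x≢0′ = sym (proj₂ (fullOrder⇒generates γ≢0 γ-full x x≢0′))

  γ^ : ℕ → Carrier
  γ^ = pow′ γ

  log-⊗ : ∀ {x y} → x ≢ 0# → y ≢ 0# → γ^ (log (x ⊗ y)) ≡ γ^ (log x ℕ.+ log y)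
  log-⊗ {x} {y} x≢0 y≢0 = trans (log-spec (⊗≢0 x≢0 y≢0))
    (trans (sym (cong₂ _⊗_ (log-spec x≢0) (log-spec y≢0))) (sym (pow-+ γ (log x) (log y))))

  ∣-exponent : ∀ {p i j} → p ∣ m → γ^ i ≡ γ^ j → p ∣ i → p ∣ j
  ∣-exponent = fullOrder⇒∣ γ≢0 γ-full

  -- c p and C ds are the Ramanujan sums c_p and c_d, d = ∏ ds squarefree, at the discrete logarithm.
  c : ℕ → Carrier → ℤ
  c p x = + p * 𝟙 (p ∣? log x) - 1ℤ

  C : List ℕ → Carrier → ℤ
  C []       x = 1ℤ - 𝟙 (x ≟ 0#)
  C (p ∷ ds) x = c p x * C ds x

  φ : List ℕ → ℤ
  φ []       = 1ℤ
  φ (p ∷ ds) = (+ p - 1ℤ) * φ ds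

  C-0 : ∀ ds → C ds 0# ≡ 0ℤ
  C-0 []       = cong (λ z → 1ℤ - z) (𝟙-yes (0# ≟ 0#) refl)
  C-0 (p ∷ ds) = trans (cong (c p 0# *_) (C-0 ds)) (ℤ.*-zeroʳ (c p 0#))

  C-[] : ∀ {x} → x ≢ 0# → C [] x ≡ 1ℤ
  C-[] {x} x≢0 = cong (λ z → 1ℤ - z) (𝟙-no (x ≟ 0#) x≢0)

  C-1 : ∀ ds → All (_∣ m) ds → C ds 1# ≡ φ ds
  C-1 []       []         = C-[] (0≢1 ∘ sym)
  C-1 (p ∷ ds) (p∣m ∷ ds∣m) = cong₂ _*_
    (cong (λ z → z - 1ℤ) (trans (cong (+ p *_) (𝟙-yes (p ∣? log 1#) p∣log1)) (ℤ.*-identityʳ (+ p))))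
    (C-1 ds ds∣m)
    where
    p∣log1 : p ∣ log 1#
    p∣log1 = ∣-exponent p∣m (sym (log-spec (0≢1 ∘ sym))) (p ℕ.∣0)

  c-periodic : ∀ {p e x} → p ∣ m → p ∣ e → x ≢ 0# → c p (x ⊗ γ^ e) ≡ c p x
  c-periodic {p} {e} {x} p∣m p∣e x≢0 = cong (λ z → + p * z - 1ℤ)
    (𝟙-cong (p ∣? log (x ⊗ γ^ e)) (p ∣? log x)
      (λ h → ℕ.∣m+n∣m⇒∣n (subst (p ∣_) (ℕ.+-comm (log x) e) (∣-exponent p∣m eq h)) p∣e)
      (λ h → ∣-exponent p∣m (sym eq) (ℕ.∣m∣n⇒∣m+n h p∣e)))
    where
    eq : γ^ (log (x ⊗ γ^ e)) ≡ γ^ (log x ℕ.+ e)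
    eq = trans (log-spec (⊗≢0 x≢0 (pow≢0 e γ≢0)))
      (trans (cong (_⊗ γ^ e) (sym (log-spec x≢0))) (sym (pow-+ γ (log x) e)))

  C-periodic : ∀ {e x} ds → All (_∣ m) ds → All (_∣ e) ds → x ≢ 0# → C ds (x ⊗ γ^ e) ≡ C ds x
  C-periodic {e} []    _ _ x≢0 = trans (C-[] (⊗≢0 x≢0 (pow≢0 e γ≢0))) (sym (C-[] x≢0))
  C-periodic (p ∷ ds) (p∣m ∷ ds∣m) (p∣e ∷ ds∣e) x≢0 =
    cong₂ _*_ (c-periodic p∣m p∣e x≢0) (C-periodic ds ds∣m ds∣e x≢0)

  -- Translating by γᵉ moves the residue of the logarithm modulo p through all classes but fixes F.
  equidistribution : ∀ {p e} → Prime p → p ∣ m → p ∤ e → (F : Carrier → ℤ) →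
    (∀ {x} → x ≢ 0# → F (x ⊗ γ^ e) ≡ F x) → ∀ {w} → w ≢ 0# →
    + p * (Σ[ x ∈ units ] (F x * 𝟙 (p ∣? log (x ⊗ w)))) ≡ Σ units F
  equidistribution {p} {e} pp p∣m p∤e F F-inv {w} w≢0 = begin
    + p * (Σ[ x ∈ units ] (F x * 𝟙 (p ∣? log (x ⊗ w))))
      ≡⟨ cong (+ p *_) (Σ-cong units (λ x → cong (λ n → F x * 𝟙 (p ∣? n)) (sym (ℕ.+-identityʳ (log (x ⊗ w)))))) ⟩
    + p * H 0
      ≡⟨ cong (λ n → + n * H 0) (List.length-upTo p) ⟨
    + length (upTo p) * H 0
      ≡⟨ Σ-const (upTo p) (H 0) ⟨
    Σ[ j ∈ upTo p ] H 0
      ≡⟨ Σ-cong (upTo p) (λ j → H-const j) ⟨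
    Σ[ j ∈ upTo p ] H j
      ≡⟨ Σ-swap (upTo p) units (λ j x → F x * 𝟙 (p ∣? log (x ⊗ w) ℕ.+ j · e)) ⟩
    Σ[ x ∈ units ] Σ[ j ∈ upTo p ] (F x * 𝟙 (p ∣? log (x ⊗ w) ℕ.+ j · e))
      ≡⟨ Σ-cong units (λ x → trans (Σ-*ˡ (upTo p) (F x) (λ j → 𝟙 (p ∣? log (x ⊗ w) ℕ.+ j · e)))
           (trans (cong (F x *_) (Progression.Σ-hits pp p∤e (log (x ⊗ w)))) (ℤ.*-identityʳ (F x)))) ⟩
    Σ units F ∎
    where
    open ≡-Reasoning
    H : ℕ → ℤ
    H j = Σ[ x ∈ units ] (F x * 𝟙 (p ∣? log (x ⊗ w) ℕ.+ j · e))
    σ = γ^ e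
    σ≢0 = pow≢0 e γ≢0
    shifted : ∀ {x} → x ≢ 0# → ∀ j → γ^ (log ((x ⊗ σ) ⊗ w) ℕ.+ j · e) ≡ γ^ (log (x ⊗ w) ℕ.+ (e ℕ.+ j · e))
    shifted {x} x≢0 j = begin
      γ^ (log ((x ⊗ σ) ⊗ w) ℕ.+ j · e)  ≡⟨ pow-+ γ (log ((x ⊗ σ) ⊗ w)) (j · e) ⟩
      γ^ (log ((x ⊗ σ) ⊗ w)) ⊗ γ^ (j · e)  ≡⟨ cong (_⊗ γ^ (j · e)) (log-spec (⊗≢0 (⊗≢0 x≢0 σ≢0) w≢0)) ⟩
      ((x ⊗ σ) ⊗ w) ⊗ γ^ (j · e)  ≡⟨ regroup x σ w (γ^ (j · e)) ⟩
      (x ⊗ w) ⊗ (σ ⊗ γ^ (j · e))  ≡⟨ cong₂ _⊗_ (log-spec (⊗≢0 x≢0 w≢0)) (pow-+ γ e (j · e)) ⟨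
      γ^ (log (x ⊗ w)) ⊗ γ^ (e ℕ.+ j · e)  ≡⟨ pow-+ γ (log (x ⊗ w)) (e ℕ.+ j · e) ⟨
      γ^ (log (x ⊗ w) ℕ.+ (e ℕ.+ j · e))  ∎
      where
      regroup : ∀ x s w z → ((x ⊗ s) ⊗ w) ⊗ z ≡ (x ⊗ w) ⊗ (s ⊗ z)
      regroup = solve 4 (λ x s w z → ((x :* s) :* w) :* z := (x :* w) :* (s :* z)) refl
    H-suc : ∀ j → H (suc j) ≡ H j
    H-suc j = trans
      (Σ-cong-∈ units (λ {x} x∈ → let x≢0 = ∈units⁻ x∈ in cong₂ _*_ (sym (F-inv x≢0))
        (𝟙-cong (p ∣? log (x ⊗ w) ℕ.+ suc j · e) (p ∣? log ((x ⊗ σ) ⊗ w) ℕ.+ j · e)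
          (∣-exponent p∣m (sym (shifted x≢0 j))) (∣-exponent p∣m (shifted x≢0 j)))))
      (ΣU-scale σ≢0 (λ y → F y * 𝟙 (p ∣? log (y ⊗ w) ℕ.+ j · e)))
    H-const : ∀ j → H j ≡ H 0
    H-const zero    = refl
    H-const (suc j) = trans (H-suc j) (H-const j)

  equidistribution₁ : ∀ {p e} → Prime p → p ∣ m → p ∤ e → (F : Carrier → ℤ) →
    (∀ {x} → x ≢ 0# → F (x ⊗ γ^ e) ≡ F x) →
    + p * (Σ[ x ∈ units ] (F x * 𝟙 (p ∣? log x))) ≡ Σ units F
  equidistribution₁ {p} pp p∣m p∤e F F-inv = trans
    (cong (+ p *_) (Σ-cong units (λ x → cong (λ y → F x * 𝟙 (p ∣? log y)) (sym (R.*-identityʳ x)))))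
    (equidistribution pp p∣m p∤e F F-inv (0≢1 ∘ sym))

  record Conductor (ds : List ℕ) : Set where
    constructor conductor
    field
      distinct : Unique ds
      primes   : All Prime ds
      divisors : All (_∣ m) ds

  all∣product : ∀ ds → All (_∣ product ds) ds
  all∣product ds = All.tabulate ∈⇒∣product

  ∤product : ∀ {p ds} → Unique (p ∷ ds) → Prime p → All Prime ds → p ∤ product ds
  ∤product {p} {ds} u pp pds p∣ = ≢-of-Unique u (prime∣product⇒∈ ds pp pds p∣) refl

  -- By equidistribution the two terms of p [p ∣ log x] - 1 have the same sum against `C ds`.
  ΣC≡0 : ∀ p ds → Conductor (p ∷ ds) → Σ elements (C (p ∷ ds)) ≡ 0ℤ
  ΣC≡0 p ds (conductor u (pp ∷ pds) (p∣m ∷ ds∣m)) = begin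
    Σ elements (C (p ∷ ds))  ≡⟨ ΣK≡ΣU (C (p ∷ ds)) ⟩
    C (p ∷ ds) 0# + Σ units (C (p ∷ ds))  ≡⟨ cong (_+ Σ units (C (p ∷ ds))) (C-0 (p ∷ ds)) ⟩
    0ℤ + Σ units (C (p ∷ ds))  ≡⟨ ℤ.+-identityˡ _ ⟩
    Σ[ x ∈ units ] (c p x * C ds x)  ≡⟨ Σ-cong units (λ x → split (+ p) (𝟙 (p ∣? log x)) (C ds x)) ⟩
    Σ[ x ∈ units ] (+ p * (C ds x * 𝟙 (p ∣? log x)) - C ds x)
      ≡⟨ Σ-minus units (λ x → + p * (C ds x * 𝟙 (p ∣? log x))) (C ds) ⟩
    Σ[ x ∈ units ] (+ p * (C ds x * 𝟙 (p ∣? log x))) - Σ units (C ds)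
      ≡⟨ cong (_- Σ units (C ds)) (trans (Σ-*ˡ units (+ p) (λ x → C ds x * 𝟙 (p ∣? log x)))
           (equidistribution₁ pp p∣m (∤product u pp pds) (C ds) (C-periodic ds ds∣m (all∣product ds)))) ⟩
    Σ units (C ds) - Σ units (C ds)  ≡⟨ ℤ.+-inverseʳ (Σ units (C ds)) ⟩
    0ℤ  ∎
    where
    open ≡-Reasoning
    split : ∀ p i z → (p * i - 1ℤ) * z ≡ p * (z * i) - z
    split = solve-∀

  -- As c_d is the sum of the characters of order d, this is character orthogonality. It is proved
  -- one prime at a time: "p ∣ log (g w) and p ∣ log g" is the same as "p ∣ log w and p ∣ log g",
  -- after which each term contains a single condition on g and is evaluated by equidistribution.
  C-orthogonality : ∀ ds → Conductor ds → ∀ {w} → w ≢ 0# →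
    Σ[ g ∈ units ] (C ds (g ⊗ w) * C ds g) ≡ + m * C ds w
  C-orthogonality [] _ {w} w≢0 = trans
    (Σ-cong-∈ units (λ {g} g∈ → cong₂ _*_ (C-[] (⊗≢0 (∈units⁻ g∈) w≢0)) (C-[] (∈units⁻ g∈))))
    (trans (Σ-1 units) (sym (trans (cong (+ m *_) (C-[] w≢0)) (ℤ.*-identityʳ (+ m)))))
  C-orthogonality (p ∷ ds) (conductor u@(_ ∷ u′) (pp ∷ pds) (p∣m ∷ ds∣m)) {w} w≢0 = begin
    Σ[ g ∈ units ] (C (p ∷ ds) (g ⊗ w) * C (p ∷ ds) g)
      ≡⟨ Σ-cong-∈ units (λ {g} g∈ → pointwise (∈units⁻ g∈)) ⟩
    Σ[ g ∈ units ] (a * f₁ g + b * f₂ g + 1ℤ * F g)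
      ≡⟨ Σ-linear₃ units a b 1ℤ f₁ f₂ F ⟩
    a * Σ units f₁ + b * Σ units f₂ + 1ℤ * Σ units F
      ≡⟨ gather (+ p) 1w (Σ units f₁) (Σ units f₂) (Σ units F) ⟩
    (+ p * 1w - 1ℤ) * (+ p * Σ units f₁) + - (+ p * Σ units f₂) + Σ units F
      ≡⟨ cong₂ (λ y z → (+ p * 1w - 1ℤ) * y + - z + Σ units F)
           (equidistribution₁ pp p∣m p∤e F F-inv) (equidistribution pp p∣m p∤e F F-inv w≢0) ⟩
    (+ p * 1w - 1ℤ) * Σ units F + - Σ units F + Σ units F
      ≡⟨ drop ((+ p * 1w - 1ℤ) * Σ units F) (Σ units F) ⟩
    (+ p * 1w - 1ℤ) * Σ units F
      ≡⟨ cong ((+ p * 1w - 1ℤ) *_) (C-orthogonality ds (conductor u′ pds ds∣m) w≢0) ⟩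
    (+ p * 1w - 1ℤ) * (+ m * C ds w)
      ≡⟨ swap (+ p * 1w - 1ℤ) (+ m) (C ds w) ⟩
    + m * C (p ∷ ds) w ∎
    where
    open ≡-Reasoning
    F f₁ f₂ : Carrier → ℤ
    F g  = C ds (g ⊗ w) * C ds g
    f₁ g = F g * 𝟙 (p ∣? log g)
    f₂ g = F g * 𝟙 (p ∣? log (g ⊗ w))
    1w = 𝟙 (p ∣? log w)
    a = + p * 1w * + p - + p
    b = - (+ p)
    e = product ds
    p∤e = ∤product u pp pds
    F-inv : ∀ {x} → x ≢ 0# → F (x ⊗ γ^ e) ≡ F x
    F-inv {x} x≢0 = cong₂ _*_
      (trans (cong (C ds) (exchange x (γ^ e) w)) (C-periodic ds ds∣m (all∣product ds) (⊗≢0 x≢0 w≢0)))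
      (C-periodic ds ds∣m (all∣product ds) x≢0)
      where
      exchange : ∀ x s w → (x ⊗ s) ⊗ w ≡ (x ⊗ w) ⊗ s
      exchange = solve 3 (λ x s w → (x :* s) :* w := (x :* w) :* s) refl
    𝟙-product : ∀ {g} → g ≢ 0# → 𝟙 (p ∣? log (g ⊗ w)) * 𝟙 (p ∣? log g) ≡ 1w * 𝟙 (p ∣? log g)
    𝟙-product {g} g≢0 = 𝟙-*-cong (p ∣? log (g ⊗ w)) (p ∣? log w) (p ∣? log g)
      (λ p∣g p∣gw → ℕ.∣m+n∣m⇒∣n (∣-exponent p∣m (log-⊗ g≢0 w≢0) p∣gw) p∣g)
      (λ p∣g p∣w → ∣-exponent p∣m (sym (log-⊗ g≢0 w≢0)) (ℕ.∣m∣n⇒∣m+n p∣g p∣w))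
    expand : ∀ p i j s t → (p * i - 1ℤ) * s * ((p * j - 1ℤ) * t)
      ≡ p * p * (i * j) * (s * t) - p * (s * t * i) - p * (s * t * j) + s * t
    expand = solve-∀
    collect : ∀ p k j i F → p * p * (k * j) * F - p * (F * i) - p * (F * j) + F
      ≡ (p * k * p - p) * (F * j) + - p * (F * i) + 1ℤ * F
    collect = solve-∀
    pointwise : ∀ {g} → g ≢ 0# → C (p ∷ ds) (g ⊗ w) * C (p ∷ ds) g ≡ a * f₁ g + b * f₂ g + 1ℤ * F g
    pointwise {g} g≢0 = trans (expand (+ p) (𝟙 (p ∣? log (g ⊗ w))) (𝟙 (p ∣? log g)) (C ds (g ⊗ w)) (C ds g))
      (trans (cong (λ z → + p * + p * z * F g - + p * f₂ g - + p * f₁ g + F g) (𝟙-product g≢0))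
             (collect (+ p) 1w (𝟙 (p ∣? log g)) (𝟙 (p ∣? log (g ⊗ w))) (F g)))
    gather : ∀ p k x y s → (p * k * p - p) * x + - p * y + 1ℤ * s ≡ (p * k - 1ℤ) * (p * x) + - (p * y) + s
    gather = solve-∀
    drop : ∀ x s → x + - s + s ≡ x
    drop = solve-∀
    swap : ∀ k m c → k * (m * c) ≡ m * (k * c)
    swap = solve-∀

module PrimitiveIndicator (K : FiniteField) (γ : FiniteField.Carrier K) (γ≢0 : γ ≢ FiniteField.0# K)
  (γ-full : CyclicGroup.HasFullOrder K γ) where
  open Ramanujan K γ γ≢0 γ-full public

  private
    module R = CommutativeRing ring
    instance _ = m-nonZero

  W : List ℕ → ℤ
  W []       = 1ℤ
  W (p ∷ ps) = + 2 * W ps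

  -- ∏ p times the indicator of the logarithms prime to ∏ ps, as a polynomial in the Ramanujan sums.
  D : List ℕ → Carrier → ℤ
  D []       x = 1ℤ
  D (p ∷ ps) x = ((+ p - 1ℤ) - c p x) * D ps x

  φ≥0 : ∀ {ps} → All Prime ps → 0ℤ ≤ φ ps
  φ≥0 []         = +≤+ z≤n
  φ≥0 {p ∷ _} (pp ∷ pps) = 0≤* (ℤ.i≤j⇒0≤j-i (+≤+ (ℕ.<⇒≤ (ℕ.nonTrivial⇒n>1 p)))) (φ≥0 pps)
    where instance _ = prime⇒nonTrivial pp

  -- The functional is abstract because it is used twice: for the sum over K, where every nontrivial
  -- c_d contributes 0, and for the sum over the box. Expanding `D` gives Σ μ(d) φ(R/d) c_d over the
  -- divisors d of R = ∏ ps.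
  module Expansion (L : (Carrier → ℤ) → ℤ)
    (L-cong : ∀ {f g} → (∀ x → f x ≡ g x) → L f ≡ L g)
    (L-linear : ∀ a f g → L (λ x → a * f x - g x) ≡ a * L f - L g)
    {Q N : ℤ} (0≤Q : 0ℤ ≤ Q) (0≤N : 0ℤ ≤ N)
    (L-small : ∀ p ds → Conductor (p ∷ ds) → Small Q N (φ (p ∷ ds)) (L (C (p ∷ ds)))) where

    split : ∀ q c C D → C * ((q - c) * D) ≡ q * (C * D) - c * C * D
    split = solve-∀

    L-step : ∀ p ds ps → L (λ x → C ds x * D (p ∷ ps) x)
      ≡ (+ p - 1ℤ) * L (λ x → C ds x * D ps x) - L (λ x → C (p ∷ ds) x * D ps x)
    L-step p ds ps = trans (L-cong (λ x → split (+ p - 1ℤ) (c p x) (C ds x) (D ps x)))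
      (L-linear (+ p - 1ℤ) (λ x → C ds x * D ps x) (λ x → C (p ∷ ds) x * D ps x))

    -- Each further prime either contributes the constant p - 1 or joins the conductor, whose φ then
    -- gains p - 1. The two branches weigh the same, which yields the factor 2 in `W`.
    L-small-D : ∀ ps r ds → Conductor (r ∷ ds) → Conductor ps → All (λ p → All (p ≢_) (r ∷ ds)) ps →
      Small Q N (φ (r ∷ ds) * (φ ps * W ps)) (L (λ x → C (r ∷ ds) x * D ps x))
    L-small-D [] r ds cd _ _ = subst₂ (Small Q N) (sym (ℤ.*-identityʳ _))
      (L-cong (λ x → sym (ℤ.*-identityʳ (C (r ∷ ds) x)))) (L-small r ds cd)
    L-small-D (p ∷ ps) r ds cd@(conductor u pds ds∣m) (conductor up@(_ ∷ up′) (pp ∷ pps) (p∣m ∷ ps∣m)) (p∉ ∷ ps∉) =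
      subst₂ (Small Q N) (weights (+ p - 1ℤ) (φ (r ∷ ds)) (φ ps) (W ps)) (sym (L-step p (r ∷ ds) ps))
        (Small-+ 0≤Q 0≤N (Small-scale 0≤Q 0≤N (+ p - 1ℤ) 0≤p-1 (L-small-D ps r ds cd cps ps∉))
          (Small-neg 0≤Q 0≤N (L-small-D ps p (r ∷ ds) (conductor (p∉ ∷ u) (pp ∷ pds) (p∣m ∷ ds∣m)) cps
            (All.zipWith (λ (p≢ , r∉) → p≢ ∷ r∉) (All.tabulate (λ s∈ → ≢-of-Unique up s∈ ∘ sym) , ps∉)))))
      where
      cps = conductor up′ pps ps∣m
      0≤p-1 = subst (0ℤ ≤_) (ℤ.*-identityʳ (+ p - 1ℤ)) (φ≥0 (pp ∷ []))
      weights : ∀ q f g w → q * (f * (g * w)) + q * f * (g * w) ≡ f * (q * g * (+ 2 * w))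
      weights = solve-∀

    L-main : ∀ ps → Conductor ps →
      ∃ λ e → Small Q N (φ ps * (W ps - 1ℤ)) e × L (λ x → C [] x * D ps x) ≡ φ ps * L (C []) + e
    L-main [] _ = 0ℤ , Small-0 0≤Q 0≤N , trans (L-cong (λ x → ℤ.*-identityʳ (C [] x)))
      (sym (trans (ℤ.+-identityʳ _) (ℤ.*-identityˡ _)))
    L-main (p ∷ ps) (conductor up@(_ ∷ up′) (pp ∷ pps) (p∣m ∷ ps∣m))
      with e , e-small , eq ← L-main ps (conductor up′ pps ps∣m) =
      (+ p - 1ℤ) * e - e′ ,
      subst (λ c → Small Q N c ((+ p - 1ℤ) * e - e′)) (weights (+ p - 1ℤ) (φ ps) (W ps))
        (Small-+ 0≤Q 0≤N (Small-scale 0≤Q 0≤N (+ p - 1ℤ) 0≤p-1 e-small)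
          (Small-neg 0≤Q 0≤N (L-small-D ps p [] (conductor ([] ∷ []) (pp ∷ []) (p∣m ∷ []))
            (conductor up′ pps ps∣m) (All.tabulate (λ s∈ → (≢-of-Unique up s∈ ∘ sym) ∷ []))))) ,
      trans (L-step p [] ps) (trans (cong (λ z → (+ p - 1ℤ) * z - e′) eq) (regroup (+ p - 1ℤ) (φ ps) (L (C [])) e e′))
      where
      e′ = L (λ x → C (p ∷ []) x * D ps x)
      0≤p-1 = subst (0ℤ ≤_) (ℤ.*-identityʳ (+ p - 1ℤ)) (φ≥0 (pp ∷ []))
      weights : ∀ q g w → q * (g * (w - 1ℤ)) + q * 1ℤ * (g * w) ≡ q * g * (+ 2 * w - 1ℤ)
      weights = solve-∀
      regroup : ∀ q g l e e′ → q * (g * l + e) - e′ ≡ q * g * l + (q * e - e′)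
      regroup = solve-∀

  D-factor : ∀ p x → (p ∣ log x × (+ p - 1ℤ) - c p x ≡ 0ℤ) ⊎ (p ∤ log x × (+ p - 1ℤ) - c p x ≡ + p)
  D-factor p x with p ∣? log x
  ... | yes p∣ = inj₁ (p∣ , cancel (+ p))
    where
    cancel : ∀ p → (p - 1ℤ) - (p * 1ℤ - 1ℤ) ≡ 0ℤ
    cancel = solve-∀
  ... | no p∤ = inj₂ (p∤ , collect (+ p))
    where
    collect : ∀ p → (p - 1ℤ) - (p * 0ℤ - 1ℤ) ≡ p
    collect = solve-∀

  D≢0⇒∤log : ∀ ps {x} → D ps x ≢ 0ℤ → ∀ {p} → p ∈ ps → p ∤ log x
  D≢0⇒∤log (p ∷ ps) {x} D≢0 (here refl) with D-factor p x
  ... | inj₁ (_ , z)  = λ _ → D≢0 (trans (cong (_* D ps x) z) (ℤ.*-zeroˡ (D ps x)))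
  ... | inj₂ (p∤ , _) = p∤
  D≢0⇒∤log (p ∷ ps) {x} D≢0 (there p∈) =
    D≢0⇒∤log ps (λ z → D≢0 (trans (cong (((+ p - 1ℤ) - c p x) *_) z) (ℤ.*-zeroʳ ((+ p - 1ℤ) - c p x)))) p∈

  D-range : ∀ ps x → 0ℤ ≤ D ps x × D ps x ≤ + product ps
  D-range []       x = +≤+ z≤n , ℤ.≤-refl
  D-range (p ∷ ps) x with D-factor p x | D-range ps x
  ... | inj₁ (_ , z) | _ = ℤ.≤-reflexive (sym eq) , subst (_≤ + (p · product ps)) (sym eq) (+≤+ z≤n)
    where
    eq = trans (cong (_* D ps x) z) (ℤ.*-zeroˡ (D ps x))
  ... | inj₂ (_ , f) | lo , hi =
    subst (0ℤ ≤_) (sym eq) (0≤* {+ p} (+≤+ z≤n) lo) ,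
    subst₂ _≤_ (sym eq) (sym (ℤ.pos-* p (product ps))) (ℤ.*-monoˡ-≤-nonNeg (+ p) hi)
    where
    eq = cong (_* D ps x) f

  indicator : Carrier → ℤ
  indicator x = C [] x * D ps x

  C[]-range : ∀ x → 0ℤ ≤ C [] x × C [] x ≤ 1ℤ
  C[]-range x with x ≟ 0#
  ... | yes _ = ℤ.≤-refl , +≤+ z≤n
  ... | no _  = +≤+ z≤n , ℤ.≤-refl

  indicator-range : ∀ x → 0ℤ ≤ indicator x × indicator x ≤ + product ps
  indicator-range x with C[]-range x | D-range ps x
  ... | lo , hi | lo′ , hi′ = 0≤* lo lo′ , subst (indicator x ≤_) (ℤ.*-identityˡ _) (*-mono-≤ lo lo′ hi hi′)

  -- If x^(m/p) = 1 then m divides log x · (m/p), and hence p divides log x.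
  ∤log⇒IsPrimitive : ∀ {x} → x ≢ 0# → (∀ {p} → p ∈ ps → p ∤ log x) → IsPrimitive K x
  ∤log⇒IsPrimitive {x} x≢0 coprime = x≢0 , fullOrder⇒generates x≢0 (fullOrder x≢0 noRoot)
    where
    noRoot : ∀ {p e} → Prime p → m ≡ p · e → pow′ x e ≢ 1#
    noRoot {p} {zero} pp m≡ _ = ℕ.≢-nonZero⁻¹ m (trans m≡ (ℕ.*-zeroʳ p))
    noRoot {p} {suc e} pp m≡ h = coprime (∈primeDivisors⁺ {m} pp (subst (p ∣_) (sym m≡) (ℕ.m∣m*n (suc e))))
      (ℕ.*-cancelʳ-∣ (suc e) (subst (_∣ log x · suc e) m≡
        (γ-full (log x · suc e) (trans (pow-* γ (log x) (suc e)) (trans (cong (λ y → pow′ y (suc e)) (log-spec x≢0)) h)))))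

  indicator≢0⇒IsPrimitive : ∀ {x} → indicator x ≢ 0ℤ → IsPrimitive K x
  indicator≢0⇒IsPrimitive {x} h = ∤log⇒IsPrimitive x≢0 (D≢0⇒∤log ps D≢0)
    where
    x≢0 : x ≢ 0#
    x≢0 refl = h (trans (cong (_* D ps 0#) (C-0 [])) (ℤ.*-zeroˡ (D ps 0#)))
    D≢0 : D ps x ≢ 0ℤ
    D≢0 z = h (trans (cong (C [] x *_) z) (ℤ.*-zeroʳ (C [] x)))

  ps-conductor : Conductor ps
  ps-conductor = conductor (primeDivisors-unique m)
    (All.tabulate (λ p∈ → proj₁ (∈primeDivisors⁻ {m} p∈))) (All.tabulate (λ p∈ → proj₂ (∈primeDivisors⁻ {m} p∈)))

  -- In the expansion with N = 0 the error must be 0, so the number of primitive elements comes out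
  -- exactly.
  Σ-indicator : Σ elements indicator ≡ φ ps * + m
  Σ-indicator with e , small _ e²≤0 , eq ← Expansion.L-main (Σ elements) (Σ-cong elements)
      (λ a f g → trans (Σ-minus elements (λ x → a * f x) g) (cong (_- Σ elements g) (Σ-*ˡ elements a f)))
      {1ℤ} {0ℤ} (+≤+ z≤n) ℤ.≤-refl
      (λ p ds cd@(conductor _ pds _) → small (φ≥0 pds) (ℤ.≤-reflexive (trans (cong (λ z → 1ℤ * z ²) (ΣC≡0 p ds cd)) (sym (ℤ.*-zeroʳ (φ (p ∷ ds) ²))))))
      ps ps-conductor = trans eq (trans (cong₂ _+_ (cong (φ ps *_) ΣC[]) (e≡0 e e²≤0)) (ℤ.+-identityʳ _))
    where
    ΣC[] : Σ elements (C []) ≡ + m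
    ΣC[] = trans (ΣK≡ΣU (C [])) (trans (cong₂ _+_ (C-0 []) (trans (Σ-cong-∈ units (C-[] ∘ ∈units⁻)) (Σ-1 units))) (ℤ.+-identityˡ (+ m)))
    e≡0 : ∀ e → 1ℤ * e ² ≤ (φ ps * (W ps - 1ℤ)) ² * 0ℤ → e ≡ 0ℤ
    e≡0 e h with ℤ.i*j≡0⇒i≡0∨j≡0 e (ℤ.≤-antisym (subst₂ _≤_ (ℤ.*-identityˡ (e ²)) (ℤ.*-zeroʳ ((φ ps * (W ps - 1ℤ)) ²)) h) (0≤² e))
    ... | inj₁ z = z
    ... | inj₂ z = z

-- Weighted sums over boxes

^-nonneg : ∀ {k} n → 0ℤ ≤ k → 0ℤ ≤ k ℤ.^ n
^-nonneg zero    0≤k = +≤+ z≤n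
^-nonneg (suc n) 0≤k = 0≤* 0≤k (^-nonneg n 0≤k)

0≤𝟙 : {P : Set} (d : Dec P) → 0ℤ ≤ 𝟙 d
0≤𝟙 (yes _) = +≤+ z≤n
0≤𝟙 (no _)  = ℤ.≤-refl

𝟙≤1 : {P : Set} (d : Dec P) → 𝟙 d ≤ 1ℤ
𝟙≤1 (yes _) = ℤ.≤-refl
𝟙≤1 (no _)  = +≤+ z≤n

minus-≤ : ∀ x {y} → 0ℤ ≤ y → x - y ≤ x
minus-≤ x {y} 0≤y = let instance _ = ℤ.nonNegative 0≤y in ℤ.i-j≤i x y

module BoxSums (K : FiniteField) (fs : List (FiniteField.Carrier K)) (fs-unique : Unique fs)
  (0∈fs : FiniteField.0# K ∈ fs)
  (⊕∈fs : ∀ {x y} → x ∈ fs → y ∈ fs → FiniteField._+_ K x y ∈ fs)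
  (⊖∈fs : ∀ {x} → x ∈ fs → FiniteField.-_ K x ∈ fs) where
  open FieldBasics K public

  private
    module R = CommutativeRing ring
    module RP = Algebra.Properties.Ring R.ring

  q : ℤ
  q = + length fs

  S : (Carrier → ℤ) → Carrier → (Carrier → ℤ) → Carrier → ℤ
  S w b ψ z = Σ[ c ∈ fs ] (w c * ψ (z ⊕ c ⊗ b))

  I : (Carrier → ℤ) → List Carrier → (Carrier → ℤ) → Carrier → ℤ
  I w []       ψ z = ψ z
  I w (b ∷ bs) ψ z = S w b (I w bs ψ) z

  one : Carrier → ℤ
  one _ = 1ℤ

  -- The element A δ₀ + B · 1 of the convolution algebra spanned by δ₀ and the constant 1 on F; α, β
  -- and the indicator of F* all have this form.
  affine : ℤ → ℤ → Carrier → ℤ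
  affine A B c = B + A * 𝟙 (c ≟ 0#)

  star : Carrier → ℤ
  star = affine (- 1ℤ) 1ℤ

  J : Carrier → (Carrier → ℤ) → Carrier → ℤ
  J b ψ z = Σ[ c ∈ fs ] ψ (z ⊕ c ⊗ b)

  S-cong : ∀ w b {ψ χ} → (∀ z → ψ z ≡ χ z) → ∀ z → S w b ψ z ≡ S w b χ z
  S-cong w b h z = Σ-cong fs (λ c → cong (w c *_) (h (z ⊕ c ⊗ b)))

  I-cong : ∀ w bs {ψ χ} → (∀ z → ψ z ≡ χ z) → ∀ z → I w bs ψ z ≡ I w bs χ z
  I-cong w []       h = h
  I-cong w (b ∷ bs) h = S-cong w b (I-cong w bs h)

  ⊕0⊗ : ∀ z b → z ⊕ 0# ⊗ b ≡ z
  ⊕0⊗ z b = trans (cong (z ⊕_) (R.zeroˡ b)) (R.+-identityʳ z)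

  Σ-at-0 : (ψ : Carrier → ℤ) → Σ[ c ∈ fs ] (𝟙 (c ≟ 0#) * ψ c) ≡ ψ 0#
  Σ-at-0 ψ = trans (Σ-only fs-unique 0∈fs (λ {c} _ c≢0 → trans (cong (_* ψ c) (𝟙-no (c ≟ 0#) c≢0)) (ℤ.*-zeroˡ (ψ c))))
    (trans (cong (_* ψ 0#) (𝟙-yes (0# ≟ 0#) refl)) (ℤ.*-identityˡ (ψ 0#)))

  S-affine : ∀ A B b ψ z → S (affine A B) b ψ z ≡ A * ψ z + B * J b ψ z
  S-affine A B b ψ z = begin
    Σ[ c ∈ fs ] ((B + A * 𝟙 (c ≟ 0#)) * ψ (z ⊕ c ⊗ b))
      ≡⟨ Σ-cong fs (λ c → distrib A B (𝟙 (c ≟ 0#)) (ψ (z ⊕ c ⊗ b))) ⟩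
    Σ[ c ∈ fs ] (A * (𝟙 (c ≟ 0#) * ψ (z ⊕ c ⊗ b)) + B * ψ (z ⊕ c ⊗ b))
      ≡⟨ Σ-+ fs (λ c → A * (𝟙 (c ≟ 0#) * ψ (z ⊕ c ⊗ b))) (λ c → B * ψ (z ⊕ c ⊗ b)) ⟩
    Σ[ c ∈ fs ] (A * (𝟙 (c ≟ 0#) * ψ (z ⊕ c ⊗ b))) + Σ[ c ∈ fs ] (B * ψ (z ⊕ c ⊗ b))
      ≡⟨ cong₂ _+_ (Σ-*ˡ fs A (λ c → 𝟙 (c ≟ 0#) * ψ (z ⊕ c ⊗ b))) (Σ-*ˡ fs B (λ c → ψ (z ⊕ c ⊗ b))) ⟩
    A * (Σ[ c ∈ fs ] (𝟙 (c ≟ 0#) * ψ (z ⊕ c ⊗ b))) + B * J b ψ z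
      ≡⟨ cong (λ y → A * y + B * J b ψ z) (trans (Σ-at-0 (λ c → ψ (z ⊕ c ⊗ b))) (cong ψ (⊕0⊗ z b))) ⟩
    A * ψ z + B * J b ψ z ∎
    where
    open ≡-Reasoning
    distrib : ∀ A B i y → (B + A * i) * y ≡ A * (i * y) + B * y
    distrib = solve-∀

  -- Translating fs by one of its own elements permutes it.
  J-J : ∀ b ψ z → J b (J b ψ) z ≡ q * J b ψ z
  J-J b ψ z = trans (Σ-cong-∈ fs absorb) (Σ-const fs (J b ψ z))
    where
    absorb : ∀ {c} → c ∈ fs → J b ψ (z ⊕ c ⊗ b) ≡ J b ψ z
    absorb {c} c∈ = trans
      (Σ-cong fs (λ d → cong ψ (trans (R.+-assoc z (c ⊗ b) (d ⊗ b))
        (cong (z ⊕_) (trans (sym (R.distribʳ b c d)) (cong (_⊗ b) (R.+-comm c d)))))))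
      (Reindex.Σ-reindex fs-unique fs-unique (_⊕ c) (_⊕ ⊖ c)
        (λ d _ → ⊕-cancel-⊖ʳ d c) (λ d _ → ⊖-cancel-⊕ʳ d c) (λ d∈ → ⊕∈fs d∈ c∈) (λ d∈ → ⊕∈fs d∈ (⊖∈fs c∈))
        (λ d → ψ (z ⊕ d ⊗ b)))

  -- As operators, `S (affine A B) b` is A + B J with J² = q J. A product of two is A A′ + (A B′ + B
  -- A′ + q B B′) J, and the hypotheses make this k (J - 1), where J - 1 belongs to `star`.
  S-S : ∀ A B A′ B′ k → A * A′ ≡ k * - 1ℤ → A * B′ + B * A′ + q * (B * B′) ≡ k →
    ∀ b ψ z → S (affine A B) b (S (affine A′ B′) b ψ) z ≡ k * S star b ψ z
  S-S A B A′ B′ k h₁ h₂ b ψ z = begin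
    S (affine A B) b (S (affine A′ B′) b ψ) z
      ≡⟨ S-affine A B b (S (affine A′ B′) b ψ) z ⟩
    A * S (affine A′ B′) b ψ z + B * J b (S (affine A′ B′) b ψ) z
      ≡⟨ cong₂ (λ x y → A * x + B * y) (S-affine A′ B′ b ψ z) J-S ⟩
    A * (A′ * ψ z + B′ * J b ψ z) + B * (A′ * J b ψ z + B′ * (q * J b ψ z))
      ≡⟨ regroup A B A′ B′ q (ψ z) (J b ψ z) ⟩
    A * A′ * ψ z + (A * B′ + B * A′ + q * (B * B′)) * J b ψ z
      ≡⟨ cong₂ (λ x y → x * ψ z + y * J b ψ z) h₁ h₂ ⟩
    k * - 1ℤ * ψ z + k * J b ψ z
      ≡⟨ factor k (ψ z) (J b ψ z) ⟩
    k * (- 1ℤ * ψ z + 1ℤ * J b ψ z)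
      ≡⟨ cong (k *_) (S-affine (- 1ℤ) 1ℤ b ψ z) ⟨
    k * S star b ψ z ∎
    where
    open ≡-Reasoning
    J-S : J b (S (affine A′ B′) b ψ) z ≡ A′ * J b ψ z + B′ * (q * J b ψ z)
    J-S = trans (Σ-cong fs (λ c → S-affine A′ B′ b ψ (z ⊕ c ⊗ b)))
      (trans (Σ-+ fs (λ c → A′ * ψ (z ⊕ c ⊗ b)) (λ c → B′ * J b ψ (z ⊕ c ⊗ b)))
        (cong₂ _+_ (Σ-*ˡ fs A′ (λ c → ψ (z ⊕ c ⊗ b)))
          (trans (Σ-*ˡ fs B′ (λ c → J b ψ (z ⊕ c ⊗ b))) (cong (B′ *_) (J-J b ψ z)))))
    regroup : ∀ A B A′ B′ q y j → A * (A′ * y + B′ * j) + B * (A′ * j + B′ * (q * j))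
      ≡ A * A′ * y + (A * B′ + B * A′ + q * (B * B′)) * j
    regroup = solve-∀
    factor : ∀ k y j → k * - 1ℤ * y + k * j ≡ k * (- 1ℤ * y + 1ℤ * j)
    factor = solve-∀

  S-comm : ∀ w b v d ψ z → S w b (S v d ψ) z ≡ S v d (S w b ψ) z
  S-comm w b v d ψ z = begin
    Σ[ c ∈ fs ] (w c * (Σ[ e ∈ fs ] (v e * ψ (z ⊕ c ⊗ b ⊕ e ⊗ d))))
      ≡⟨ Σ-cong fs (λ c → sym (Σ-*ˡ fs (w c) (λ e → v e * ψ (z ⊕ c ⊗ b ⊕ e ⊗ d)))) ⟩
    Σ[ c ∈ fs ] Σ[ e ∈ fs ] (w c * (v e * ψ (z ⊕ c ⊗ b ⊕ e ⊗ d)))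
      ≡⟨ Σ-swap fs fs (λ c e → w c * (v e * ψ (z ⊕ c ⊗ b ⊕ e ⊗ d))) ⟩
    Σ[ e ∈ fs ] Σ[ c ∈ fs ] (w c * (v e * ψ (z ⊕ c ⊗ b ⊕ e ⊗ d)))
      ≡⟨ Σ-cong fs (λ e → Σ-cong fs (λ c → trans (exchange (w c) (v e) _)
           (cong (λ y → v e * (w c * ψ y)) (swap z (c ⊗ b) (e ⊗ d))))) ⟩
    Σ[ e ∈ fs ] Σ[ c ∈ fs ] (v e * (w c * ψ (z ⊕ e ⊗ d ⊕ c ⊗ b)))
      ≡⟨ Σ-cong fs (λ e → Σ-*ˡ fs (v e) (λ c → w c * ψ (z ⊕ e ⊗ d ⊕ c ⊗ b))) ⟩
    Σ[ e ∈ fs ] (v e * (Σ[ c ∈ fs ] (w c * ψ (z ⊕ e ⊗ d ⊕ c ⊗ b)))) ∎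
    where
    open ≡-Reasoning
    exchange : ∀ x y t → x * (y * t) ≡ y * (x * t)
    exchange = solve-∀
    swap : ∀ z x y → z ⊕ x ⊕ y ≡ z ⊕ y ⊕ x
    swap z x y = trans (R.+-assoc z x y) (trans (cong (z ⊕_) (R.+-comm x y)) (sym (R.+-assoc z y x)))

  S-I-comm : ∀ w b v bs ψ z → S w b (I v bs ψ) z ≡ I v bs (S w b ψ) z
  S-I-comm w b v []       ψ z = refl
  S-I-comm w b v (d ∷ bs) ψ z = trans (S-comm w b v d (I v bs ψ) z) (S-cong v d (S-I-comm w b v bs ψ) z)

  S-* : ∀ w b k ψ z → S w b (λ y → k * ψ y) z ≡ k * S w b ψ z
  S-* w b k ψ z = trans (Σ-cong fs (λ c → exchange (w c) k (ψ (z ⊕ c ⊗ b)))) (Σ-*ˡ fs k (λ c → w c * ψ (z ⊕ c ⊗ b)))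
    where
    exchange : ∀ x y t → x * (y * t) ≡ y * (x * t)
    exchange = solve-∀

  -- Operators in different coordinates commute, so the two iterated sums regroup into one pair per
  -- coordinate, each contributing k.
  I-I : ∀ A B A′ B′ k → A * A′ ≡ k * - 1ℤ → A * B′ + B * A′ + q * (B * B′) ≡ k →
    ∀ bs ψ z → I (affine A B) bs (I (affine A′ B′) bs ψ) z ≡ k ℤ.^ length bs * I star bs ψ z
  I-I A B A′ B′ k h₁ h₂ []       ψ z = sym (ℤ.*-identityˡ (ψ z))
  I-I A B A′ B′ k h₁ h₂ (b ∷ bs) ψ z = begin
    S α b (I α bs (S β b (I β bs ψ))) z  ≡⟨ S-cong α b (λ y → sym (S-I-comm β b α bs (I β bs ψ) y)) z ⟩
    S α b (S β b (I α bs (I β bs ψ))) z  ≡⟨ S-S A B A′ B′ k h₁ h₂ b (I α bs (I β bs ψ)) z ⟩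
    k * S star b (I α bs (I β bs ψ)) z  ≡⟨ cong (k *_) (S-cong star b (I-I A B A′ B′ k h₁ h₂ bs ψ) z) ⟩
    k * S star b (λ y → kⁿ * I star bs ψ y) z  ≡⟨ cong (k *_) (S-* star b kⁿ (I star bs ψ) z) ⟩
    k * (kⁿ * S star b (I star bs ψ) z)  ≡⟨ ℤ.*-assoc k kⁿ _ ⟨
    k * kⁿ * S star b (I star bs ψ) z  ∎
    where
    open ≡-Reasoning
    α = affine A B
    β = affine A′ B′
    kⁿ = k ℤ.^ length bs

  energy : (Carrier → ℤ) → ℤ
  energy w = Σ[ c ∈ fs ] w c ²

  energy-affine : ∀ A B → energy (affine A B) ≡ A ² + (+ 2) * (A * B) + q * B ²
  energy-affine A B = begin
    Σ[ c ∈ fs ] affine A B c ²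
      ≡⟨ Σ-cong fs (λ c → trans (square A B (𝟙 (c ≟ 0#))) (cong (λ y → y + B * B) (idem c))) ⟩
    Σ[ c ∈ fs ] (𝟙 (c ≟ 0#) * (A * A + (+ 2) * (A * B)) + B * B)
      ≡⟨ Σ-+ fs (λ c → 𝟙 (c ≟ 0#) * (A * A + (+ 2) * (A * B))) (λ _ → B * B) ⟩
    Σ[ c ∈ fs ] (𝟙 (c ≟ 0#) * (A * A + (+ 2) * (A * B))) + Σ[ c ∈ fs ] (B * B)
      ≡⟨ cong₂ _+_ (Σ-at-0 (λ _ → A * A + (+ 2) * (A * B))) (Σ-const fs (B * B)) ⟩
    A ² + (+ 2) * (A * B) + q * B ² ∎
    where
    open ≡-Reasoning
    square : ∀ A B i → (B + A * i) * (B + A * i) ≡ (i * i * (A * A) + i * ((+ 2) * (A * B))) + B * B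
    square = solve-∀
    idem : ∀ c → 𝟙 (c ≟ 0#) * 𝟙 (c ≟ 0#) * (A * A) + 𝟙 (c ≟ 0#) * ((+ 2) * (A * B)) ≡ 𝟙 (c ≟ 0#) * (A * A + (+ 2) * (A * B))
    idem c with c ≟ 0#
    ... | yes _ = sym (ℤ.*-distribˡ-+ 1ℤ (A * A) ((+ 2) * (A * B)))
    ... | no _  = refl

  S-one : ∀ b ψ z → S one b ψ z ≡ J b ψ z
  S-one b ψ z = Σ-cong fs (λ c → ℤ.*-identityˡ (ψ (z ⊕ c ⊗ b)))

  energy≥0 : ∀ w → 0ℤ ≤ energy w
  energy≥0 w = Σ-nonneg fs (λ c → 0≤² (w c))

  I-cauchy-schwarz : ∀ w bs ψ z → I w bs ψ z ² ≤ energy w ℤ.^ length bs * I one bs (λ y → ψ y ²) z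
  I-cauchy-schwarz w []       ψ z = ℤ.≤-reflexive (sym (ℤ.*-identityˡ (ψ z ²)))
  I-cauchy-schwarz w (b ∷ bs) ψ z = begin
    S w b (I w bs ψ) z ²
      ≤⟨ cauchy-schwarz fs w (λ c → I w bs ψ (z ⊕ c ⊗ b)) ⟩
    energy w * (Σ[ c ∈ fs ] I w bs ψ (z ⊕ c ⊗ b) ²)
      ≤⟨ *-mono-≤ (energy≥0 w) (Σ-nonneg fs (λ c → 0≤² (I w bs ψ (z ⊕ c ⊗ b)))) ℤ.≤-refl
           (Σ-mono fs (λ c → I-cauchy-schwarz w bs ψ (z ⊕ c ⊗ b))) ⟩
    energy w * (Σ[ c ∈ fs ] (eⁿ * I one bs (λ y → ψ y ²) (z ⊕ c ⊗ b)))
      ≡⟨ cong (energy w *_) (trans (Σ-*ˡ fs eⁿ (λ c → I one bs (λ y → ψ y ²) (z ⊕ c ⊗ b)))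
           (cong (eⁿ *_) (sym (S-one b (I one bs (λ y → ψ y ²)) z)))) ⟩
    energy w * (eⁿ * S one b (I one bs (λ y → ψ y ²)) z)
      ≡⟨ ℤ.*-assoc (energy w) eⁿ _ ⟨
    energy w * eⁿ * S one b (I one bs (λ y → ψ y ²)) z ∎
    where
    open ℤ.≤-Reasoning
    eⁿ = energy w ℤ.^ length bs

  -- The representations a = Σ cᵢ bᵢ counted with weight ∏ w(cᵢ). It turns `I` into one sum over K,
  -- from which linearity and the exchange of sums are read off.
  kernel : (Carrier → ℤ) → List Carrier → Carrier → ℤ
  kernel w []       a = 𝟙 (a ≟ 0#)
  kernel w (b ∷ bs) a = Σ[ c ∈ fs ] (w c * kernel w bs (a ⊕ ⊖ (c ⊗ b)))

  I-kernel : ∀ w bs ψ z → I w bs ψ z ≡ Σ[ a ∈ elements ] (kernel w bs a * ψ (z ⊕ a))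
  I-kernel w [] ψ z = sym (trans
    (Σ-only unique (complete 0#) (λ {a} _ a≢0 → trans (cong (_* ψ (z ⊕ a)) (𝟙-no (a ≟ 0#) a≢0)) (ℤ.*-zeroˡ (ψ (z ⊕ a)))))
    (trans (cong₂ _*_ (𝟙-yes (0# ≟ 0#) refl) (cong ψ (R.+-identityʳ z))) (ℤ.*-identityˡ (ψ z))))
  I-kernel w (b ∷ bs) ψ z = begin
    Σ[ c ∈ fs ] (w c * I w bs ψ (z ⊕ c ⊗ b))
      ≡⟨ Σ-cong fs (λ c → trans (cong (w c *_) (shift c))
           (sym (Σ-*ˡ elements (w c) (λ a → kernel w bs (a ⊕ ⊖ (c ⊗ b)) * ψ (z ⊕ a))))) ⟩
    Σ[ c ∈ fs ] Σ[ a ∈ elements ] (w c * (kernel w bs (a ⊕ ⊖ (c ⊗ b)) * ψ (z ⊕ a)))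
      ≡⟨ Σ-swap fs elements (λ c a → w c * (kernel w bs (a ⊕ ⊖ (c ⊗ b)) * ψ (z ⊕ a))) ⟩
    Σ[ a ∈ elements ] Σ[ c ∈ fs ] (w c * (kernel w bs (a ⊕ ⊖ (c ⊗ b)) * ψ (z ⊕ a)))
      ≡⟨ Σ-cong elements (λ a → trans
           (Σ-cong fs (λ c → sym (ℤ.*-assoc (w c) (kernel w bs (a ⊕ ⊖ (c ⊗ b))) (ψ (z ⊕ a)))))
           (Σ-*ʳ fs (ψ (z ⊕ a)) (λ c → w c * kernel w bs (a ⊕ ⊖ (c ⊗ b))))) ⟩
    Σ[ a ∈ elements ] (kernel w (b ∷ bs) a * ψ (z ⊕ a)) ∎
    where
    open ≡-Reasoning
    rearrange : ∀ z d a → z ⊕ d ⊕ (a ⊕ ⊖ d) ≡ z ⊕ a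
    rearrange z d a = trans (R.+-assoc z d (a ⊕ ⊖ d)) (cong (z ⊕_) (trans (R.+-comm d (a ⊕ ⊖ d)) (⊖-cancel-⊕ʳ a d)))
    shift : ∀ c → I w bs ψ (z ⊕ c ⊗ b) ≡ Σ[ a ∈ elements ] (kernel w bs (a ⊕ ⊖ (c ⊗ b)) * ψ (z ⊕ a))
    shift c = trans (I-kernel w bs ψ (z ⊕ c ⊗ b))
      (trans (sym (ΣK-translate (⊖ (c ⊗ b)) (λ a → kernel w bs a * ψ (z ⊕ c ⊗ b ⊕ a))))
        (Σ-cong elements (λ a → cong (λ y → kernel w bs (a ⊕ ⊖ (c ⊗ b)) * ψ y) (rearrange z (c ⊗ b) a))))

  I-linear : ∀ w bs k f g z → I w bs (λ x → k * f x - g x) z ≡ k * I w bs f z - I w bs g z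
  I-linear w bs k f g z = begin
    I w bs (λ x → k * f x - g x) z
      ≡⟨ I-kernel w bs (λ x → k * f x - g x) z ⟩
    Σ[ a ∈ elements ] (ω a * (k * f (z ⊕ a) - g (z ⊕ a)))
      ≡⟨ Σ-cong elements (λ a → distrib (ω a) k (f (z ⊕ a)) (g (z ⊕ a))) ⟩
    Σ[ a ∈ elements ] (k * (ω a * f (z ⊕ a)) - ω a * g (z ⊕ a))
      ≡⟨ Σ-minus elements (λ a → k * (ω a * f (z ⊕ a))) (λ a → ω a * g (z ⊕ a)) ⟩
    Σ[ a ∈ elements ] (k * (ω a * f (z ⊕ a))) - Σ[ a ∈ elements ] (ω a * g (z ⊕ a))
      ≡⟨ cong₂ _-_ (trans (Σ-*ˡ elements k (λ a → ω a * f (z ⊕ a))) (cong (k *_) (sym (I-kernel w bs f z))))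
                   (sym (I-kernel w bs g z)) ⟩
    k * I w bs f z - I w bs g z ∎
    where
    open ≡-Reasoning
    ω = kernel w bs
    distrib : ∀ w k f g → w * (k * f - g) ≡ k * (w * f) - w * g
    distrib = solve-∀

  I-Σ : ∀ w bs (xs : List A) (f : A → Carrier → ℤ) z →
    I w bs (λ x → Σ[ i ∈ xs ] f i x) z ≡ Σ[ i ∈ xs ] I w bs (f i) z
  I-Σ w bs xs f z = begin
    I w bs (λ x → Σ[ i ∈ xs ] f i x) z
      ≡⟨ I-kernel w bs (λ x → Σ[ i ∈ xs ] f i x) z ⟩
    Σ[ a ∈ elements ] (ω a * (Σ[ i ∈ xs ] f i (z ⊕ a)))
      ≡⟨ Σ-cong elements (λ a → sym (Σ-*ˡ xs (ω a) (λ i → f i (z ⊕ a)))) ⟩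
    Σ[ a ∈ elements ] Σ[ i ∈ xs ] (ω a * f i (z ⊕ a))
      ≡⟨ Σ-swap elements xs (λ a i → ω a * f i (z ⊕ a)) ⟩
    Σ[ i ∈ xs ] Σ[ a ∈ elements ] (ω a * f i (z ⊕ a))
      ≡⟨ Σ-cong xs (λ i → sym (I-kernel w bs (f i) z)) ⟩
    Σ[ i ∈ xs ] I w bs (f i) z ∎
    where
    open ≡-Reasoning
    ω = kernel w bs

  I-* : ∀ w bs k f z → I w bs (λ x → k * f x) z ≡ k * I w bs f z
  I-* w []       k f z = refl
  I-* w (b ∷ bs) k f z = trans (S-cong w b (I-* w bs k f) z) (S-* w b k (I w bs f) z)

  I-const : ∀ A B k bs z → I (affine A B) bs (λ _ → k) z ≡ (A + q * B) ℤ.^ length bs * k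
  I-const A B k []       z = sym (ℤ.*-identityˡ k)
  I-const A B k (b ∷ bs) z = begin
    S (affine A B) b (I (affine A B) bs (λ _ → k)) z  ≡⟨ S-cong (affine A B) b (I-const A B k bs) z ⟩
    S (affine A B) b (λ _ → r) z  ≡⟨ S-affine A B b (λ _ → r) z ⟩
    A * r + B * (Σ[ c ∈ fs ] r)  ≡⟨ cong (λ y → A * r + B * y) (Σ-const fs r) ⟩
    A * r + B * (q * r)  ≡⟨ collect A B q ((A + q * B) ℤ.^ length bs) k ⟩
    (A + q * B) * (A + q * B) ℤ.^ length bs * k  ∎
    where
    open ≡-Reasoning
    r = (A + q * B) ℤ.^ length bs * k
    collect : ∀ A B q r k → A * (r * k) + B * (q * (r * k)) ≡ (A + q * B) * r * k
    collect = solve-∀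

  I-one-const : ∀ k bs z → I one bs (λ _ → k) z ≡ q ℤ.^ length bs * k
  I-one-const k []       z = sym (ℤ.*-identityˡ k)
  I-one-const k (b ∷ bs) z = trans (S-cong one b (I-one-const k bs) z)
    (trans (S-one b (λ _ → r) z) (trans (Σ-const fs r) (sym (ℤ.*-assoc q _ k))))
    where
    r = q ℤ.^ length bs * k

  star-range : ∀ c → 0ℤ ≤ star c × star c ≤ 1ℤ
  star-range c with c ≟ 0#
  ... | yes _ = ℤ.≤-refl , +≤+ z≤n
  ... | no _  = +≤+ z≤n , ℤ.≤-refl

  I-star-range : ∀ bs {θ : Carrier → ℤ} → (∀ x → 0ℤ ≤ θ x) → ∀ z → 0ℤ ≤ I star bs θ z × I star bs θ z ≤ I one bs θ z
  I-star-range []       θ≥0 z = θ≥0 z , ℤ.≤-refl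
  I-star-range (b ∷ bs) θ≥0 z =
    Σ-nonneg fs (λ c → 0≤* (proj₁ (star-range c)) (proj₁ (I-star-range bs θ≥0 (z ⊕ c ⊗ b)))) ,
    Σ-mono fs (λ c → *-mono-≤ (proj₁ (star-range c)) (proj₁ (I-star-range bs θ≥0 (z ⊕ c ⊗ b)))
      (proj₂ (star-range c)) (proj₂ (I-star-range bs θ≥0 (z ⊕ c ⊗ b))))

  data InBox : List Carrier → Carrier → Carrier → Set where
    stop : ∀ {z} → InBox [] z z
    step : ∀ {b bs z x c} → c ∈ fs → c ≢ 0# → InBox bs (z ⊕ c ⊗ b) x → InBox (b ∷ bs) z x

  I-star≢0⇒∃ : ∀ bs ψ z → I star bs ψ z ≢ 0ℤ → ∃ λ x → InBox bs z x × ψ x ≢ 0ℤ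
  I-star≢0⇒∃ []       ψ z h = z , stop , h
  I-star≢0⇒∃ (b ∷ bs) ψ z h
    with c , c∈ , term≢0 ← Σ≢0⇒∃ fs (λ c → star c * I star bs ψ (z ⊕ c ⊗ b)) h
    with x , inbox , ψx≢0 ← I-star≢0⇒∃ bs ψ (z ⊕ c ⊗ b)
           (λ e → term≢0 (trans (cong (star c *_) e) (ℤ.*-zeroʳ (star c)))) =
    x , step c∈ c≢0 inbox , ψx≢0
    where
    c≢0 : c ≢ 0#
    c≢0 refl = term≢0 (cong (λ y → (1ℤ + - 1ℤ * y) * I star bs ψ (z ⊕ 0# ⊗ b)) (𝟙-yes (0# ≟ 0#) refl))

  -- Linear independence witnessed by subgroups: V contains the multiples of all later vectors but
  -- no nonzero multiple of b. The hyperplanes supply such V directly, namely their direction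
  -- spaces.
  data Separated : List Carrier → Set₁ where
    []  : Separated []
    sep : ∀ {b bs} (V : Carrier → Set) → V 0# → (∀ {x y} → V x → V y → V (x ⊕ y)) → (∀ {x} → V x → V (⊖ x)) →
      (∀ {d} → d ∈ bs → ∀ {c} → c ∈ fs → V (c ⊗ d)) → (∀ {c} → c ∈ fs → c ≢ 0# → ¬ V (c ⊗ b)) →
      Separated bs → Separated (b ∷ bs)

  kernel-support : ∀ bs (V : Carrier → Set) → V 0# → (∀ {x y} → V x → V y → V (x ⊕ y)) →
    (∀ {d} → d ∈ bs → ∀ {c} → c ∈ fs → V (c ⊗ d)) → ∀ a → kernel one bs a ≢ 0ℤ → V a
  kernel-support [] V V0 V⊕ V⊗ a h with a ≟ 0#
  ... | yes refl = V0
  ... | no _     = ⊥-elim (h refl)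
  kernel-support (b ∷ bs) V V0 V⊕ V⊗ a h
    with c , c∈ , term≢0 ← Σ≢0⇒∃ fs (λ c → 1ℤ * kernel one bs (a ⊕ ⊖ (c ⊗ b))) h =
    subst V (⊖-cancel-⊕ʳ a (c ⊗ b))
      (V⊕ (kernel-support bs V V0 V⊕ (V⊗ ∘ there) (a ⊕ ⊖ (c ⊗ b)) (λ e → term≢0 (cong (1ℤ *_) e))) (V⊗ (here refl) c∈))

  -- Representations are unique: if coefficients c and d of b both left a remainder in V, the
  -- difference (c - d) b would lie in V.
  kernel-range : ∀ {bs} → Separated bs → ∀ a → 0ℤ ≤ kernel one bs a × kernel one bs a ≤ 1ℤ
  kernel-range [] a = 0≤𝟙 (a ≟ 0#) , 𝟙≤1 (a ≟ 0#)
  kernel-range {b ∷ bs} (sep V V0 V⊕ V⊖ V⊗ ∉V s) a =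
    Σ-nonneg fs (λ c → 0≤* {1ℤ} (+≤+ z≤n) (proj₁ (kernel-range s (a ⊕ ⊖ (c ⊗ b))))) ,
    Σ-at-most-one fs-unique (λ c → subst (_≤ 1ℤ) (sym (ℤ.*-identityˡ _)) (proj₂ (kernel-range s (a ⊕ ⊖ (c ⊗ b))))) same
    where
    supported : ∀ {c} → 1ℤ * kernel one bs (a ⊕ ⊖ (c ⊗ b)) ≢ 0ℤ → V (a ⊕ ⊖ (c ⊗ b))
    supported {c} h = kernel-support bs V V0 V⊕ V⊗ (a ⊕ ⊖ (c ⊗ b)) (λ e → h (cong (1ℤ *_) e))
    cancel : ∀ a x y → (a ⊕ ⊖ y) ⊕ ⊖ (a ⊕ ⊖ x) ≡ x ⊕ ⊖ y
    cancel a x y = begin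
      (a ⊕ ⊖ y) ⊕ ⊖ (a ⊕ ⊖ x)  ≡⟨ cong ((a ⊕ ⊖ y) ⊕_) (trans (sym (RP.-‿+-comm a (⊖ x))) (cong (⊖ a ⊕_) (RP.-‿involutive x))) ⟩
      (a ⊕ ⊖ y) ⊕ (⊖ a ⊕ x)  ≡⟨ cong (_⊕ (⊖ a ⊕ x)) (R.+-comm a (⊖ y)) ⟩
      (⊖ y ⊕ a) ⊕ (⊖ a ⊕ x)  ≡⟨ R.+-assoc (⊖ y) a (⊖ a ⊕ x) ⟩
      ⊖ y ⊕ (a ⊕ (⊖ a ⊕ x))  ≡⟨ cong (⊖ y ⊕_) (trans (sym (R.+-assoc a (⊖ a) x)) (trans (cong (_⊕ x) (R.-‿inverseʳ a)) (R.+-identityˡ x))) ⟩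
      ⊖ y ⊕ x  ≡⟨ R.+-comm (⊖ y) x ⟩
      x ⊕ ⊖ y  ∎
      where open ≡-Reasoning
    ⊖⊗ : ∀ c d → c ⊗ b ⊕ ⊖ (d ⊗ b) ≡ (c ⊕ ⊖ d) ⊗ b
    ⊖⊗ c d = trans (cong (c ⊗ b ⊕_) (RP.-‿distribˡ-* d b)) (sym (R.distribʳ b c (⊖ d)))
    same : ∀ {c d} → c ∈ fs → d ∈ fs → 1ℤ * kernel one bs (a ⊕ ⊖ (c ⊗ b)) ≢ 0ℤ →
      1ℤ * kernel one bs (a ⊕ ⊖ (d ⊗ b)) ≢ 0ℤ → c ≡ d
    same {c} {d} c∈ d∈ hc hd with (c ⊕ ⊖ d) ≟ 0#
    ... | yes eq = ⊖-unique c d eq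
    ... | no neq = ⊥-elim (∉V (⊕∈fs c∈ (⊖∈fs d∈)) neq
            (subst V (trans (cancel a (c ⊗ b) (d ⊗ b)) (⊖⊗ c d)) (V⊕ (supported hd) (V⊖ (supported hc)))))

  module Basis (bs : List Carrier) (separated : Separated bs) (card≡ : + card ≡ q ℤ.^ length bs) where

    Σkernel : Σ elements (kernel one bs) ≡ + card
    Σkernel = trans (Σ-cong elements (λ a → sym (ℤ.*-identityʳ (kernel one bs a))))
      (trans (sym (I-kernel one bs (λ _ → 1ℤ) 0#)) (trans (I-one-const 1ℤ bs 0#) (trans (ℤ.*-identityʳ _) (sym card≡))))

    -- The q^n combinations are distinct, hence exhaust K.
    kernel≡1 : ∀ a → kernel one bs a ≡ 1ℤ
    kernel≡1 a = ℤ.≤-antisym (proj₂ (kernel-range separated a)) (ℤ.i-j≤0⇒i≤j (subst (1ℤ - kernel one bs a ≤_) total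
      (Σ-term≤ elements (λ x → ℤ.i≤j⇒0≤j-i (proj₂ (kernel-range separated x))) (complete a))))
      where
      total : Σ[ x ∈ elements ] (1ℤ - kernel one bs x) ≡ 0ℤ
      total = trans (Σ-minus elements one (kernel one bs)) (trans (cong₂ _-_ (Σ-1 elements) Σkernel) (ℤ.+-inverseʳ (+ card)))

    I-one : ∀ ψ z → I one bs ψ z ≡ Σ elements ψ
    I-one ψ z = trans (I-kernel one bs ψ z)
      (trans (Σ-cong elements (λ a → trans (cong (_* ψ (z ⊕ a)) (kernel≡1 a)) (ℤ.*-identityˡ (ψ (z ⊕ a)))))
        (ΣK-translateˡ z ψ))

    -- The Cauchy–Schwarz bound applied to the kernel itself: T² ≤ eⁿ T for T = Σ ω².
    kernel-energy : ∀ w → Σ[ a ∈ elements ] kernel w bs a ² ≤ energy w ℤ.^ length bs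
    kernel-energy w = cases (total ℤ.≟ 0ℤ)
      where
      total = Σ[ a ∈ elements ] kernel w bs a ²
      eⁿ = energy w ℤ.^ length bs
      I≡total : I w bs (kernel w bs) 0# ≡ total
      I≡total = trans (I-kernel w bs (kernel w bs) 0#)
        (Σ-cong elements (λ a → cong (λ y → kernel w bs a * kernel w bs y) (R.+-identityˡ a)))
      total²≤ : total * total ≤ eⁿ * total
      total²≤ = subst₂ _≤_ (cong _² I≡total) (cong (eⁿ *_) (I-one (λ y → kernel w bs y ²) 0#))
        (I-cauchy-schwarz w bs (kernel w bs) 0#)
      cases : Dec (total ≡ 0ℤ) → total ≤ eⁿ
      cases (yes total≡0) = subst (_≤ eⁿ) (sym total≡0) (^-nonneg (length bs) (energy≥0 w))
      cases (no  total≢0) = ℤ.*-cancelʳ-≤-pos total eⁿ total total²≤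
        where
        instance _ = ℤ.positive (ℤ.≤∧≢⇒< (Σ-nonneg elements (λ a → 0≤² (kernel w bs a))) (total≢0 ∘ sym))

module CharacterBound (K : FiniteField) (γ : FiniteField.Carrier K) (γ≢0 : γ ≢ FiniteField.0# K)
  (γ-full : CyclicGroup.HasFullOrder K γ)
  (fs : List (FiniteField.Carrier K)) (fs-unique : Unique fs)
  (0∈fs : FiniteField.0# K ∈ fs)
  (⊕∈fs : ∀ {x y} → x ∈ fs → y ∈ fs → FiniteField._+_ K x y ∈ fs)
  (⊖∈fs : ∀ {x} → x ∈ fs → FiniteField.-_ K x ∈ fs) where
  open PrimitiveIndicator K γ γ≢0 γ-full public
  open BoxSums K fs fs-unique 0∈fs ⊕∈fs ⊖∈fs public
    using (q; I; I-cong; one; affine; star; I-I; energy; energy≥0; energy-affine; I-cauchy-schwarz; kernel; I-kernel; I-linear;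
           I-Σ; I-*; I-const; I-one-const; I-star-range; InBox; stop; step; I-star≢0⇒∃; Separated; []; sep; module Basis)

  private
    module R = CommutativeRing ring
    instance _ = m-nonZero

  open import Algebra.Solver.Ring.NaturalCoefficients.Default R.commutativeSemiring
    using (solve; _:=_; _:*_)

  module _ (p : ℕ) (ds : List ℕ) (cd : Conductor (p ∷ ds)) where
    private
      χ : Carrier → ℤ
      χ = C (p ∷ ds)
      φχ = φ (p ∷ ds)
      χ1 : χ 1# ≡ φχ
      χ1 = C-1 (p ∷ ds) (Conductor.divisors cd)
      χ0 : χ 0# ≡ 0ℤ
      χ0 = C-0 (p ∷ ds)
      φχ≥0 : 0ℤ ≤ φχ
      φχ≥0 = φ≥0 (Conductor.primes cd)

    χ-vanish : ∀ g {w} → w ≡ 0# → χ (g ⊗ w) ≡ 0ℤ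
    χ-vanish g refl = trans (cong χ (R.zeroʳ g)) χ0

    χ-orthogonality : ∀ w → Σ[ g ∈ units ] (χ (g ⊗ w) * χ g) ≡ + m * χ w
    χ-orthogonality w = cases (w ≟ 0#)
      where
      cases : Dec (w ≡ 0#) → Σ[ g ∈ units ] (χ (g ⊗ w) * χ g) ≡ + m * χ w
      cases (no w≢0)  = C-orthogonality (p ∷ ds) cd w≢0
      cases (yes w≡0) = trans
       (Σ-vanish units (λ {g} _ → trans (cong (_* χ g) (χ-vanish g w≡0)) (ℤ.*-zeroˡ (χ g))))
       (sym (trans (cong (+ m *_) (trans (cong χ w≡0) χ0)) (ℤ.*-zeroʳ (+ m))))

    -- After rescaling g, the inner sum depends only on 1 + v / z. For v ≠ 0 the quotient v / z runs
    -- through the units, and since χ has sum 0 over K, the sum of χ(1 + y) over y ≠ 0 is -χ(1).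
    χ-correlation : ∀ v → Σ[ z ∈ elements ] Σ[ g ∈ units ] (χ (g ⊗ (z ⊕ v)) * χ (g ⊗ z))
      ≡ + m * φχ * (+ card * 𝟙 (v ≟ 0#) - 1ℤ)
    χ-correlation v = begin
      Σ[ z ∈ elements ] corr z
        ≡⟨ ΣK≡ΣU corr ⟩
      corr 0# + Σ[ z ∈ units ] corr z
        ≡⟨ cong₂ _+_ (Σ-vanish units (λ {g} _ → trans (cong (χ (g ⊗ (0# ⊕ v)) *_) (χ-vanish g refl)) (ℤ.*-zeroʳ (χ (g ⊗ (0# ⊕ v))))))
                     (Σ-cong-∈ units (λ z∈ → corr-unit (∈units⁻ z∈))) ⟩
      0ℤ + Σ[ z ∈ units ] (+ m * χ (1# ⊕ v ⊗ inv z))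
        ≡⟨ trans (ℤ.+-identityˡ _) (Σ-*ˡ units (+ m) (λ z → χ (1# ⊕ v ⊗ inv z))) ⟩
      + m * (Σ[ z ∈ units ] χ (1# ⊕ v ⊗ inv z))
        ≡⟨ trans (cong (+ m *_) (finish v)) (sym (ℤ.*-assoc (+ m) φχ _)) ⟩
      + m * φχ * (+ card * 𝟙 (v ≟ 0#) - 1ℤ) ∎
      where
      open ≡-Reasoning
      corr : Carrier → ℤ
      corr z = Σ[ g ∈ units ] (χ (g ⊗ (z ⊕ v)) * χ (g ⊗ z))
      corr-unit : ∀ {z} → z ≢ 0# → corr z ≡ + m * χ (1# ⊕ v ⊗ inv z)
      corr-unit {z} z≢0 = trans
        (Σ-cong units (λ g → cong (λ y → χ y * χ (g ⊗ z)) (trans (cong (g ⊗_) z⊕v) (regroup g z w))))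
        (trans (ΣU-scale z≢0 (λ g → χ (g ⊗ w) * χ g)) (χ-orthogonality w))
        where
        w = 1# ⊕ v ⊗ inv z
        regroup : ∀ g z w → g ⊗ (w ⊗ z) ≡ (g ⊗ z) ⊗ w
        regroup = solve 3 (λ g z w → g :* (w :* z) := (g :* z) :* w) refl
        z⊕v : z ⊕ v ≡ w ⊗ z
        z⊕v = sym (trans (R.distribʳ z 1# (v ⊗ inv z)) (cong₂ _⊕_ (R.*-identityˡ z) (inv-⊗-cancelʳ v z≢0)))
      finish : ∀ v → Σ[ z ∈ units ] χ (1# ⊕ v ⊗ inv z) ≡ φχ * (+ card * 𝟙 (v ≟ 0#) - 1ℤ)
      finish v = cases (v ≟ 0#)
        where
        card-1 : + card * 1ℤ - 1ℤ ≡ + m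
        card-1 = trans (cong (λ k → + k * 1ℤ - 1ℤ) card≡1+m) (drop-1 (+ m))
          where
          drop-1 : ∀ m → (1ℤ + m) * 1ℤ - 1ℤ ≡ m
          drop-1 = solve-∀
        drop : ∀ a s → s ≡ a + s - a
        drop = solve-∀
        negate : ∀ f k → 0ℤ - f ≡ f * (k * 0ℤ - 1ℤ)
        negate = solve-∀
        cases : (d : Dec (v ≡ 0#)) → Σ[ z ∈ units ] χ (1# ⊕ v ⊗ inv z) ≡ φχ * (+ card * 𝟙 d - 1ℤ)
        cases (yes v≡0) = trans
          (Σ-cong units (λ z → trans (cong χ (trans (cong (1# ⊕_) (trans (cong (_⊗ inv z) v≡0) (R.zeroˡ (inv z)))) (R.+-identityʳ 1#))) χ1))
          (trans (Σ-const units φχ) (trans (ℤ.*-comm (+ m) φχ) (cong (φχ *_) (sym card-1))))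
        cases (no v≢0) = begin
          Σ[ z ∈ units ] χ (1# ⊕ v ⊗ inv z)  ≡⟨ ΣU-divide v≢0 (λ y → χ (1# ⊕ y)) ⟩
          Σ[ y ∈ units ] χ (1# ⊕ y)  ≡⟨ drop (χ (1# ⊕ 0#)) _ ⟩
          χ (1# ⊕ 0#) + Σ[ y ∈ units ] χ (1# ⊕ y) - χ (1# ⊕ 0#)
            ≡⟨ cong₂ _-_ (trans (sym (ΣK≡ΣU (λ y → χ (1# ⊕ y)))) (trans (ΣK-translateˡ 1# χ) (ΣC≡0 p ds cd)))
                         (trans (cong χ (R.+-identityʳ 1#)) χ1) ⟩
          0ℤ - φχ  ≡⟨ negate φχ (+ card) ⟩
          φχ * (+ card * 0ℤ - 1ℤ)  ∎

    χ-dilate : Carrier → Carrier → ℤ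
    χ-dilate g x = χ (g ⊗ x)

    -- The correlation matrix of the translates is m φ (|K| · identity - all ones). The second part
    -- contributes minus a square and is dropped.
    χ-energy : ∀ w bs → Σ[ g ∈ units ] Σ[ z ∈ elements ] I w bs (χ-dilate g) z ²
      ≤ + m * φχ * + card * (Σ[ a ∈ elements ] kernel w bs a ²)
    χ-energy w bs = subst (_≤ + m * φχ * + card * T₂) (sym total)
      (minus-≤ (+ m * φχ * + card * T₂) (0≤* (0≤* {+ m} (+≤+ z≤n) φχ≥0) (0≤² T₁)))
      where
      open ≡-Reasoning
      ω = kernel w bs
      T₁ = Σ elements ω
      T₂ = Σ[ a ∈ elements ] ω a ²
      pair : Carrier → Carrier → ℤ
      pair a b = Σ[ g ∈ units ] Σ[ z ∈ elements ] (χ (g ⊗ (z ⊕ a)) * χ (g ⊗ (z ⊕ b)))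
      pair≡ : ∀ a b → pair a b ≡ + m * φχ * (+ card * 𝟙 (b ≟ a) - 1ℤ)
      pair≡ a b = begin
        pair a b
          ≡⟨ Σ-swap units elements (λ g z → χ (g ⊗ (z ⊕ a)) * χ (g ⊗ (z ⊕ b))) ⟩
        Σ[ z ∈ elements ] Σ[ g ∈ units ] (χ (g ⊗ (z ⊕ a)) * χ (g ⊗ (z ⊕ b)))
          ≡⟨ ΣK-translate (⊖ b) (λ z → Σ[ g ∈ units ] (χ (g ⊗ (z ⊕ a)) * χ (g ⊗ (z ⊕ b)))) ⟨
        Σ[ z ∈ elements ] Σ[ g ∈ units ] (χ (g ⊗ (z ⊕ ⊖ b ⊕ a)) * χ (g ⊗ (z ⊕ ⊖ b ⊕ b)))
          ≡⟨ Σ-cong elements (λ z → Σ-cong units (λ g → cong₂ (λ x y → χ (g ⊗ x) * χ (g ⊗ y))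
               (trans (R.+-assoc z (⊖ b) a) (cong (z ⊕_) (R.+-comm (⊖ b) a))) (⊖-cancel-⊕ʳ z b))) ⟩
        Σ[ z ∈ elements ] Σ[ g ∈ units ] (χ (g ⊗ (z ⊕ (a ⊕ ⊖ b))) * χ (g ⊗ z))
          ≡⟨ χ-correlation (a ⊕ ⊖ b) ⟩
        + m * φχ * (+ card * 𝟙 (a ⊕ ⊖ b ≟ 0#) - 1ℤ)
          ≡⟨ cong (λ i → + m * φχ * (+ card * i - 1ℤ)) (𝟙-cong (a ⊕ ⊖ b ≟ 0#) (b ≟ a)
               (λ e → sym (⊖-unique a b e)) (λ { refl → R.-‿inverseʳ a })) ⟩
        + m * φχ * (+ card * 𝟙 (b ≟ a) - 1ℤ) ∎
      Σ-product : ∀ (f : Carrier → ℤ) → (Σ[ a ∈ elements ] (ω a * f a)) ² ≡ Σ[ a ∈ elements ] Σ[ b ∈ elements ] (ω a * ω b * (f a * f b))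
      Σ-product f = sym (trans
        (Σ-cong elements (λ a → trans (Σ-cong elements (λ b → regroup (ω a) (ω b) (f a) (f b)))
          (Σ-*ˡ elements (ω a * f a) (λ b → ω b * f b))))
        (Σ-*ʳ elements (Σ[ b ∈ elements ] (ω b * f b)) (λ a → ω a * f a)))
        where
        regroup : ∀ x y f g → x * y * (f * g) ≡ x * f * (y * g)
        regroup = solve-∀
      collect : (Σ[ g ∈ units ] Σ[ z ∈ elements ] Σ[ a ∈ elements ] Σ[ b ∈ elements ] (ω a * ω b * (χ (g ⊗ (z ⊕ a)) * χ (g ⊗ (z ⊕ b)))))
        ≡ Σ[ a ∈ elements ] Σ[ b ∈ elements ] (ω a * ω b * pair a b)
      collect = begin
        Σ[ g ∈ units ] Σ[ z ∈ elements ] Σ[ a ∈ elements ] Σ[ b ∈ elements ] F g z a b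
          ≡⟨ Σ-cong units (λ g → Σ-swap elements elements (λ z a → Σ[ b ∈ elements ] F g z a b)) ⟩
        Σ[ g ∈ units ] Σ[ a ∈ elements ] Σ[ z ∈ elements ] Σ[ b ∈ elements ] F g z a b
          ≡⟨ Σ-swap units elements (λ g a → Σ[ z ∈ elements ] Σ[ b ∈ elements ] F g z a b) ⟩
        Σ[ a ∈ elements ] Σ[ g ∈ units ] Σ[ z ∈ elements ] Σ[ b ∈ elements ] F g z a b
          ≡⟨ Σ-cong elements (λ a → Σ-cong units (λ g → Σ-swap elements elements (λ z b → F g z a b))) ⟩
        Σ[ a ∈ elements ] Σ[ g ∈ units ] Σ[ b ∈ elements ] Σ[ z ∈ elements ] F g z a b
          ≡⟨ Σ-cong elements (λ a → Σ-swap units elements (λ g b → Σ[ z ∈ elements ] F g z a b)) ⟩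
        Σ[ a ∈ elements ] Σ[ b ∈ elements ] Σ[ g ∈ units ] Σ[ z ∈ elements ] F g z a b
          ≡⟨ Σ-cong elements (λ a → Σ-cong elements (λ b → trans
               (Σ-cong units (λ g → Σ-*ˡ elements (ω a * ω b) (λ z → χ (g ⊗ (z ⊕ a)) * χ (g ⊗ (z ⊕ b)))))
               (Σ-*ˡ units (ω a * ω b) (λ g → Σ[ z ∈ elements ] (χ (g ⊗ (z ⊕ a)) * χ (g ⊗ (z ⊕ b))))))) ⟩
        Σ[ a ∈ elements ] Σ[ b ∈ elements ] (ω a * ω b * pair a b) ∎
        where
        F : Carrier → Carrier → Carrier → Carrier → ℤ
        F g z a b = ω a * ω b * (χ (g ⊗ (z ⊕ a)) * χ (g ⊗ (z ⊕ b)))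
      row : ∀ a → Σ[ b ∈ elements ] (ω a * ω b * pair a b) ≡ + m * φχ * + card * ω a ² - + m * φχ * T₁ * ω a
      row a = begin
        Σ[ b ∈ elements ] (ω a * ω b * pair a b)
          ≡⟨ Σ-cong elements (λ b → trans (cong (ω a * ω b *_) (pair≡ a b)) (spread (ω a) (ω b) (+ m * φχ) (+ card) (𝟙 (b ≟ a)))) ⟩
        Σ[ b ∈ elements ] (+ m * φχ * + card * ω a * (𝟙 (b ≟ a) * ω b) - + m * φχ * ω a * ω b)
          ≡⟨ Σ-minus elements (λ b → + m * φχ * + card * ω a * (𝟙 (b ≟ a) * ω b)) (λ b → + m * φχ * ω a * ω b) ⟩
        Σ[ b ∈ elements ] (+ m * φχ * + card * ω a * (𝟙 (b ≟ a) * ω b)) - Σ[ b ∈ elements ] (+ m * φχ * ω a * ω b)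
          ≡⟨ cong₂ _-_ (trans (Σ-*ˡ elements (+ m * φχ * + card * ω a) (λ b → 𝟙 (b ≟ a) * ω b)) (cong (+ m * φχ * + card * ω a *_) diagonal))
                       (Σ-*ˡ elements (+ m * φχ * ω a) ω) ⟩
        + m * φχ * + card * ω a * ω a - + m * φχ * ω a * T₁
          ≡⟨ tidy (+ m * φχ) (+ card) (ω a) T₁ ⟩
        + m * φχ * + card * ω a ² - + m * φχ * T₁ * ω a ∎
        where
        spread : ∀ x y k c i → x * y * (k * (c * i - 1ℤ)) ≡ k * c * x * (i * y) - k * x * y
        spread = solve-∀
        tidy : ∀ k c x t → k * c * x * x - k * x * t ≡ k * c * (x * x) - k * t * x
        tidy = solve-∀
        diagonal : Σ[ b ∈ elements ] (𝟙 (b ≟ a) * ω b) ≡ ω a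
        diagonal = trans (Σ-only unique (complete a) (λ {b} _ b≢a → trans (cong (_* ω b) (𝟙-no (b ≟ a) b≢a)) (ℤ.*-zeroˡ (ω b))))
          (trans (cong (_* ω a) (𝟙-yes (a ≟ a) refl)) (ℤ.*-identityˡ (ω a)))
      total : Σ[ g ∈ units ] Σ[ z ∈ elements ] I w bs (χ-dilate g) z ² ≡ + m * φχ * + card * T₂ - + m * φχ * T₁ ²
      total = begin
        Σ[ g ∈ units ] Σ[ z ∈ elements ] I w bs (χ-dilate g) z ²
          ≡⟨ Σ-cong units (λ g → Σ-cong elements (λ z → trans (cong _² (I-kernel w bs (χ-dilate g) z))
               (Σ-product (λ a → χ (g ⊗ (z ⊕ a)))))) ⟩
        Σ[ g ∈ units ] Σ[ z ∈ elements ] Σ[ a ∈ elements ] Σ[ b ∈ elements ] (ω a * ω b * (χ (g ⊗ (z ⊕ a)) * χ (g ⊗ (z ⊕ b))))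
          ≡⟨ collect ⟩
        Σ[ a ∈ elements ] Σ[ b ∈ elements ] (ω a * ω b * pair a b)
          ≡⟨ Σ-cong elements row ⟩
        Σ[ a ∈ elements ] (+ m * φχ * + card * ω a ² - + m * φχ * T₁ * ω a)
          ≡⟨ Σ-minus elements (λ a → + m * φχ * + card * ω a ²) (λ a → + m * φχ * T₁ * ω a) ⟩
        Σ[ a ∈ elements ] (+ m * φχ * + card * ω a ²) - Σ[ a ∈ elements ] (+ m * φχ * T₁ * ω a)
          ≡⟨ cong₂ _-_ (Σ-*ˡ elements (+ m * φχ * + card) (λ a → ω a ²)) (Σ-*ˡ elements (+ m * φχ * T₁) ω) ⟩
        + m * φχ * + card * T₂ - + m * φχ * T₁ * T₁
          ≡⟨ cong (λ y → + m * φχ * + card * T₂ - y) (ℤ.*-assoc (+ m * φχ) T₁ T₁) ⟩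
        + m * φχ * + card * T₂ - + m * φχ * T₁ ² ∎

    module _ (bs : List Carrier) (separated : Separated bs) (card≡ : + card ≡ q ℤ.^ length bs)
      (A B A′ B′ k : ℤ) (h₁ : A * A′ ≡ k * - 1ℤ) (h₂ : A * B′ + B * A′ + q * (B * B′) ≡ k) where
      open Basis bs separated card≡

      -- χ is not multiplicative; instead Σ χ(g) χ(g x) = m χ(x) expresses the box sum through all
      -- dilates of χ, and Cauchy-Schwarz in g applies. For each dilate, kⁿ times the box sum is the
      -- β-sum of its α-sums; Cauchy-Schwarz in the coordinates replaces the former by an energy
      -- over K, which `χ-energy` and `kernel-energy` bound on average over g.
      star-bound : ∀ u → Small ((k ℤ.^ length bs) ²)
        (+ card * (energy (affine A B) ℤ.^ length bs * energy (affine A′ B′) ℤ.^ length bs))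
        φχ (I star bs χ u)
      star-bound u = small φχ≥0 (ℤ.*-cancelˡ-≤-pos _ _ (+ m * + m) (subst₂ _≤_ lhs rhs chain))
        where
        α = affine A B
        β = affine A′ B′
        kⁿ = k ℤ.^ length bs
        eα = energy α ℤ.^ length bs
        eβ = energy β ℤ.^ length bs
        E = I star bs χ u
        G : Carrier → ℤ
        G g = kⁿ * I star bs (χ-dilate g) u
        instance _ = ℤ.positive (ℤ.<-≤-trans (ℤ.+<+ (s≤s z≤n)) (ℤ.≤-trans (+≤+ (ℕ.*-mono-≤ (ℕ.>-nonZero⁻¹ m) (ℕ.>-nonZero⁻¹ m))) (ℤ.≤-reflexive (ℤ.pos-* m m))))
        average : Σ[ g ∈ units ] (χ g * G g) ≡ + m * (kⁿ * E)
        average = begin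
          Σ[ g ∈ units ] (χ g * (kⁿ * I star bs (χ-dilate g) u))
            ≡⟨ Σ-cong units (λ g → trans (exchange (χ g) kⁿ _) (cong (kⁿ *_) (sym (I-* star bs (χ g) (χ-dilate g) u)))) ⟩
          Σ[ g ∈ units ] (kⁿ * I star bs (λ x → χ g * χ-dilate g x) u)
            ≡⟨ Σ-*ˡ units kⁿ (λ g → I star bs (λ x → χ g * χ-dilate g x) u) ⟩
          kⁿ * (Σ[ g ∈ units ] I star bs (λ x → χ g * χ-dilate g x) u)
            ≡⟨ cong (kⁿ *_) (I-Σ star bs units (λ g x → χ g * χ-dilate g x) u) ⟨
          kⁿ * I star bs (λ x → Σ[ g ∈ units ] (χ g * χ (g ⊗ x))) u
            ≡⟨ cong (kⁿ *_) (I-cong star bs (λ x → trans (Σ-cong units (λ g → ℤ.*-comm (χ g) (χ (g ⊗ x)))) (χ-orthogonality x)) u) ⟩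
          kⁿ * I star bs (λ x → + m * χ x) u
            ≡⟨ cong (kⁿ *_) (I-* star bs (+ m) χ u) ⟩
          kⁿ * (+ m * E)
            ≡⟨ exchange kⁿ (+ m) E ⟩
          + m * (kⁿ * E) ∎
          where
          open ≡-Reasoning
          exchange : ∀ x y t → x * (y * t) ≡ y * (x * t)
          exchange = solve-∀
        χ-square : Σ[ g ∈ units ] χ g ² ≡ + m * φχ
        χ-square = trans (Σ-cong units (λ g → cong (λ y → χ y * χ g) (sym (R.*-identityʳ g))))
          (trans (χ-orthogonality 1#) (cong (+ m *_) χ1))
        G-square : ∀ g → G g ² ≤ eβ * (Σ[ z ∈ elements ] I α bs (χ-dilate g) z ²)
        G-square g = subst₂ _≤_ (cong _² (I-I A′ B′ A B k (trans (ℤ.*-comm A′ A) h₁) (trans (symm A B A′ B′ q) h₂) bs (χ-dilate g) u))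
          (cong (eβ *_) (I-one (λ z → I α bs (χ-dilate g) z ²) u))
          (I-cauchy-schwarz β bs (I α bs (χ-dilate g)) u)
          where
          symm : ∀ A B A′ B′ q → A′ * B + B′ * A + q * (B′ * B) ≡ A * B′ + B * A′ + q * (B * B′)
          symm = solve-∀
        eβ≥0 : 0ℤ ≤ eβ
        eβ≥0 = ^-nonneg (length bs) (energy≥0 β)
        mφ≥0 : 0ℤ ≤ + m * φχ
        mφ≥0 = 0≤* {+ m} (+≤+ z≤n) φχ≥0
        chain : (+ m * (kⁿ * E)) ² ≤ + m * φχ * (eβ * (+ m * φχ * + card * eα))
        chain = begin
          (+ m * (kⁿ * E)) ²
            ≡⟨ cong _² average ⟨
          (Σ[ g ∈ units ] (χ g * G g)) ²
            ≤⟨ cauchy-schwarz units χ G ⟩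
          Σ[ g ∈ units ] χ g ² * Σ[ g ∈ units ] G g ²
            ≡⟨ cong (_* Σ[ g ∈ units ] G g ²) χ-square ⟩
          + m * φχ * Σ[ g ∈ units ] G g ²
            ≤⟨ *-mono-≤ mφ≥0 (Σ-nonneg units (λ g → 0≤² (G g))) ℤ.≤-refl bound ⟩
          + m * φχ * (eβ * (+ m * φχ * + card * eα)) ∎
          where
          open ℤ.≤-Reasoning
          bound : Σ[ g ∈ units ] G g ² ≤ eβ * (+ m * φχ * + card * eα)
          bound = begin
            Σ[ g ∈ units ] G g ²
              ≤⟨ Σ-mono units G-square ⟩
            Σ[ g ∈ units ] (eβ * (Σ[ z ∈ elements ] I α bs (χ-dilate g) z ²))
              ≡⟨ Σ-*ˡ units eβ (λ g → Σ[ z ∈ elements ] I α bs (χ-dilate g) z ²) ⟩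
            eβ * (Σ[ g ∈ units ] Σ[ z ∈ elements ] I α bs (χ-dilate g) z ²)
              ≤⟨ *-mono-≤ eβ≥0 (Σ-nonneg units (λ g → Σ-nonneg elements (λ z → 0≤² (I α bs (χ-dilate g) z)))) ℤ.≤-refl (χ-energy α bs) ⟩
            eβ * (+ m * φχ * + card * (Σ[ a ∈ elements ] kernel α bs a ²))
              ≤⟨ *-mono-≤ eβ≥0 (0≤* (0≤* mφ≥0 (+≤+ z≤n)) (Σ-nonneg elements (λ a → 0≤² (kernel α bs a)))) ℤ.≤-refl
                   (*-mono-≤ (0≤* mφ≥0 (+≤+ z≤n)) (Σ-nonneg elements (λ a → 0≤² (kernel α bs a))) ℤ.≤-refl (kernel-energy α)) ⟩
            eβ * (+ m * φχ * + card * eα) ∎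
        lhs : (+ m * (kⁿ * E)) ² ≡ + m * + m * (kⁿ ² * E ²)
        lhs = square (+ m) kⁿ E
          where
          square : ∀ m k e → m * (k * e) * (m * (k * e)) ≡ m * m * (k * k * (e * e))
          square = solve-∀
        rhs : + m * φχ * (eβ * (+ m * φχ * + card * eα)) ≡ + m * + m * (φχ ² * (+ card * (eα * eβ)))
        rhs = regroup (+ m) φχ (+ card) eα eβ
          where
          regroup : ∀ m f c x y → m * f * (y * (m * f * c * x)) ≡ m * m * (f * f * (c * (x * y)))
          regroup = solve-∀

-- Two criteria for a generator in a box

^-distrib-* : ∀ x y n → (x * y) ℤ.^ n ≡ x ℤ.^ n * y ℤ.^ n
^-distrib-* x y zero    = refl
^-distrib-* x y (suc n) = trans (cong (x * y *_) (^-distrib-* x y n)) (interchange x y (x ℤ.^ n) (y ℤ.^ n))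
  where
  interchange : ∀ a b c d → a * b * (c * d) ≡ a * c * (b * d)
  interchange = solve-∀

pos-^ : ∀ k n → + (k ^ n) ≡ (+ k) ℤ.^ n
pos-^ k zero    = refl
pos-^ k (suc n) = trans (ℤ.pos-* k (k ^ n)) (cong (+ k *_) (pos-^ k n))

totient : List ℕ → ℕ
totient ps = product (map pred ps)

CharacterCriterion : ℕ → ℕ → ℕ → Set
CharacterCriterion q n ω = ∃ λ r → r ≢ 0 ×
  2 ^ ω · 2 ^ ω · ((pred q ℕ.+ r · r) · (pred q ℕ.+ r · r)) ^ n
    ℕ.≤ (pred q · (q · (r · r))) ^ n

-- φ(R) m / R > qⁿ - (q - 1)ⁿ for R = ∏ ps, cleared of division and subtraction.
CountingCriterion : ℕ → ℕ → List ℕ → Set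
CountingCriterion q n ps = product ps · q ^ n ℕ.< totient ps · pred (q ^ n) ℕ.+ product ps · pred q ^ n

module BoxPrimitive (K : FiniteField) (γ : FiniteField.Carrier K) (γ≢0 : γ ≢ FiniteField.0# K)
  (γ-full : CyclicGroup.HasFullOrder K γ)
  (fs : List (FiniteField.Carrier K)) (fs-unique : Unique fs)
  (0∈fs : FiniteField.0# K ∈ fs)
  (⊕∈fs : ∀ {x y} → x ∈ fs → y ∈ fs → FiniteField._+_ K x y ∈ fs)
  (⊖∈fs : ∀ {x} → x ∈ fs → FiniteField.-_ K x ∈ fs) where
  open CharacterBound K γ γ≢0 γ-full fs fs-unique 0∈fs ⊕∈fs ⊖∈fs public

  module _ (bs : List Carrier) (separated : Separated bs)
    {s : ℕ} (|fs|≡ : length fs ≡ suc s) {n : ℕ} (|bs|≡ : length bs ≡ n) (card≡ : card ≡ suc s ^ n)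
    (1<s : 1 ℕ.< s) (0<n : 0 ℕ.< n) (u : Carrier) where

    private
      q≡ : q ≡ + suc s
      q≡ = cong +_ |fs|≡
      card≡ℤ : + card ≡ q ℤ.^ length bs
      card≡ℤ = trans (cong +_ card≡) (trans (pos-^ (suc s) n) (cong₂ ℤ._^_ (sym q≡) (sym |bs|≡)))

    open Basis bs separated card≡ℤ

    private
      Z Qⁿ : ℤ
      Z  = (+ s) ℤ.^ n
      Qⁿ = (+ suc s) ℤ.^ n
      L : (Carrier → ℤ) → ℤ
      L ψ = I star bs ψ u
      m≡ : m ≡ pred (suc s ^ n)
      m≡ = cong pred (trans (sym card≡1+m) card≡)
      L-const : ∀ k → L (λ _ → k) ≡ Z * k
      L-const k = trans (I-const (- 1ℤ) 1ℤ k bs u) (cong (_* k) (cong₂ ℤ._^_ (trans (cong (λ y → - 1ℤ + y * 1ℤ) q≡) (drop (+ s))) |bs|≡))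
        where
        drop : ∀ s → - 1ℤ + (1ℤ + s) * 1ℤ ≡ s
        drop = solve-∀

    -- The box has (q - 1)ⁿ points, at most one of which is 0.
    L-units : Z - 1ℤ ≤ L (C [])
    L-units = subst (Z - 1ℤ ≤_) (sym split) (ℤ.+-monoʳ-≤ Z (ℤ.neg-mono-≤ (subst (L δ ≤_) total (proj₂ (I-star-range bs δ≥0 u)))))
      where
      δ : Carrier → ℤ
      δ x = 𝟙 (x ≟ 0#)
      δ≥0 : ∀ x → 0ℤ ≤ δ x
      δ≥0 x = 0≤𝟙 (x ≟ 0#)
      total : I one bs δ u ≡ 1ℤ
      total = trans (I-one δ u) (trans (Σ-only unique (complete 0#) (λ {x} _ x≢0 → 𝟙-no (x ≟ 0#) x≢0)) (𝟙-yes (0# ≟ 0#) refl))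
      split : L (C []) ≡ Z - L δ
      split = trans (I-linear star bs 1ℤ (λ _ → 1ℤ) δ u) (cong (_- L δ) (trans (ℤ.*-identityˡ _) (trans (L-const 1ℤ) (ℤ.*-identityʳ Z))))

    -- R - `indicator` is nonnegative, so its sum over the box is at most its sum over K; without
    -- primitive elements in the box the former is R (q - 1)ⁿ.
    indicator-vanish-counting : L indicator ≡ 0ℤ → φ ps * + m + + product ps * Z ≤ + product ps * Qⁿ
    indicator-vanish-counting L≡0 = ℤ.0≤i-j⇒j≤i (subst (0ℤ ≤_) (regroup R Qⁿ (φ ps * + m) Z) (ℤ.i≤j⇒0≤j-i
      (subst₂ _≤_ starR oneR (proj₂ (I-star-range bs (λ x → ℤ.i≤j⇒0≤j-i (proj₂ (indicator-range x))) u)))))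
      where
      R = + product ps
      regroup : ∀ R Q f Z → R * Q - f - R * Z ≡ R * Q - (f + R * Z)
      regroup = solve-∀
      rest : ∀ x → R - indicator x ≡ 1ℤ * R - indicator x
      rest x = cong (_- indicator x) (sym (ℤ.*-identityˡ R))
      starR : I star bs (λ x → R - indicator x) u ≡ R * Z
      starR = trans (I-cong star bs rest u) (trans (I-linear star bs 1ℤ (λ _ → R) indicator u)
        (trans (cong₂ _-_ (trans (ℤ.*-identityˡ _) (L-const R)) L≡0) (trans (ℤ.+-identityʳ _) (ℤ.*-comm Z R))))
      oneR : I one bs (λ x → R - indicator x) u ≡ R * Qⁿ - φ ps * + m
      oneR = trans (I-cong one bs rest u) (trans (I-linear one bs 1ℤ (λ _ → R) indicator u)
        (cong₂ _-_ (trans (ℤ.*-identityˡ _) (trans (I-one-const R bs u)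
                     (trans (cong (_* R) (trans (sym card≡ℤ) (trans (cong +_ card≡) (pos-^ (suc s) n)))) (ℤ.*-comm Qⁿ R))))
                   (trans (I-one indicator u) Σ-indicator)))

    -- The error must cancel the main term, which is at least φ(R) (Z - 1). Its bound, squared and
    -- divided by φ(R)² q^(3n), is the claim.
    indicator-vanish-character : ∀ r → L indicator ≡ 0ℤ →
      let rⁿ = (+ r) ℤ.^ n; Vⁿ = (+ (s ℕ.+ r · r)) ℤ.^ n in
      r ≢ 0 → Qⁿ * (rⁿ * rⁿ) * (Z - 1ℤ) ² ≤ (W ps - 1ℤ) ² * (Z * (Vⁿ * Vⁿ))
    indicator-vanish-character r L≡0 r≢0 = conclude
      (Expansion.L-main L (λ h → I-cong star bs h u) (λ a f g → I-linear star bs a f g u)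
        {(k ℤ.^ length bs) ²} {+ card * (eα * eβ)} (0≤² (k ℤ.^ length bs)) (0≤* {+ card} (+≤+ z≤n) (0≤* eα≥0 eβ≥0))
        (λ p ds cd → star-bound p ds cd bs separated card≡ℤ α₀ α₁ β₀ β₁ k h₁ h₂ u) ps ps-conductor)
      where
      Q α₀ α₁ β₀ β₁ k S R V : ℤ
      S  = + s
      R  = + r
      Q  = + suc s
      V  = + (s ℕ.+ r · r)
      -- α = (α₀, α₁) has Fourier coefficients q r (trivial character) and q, β has q (q − 1) and −q r,
      -- so that α * β is q² r times the indicator of F*.
      α₀  = q
      α₁  = R - 1ℤ
      β₀ = - (q * R)
      β₁ = q - 1ℤ + R
      k  = q * q * R
      h₁ : α₀ * β₀ ≡ k * - 1ℤ
      h₁ = identity q R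
        where
        identity : ∀ q r → q * - (q * r) ≡ q * q * r * - 1ℤ
        identity = solve-∀
      h₂ : α₀ * β₁ + α₁ * β₀ + q * (α₁ * β₁) ≡ k
      h₂ = identity q R
        where
        identity : ∀ q r → q * (q - 1ℤ + r) + (r - 1ℤ) * - (q * r) + q * ((r - 1ℤ) * (q - 1ℤ + r)) ≡ q * q * r
        identity = solve-∀
      eα = energy (affine α₀ α₁) ℤ.^ length bs
      eβ = energy (affine β₀ β₁) ℤ.^ length bs
      eα≥0 = ^-nonneg (length bs) (energy≥0 (affine α₀ α₁))
      eβ≥0 = ^-nonneg (length bs) (energy≥0 (affine β₀ β₁))
      rⁿ = R ℤ.^ n
      Vⁿ = V ℤ.^ n
      V≡ : V ≡ S + R * R
      V≡ = trans (ℤ.pos-+ s (r · r)) (cong (λ y → S + y) (ℤ.pos-* r r))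
      eα≡ : eα ≡ Qⁿ * Vⁿ
      eα≡ = trans (cong₂ ℤ._^_ (trans (energy-affine α₀ α₁) (trans (cong (λ q → q * q + (+ 2) * (q * α₁) + q * (α₁ * α₁)) q≡)
          (trans (identity S R) (cong (Q *_) (sym V≡))))) |bs|≡) (^-distrib-* Q V n)
        where
        identity : ∀ s r → (1ℤ + s) * (1ℤ + s) + (+ 2) * ((1ℤ + s) * (r - 1ℤ)) + (1ℤ + s) * ((r - 1ℤ) * (r - 1ℤ)) ≡ (1ℤ + s) * (s + r * r)
        identity = solve-∀
      eβ≡ : eβ ≡ Qⁿ * (Z * Vⁿ)
      eβ≡ = trans (cong₂ ℤ._^_ (trans (energy-affine β₀ β₁) (trans
          (cong (λ q → - (q * R) * - (q * R) + (+ 2) * (- (q * R) * (q - 1ℤ + R)) + q * ((q - 1ℤ + R) * (q - 1ℤ + R))) q≡)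
          (trans (identity S R) (cong (λ v → Q * (S * v)) (sym V≡))))) |bs|≡)
          (trans (^-distrib-* Q (S * V) n) (cong (Qⁿ *_) (^-distrib-* S V n)))
        where
        identity : ∀ s r → - ((1ℤ + s) * r) * - ((1ℤ + s) * r) + (+ 2) * (- ((1ℤ + s) * r) * ((1ℤ + s) - 1ℤ + r))
          + (1ℤ + s) * (((1ℤ + s) - 1ℤ + r) * ((1ℤ + s) - 1ℤ + r)) ≡ (1ℤ + s) * (s * (s + r * r))
        identity = solve-∀
      kⁿ≡ : k ℤ.^ length bs ≡ Qⁿ * Qⁿ * rⁿ
      kⁿ≡ = trans (cong₂ ℤ._^_ (cong (λ q → q * q * R) q≡) |bs|≡)
        (trans (^-distrib-* (Q * Q) R n) (cong (_* rⁿ) (^-distrib-* Q Q n)))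
      card≡Qⁿ : + card ≡ Qⁿ
      card≡Qⁿ = trans (cong +_ card≡) (pos-^ (suc s) n)
      ^-pos : ∀ k n → k ≢ 0 → 0ℤ < (+ k) ℤ.^ n
      ^-pos k n k≢0 = subst (0ℤ <_) (pos-^ k n) (ℤ.+<+ (ℕ.m^n>0 k n))
        where instance _ = ℕ.≢-nonZero k≢0
      φ-pos : 0ℤ < φ ps
      φ-pos = positive (Conductor.primes ps-conductor)
        where
        positive : ∀ {ps} → All Prime ps → 0ℤ < φ ps
        positive []         = ℤ.+<+ (s≤s z≤n)
        positive {p ∷ ps} (pp ∷ pps) = *-pos (ℤ.<-≤-trans (ℤ.+<+ (s≤s z≤n)) (ℤ.+-monoˡ-≤ (- 1ℤ) (+≤+ (ℕ.nonTrivial⇒n>1 p)))) (positive pps)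
          where
          instance _ = prime⇒nonTrivial pp
          *-pos : ∀ {x y} → 0ℤ < x → 0ℤ < y → 0ℤ < x * y
          *-pos {x} {y} 0<x 0<y = let instance _ = ℤ.positive 0<y in ℤ.*-monoʳ-<-pos y 0<x
      *-pos : ∀ {x y} → 0ℤ < x → 0ℤ < y → 0ℤ < x * y
      *-pos {x} {y} 0<x 0<y = let instance _ = ℤ.positive 0<y in ℤ.*-monoʳ-<-pos y 0<x
      Qⁿ-pos = ^-pos (suc s) n (λ ())
      instance _ = ℤ.positive (*-pos (*-pos φ-pos φ-pos) (*-pos Qⁿ-pos (*-pos Qⁿ-pos Qⁿ-pos)))
      e≡ : ∀ e → L indicator ≡ φ ps * L (C []) + e → e ≡ - (φ ps * L (C []))
      e≡ e eq = trans (cancel (φ ps * L (C [])) e) (trans (cong (_- φ ps * L (C [])) (trans (sym eq) L≡0)) (ℤ.+-identityˡ _))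
        where
        cancel : ∀ x e → e ≡ x + e - x
        cancel = solve-∀
      Z≥1 : 0ℤ ≤ Z - 1ℤ
      Z≥1 = ℤ.i≤j⇒0≤j-i (ℤ.i<j⇒suc[i]≤j (^-pos s n (λ { refl → ℕ.n≮0 1<s })))
      lower : ∀ e → L indicator ≡ φ ps * L (C []) + e →
        (k ℤ.^ length bs) ² * (φ ps * (Z - 1ℤ)) ² ≤ (k ℤ.^ length bs) ² * e ²
      lower e eq = *-mono-≤ (0≤² (k ℤ.^ length bs)) (0≤² (φ ps * (Z - 1ℤ))) ℤ.≤-refl
        (subst ((φ ps * (Z - 1ℤ)) ² ≤_) (trans (neg² (φ ps * L (C []))) (sym (cong _² (e≡ e eq))))
          (*-mono-≤ φ*≥0 φ*≥0 φ*≤ φ*≤))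
        where
        neg² : ∀ x → x * x ≡ - x * - x
        neg² = solve-∀
        φ*≥0 = 0≤* (ℤ.<⇒≤ φ-pos) Z≥1
        φ*≤ : φ ps * (Z - 1ℤ) ≤ φ ps * L (C [])
        φ*≤ = *-mono-≤ (ℤ.<⇒≤ φ-pos) Z≥1 ℤ.≤-refl L-units
      lhs : ∀ e → L indicator ≡ φ ps * L (C []) + e → (k ℤ.^ length bs) ² * (φ ps * (Z - 1ℤ)) ²
        ≡ φ ps ² * (Qⁿ * (Qⁿ * Qⁿ)) * (Qⁿ * (rⁿ * rⁿ) * (Z - 1ℤ) ²)
      lhs e eq = trans (cong (λ k → k * k * (φ ps * (Z - 1ℤ)) ²) kⁿ≡) (regroup Qⁿ rⁿ (φ ps) (Z - 1ℤ))
        where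
        regroup : ∀ q r f z → q * q * r * (q * q * r) * (f * z * (f * z)) ≡ f * f * (q * (q * q)) * (q * (r * r) * (z * z))
        regroup = solve-∀
      rhs : (φ ps * (W ps - 1ℤ)) ² * (+ card * (eα * eβ)) ≡ φ ps ² * (Qⁿ * (Qⁿ * Qⁿ)) * ((W ps - 1ℤ) ² * (Z * (Vⁿ * Vⁿ)))
      rhs = trans (cong ((φ ps * (W ps - 1ℤ)) ² *_) (cong₂ _*_ card≡Qⁿ (cong₂ _*_ eα≡ eβ≡)))
        (regroup (φ ps) (W ps - 1ℤ) Qⁿ Vⁿ Z)
        where
        regroup : ∀ f w q v z → f * w * (f * w) * (q * (q * v * (q * (z * v)))) ≡ f * f * (q * (q * q)) * (w * w * (z * (v * v)))
        regroup = solve-∀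
      conclude : (∃ λ e → Small ((k ℤ.^ length bs) ²) (+ card * (eα * eβ)) (φ ps * (W ps - 1ℤ)) e × L indicator ≡ φ ps * L (C []) + e) →
        Qⁿ * (rⁿ * rⁿ) * (Z - 1ℤ) ² ≤ (W ps - 1ℤ) ² * (Z * (Vⁿ * Vⁿ))
      conclude (e , small _ e-bound , eq) =
        ℤ.*-cancelˡ-≤-pos _ _ (φ ps ² * (Qⁿ * (Qⁿ * Qⁿ))) (subst₂ _≤_ (lhs e eq) rhs (ℤ.≤-trans (lower e eq) e-bound))

    found : L indicator ≢ 0ℤ → ∃ λ x → InBox bs u x × IsPrimitive K x
    found L≢0 with x , inbox , x≢0 ← I-star≢0⇒∃ bs indicator u L≢0 = x , inbox , indicator≢0⇒IsPrimitive x≢0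

    private
      φ≡totient : ∀ {qs} → All Prime qs → φ qs ≡ + totient qs
      φ≡totient []         = refl
      φ≡totient {p ∷ qs} (pp ∷ pqs) = trans (cong₂ _*_ (p-1 p) (φ≡totient pqs)) (sym (ℤ.pos-* (pred p) (totient qs)))
        where
        instance _ = prime⇒nonZero pp
        p-1 : ∀ p .{{_ : NonZero p}} → + p - 1ℤ ≡ + pred p
        p-1 (suc p) = refl
      W≡ : ∀ qs → W qs ≡ + (2 ^ length qs)
      W≡ []       = refl
      W≡ (p ∷ qs) = trans (cong (+ 2 *_) (W≡ qs)) (sym (ℤ.pos-* 2 (2 ^ length qs)))

    counting : CountingCriterion (suc s) n ps → L indicator ≢ 0ℤ
    counting crit L≡0 = ℕ.<⇒≱ crit (ℤ.drop‿+≤+ (subst₂ _≤_ lhs rhs (indicator-vanish-counting L≡0)))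
      where
      lhs : φ ps * + m + + product ps * Z ≡ + (totient ps · pred (suc s ^ n) ℕ.+ product ps · s ^ n)
      lhs = trans (cong₂ _+_
          (trans (cong₂ (λ x y → x * + y) (φ≡totient (Conductor.primes ps-conductor)) m≡) (sym (ℤ.pos-* (totient ps) _)))
          (trans (cong (+ product ps *_) (sym (pos-^ s n))) (sym (ℤ.pos-* (product ps) _))))
        (sym (ℤ.pos-+ (totient ps · pred (suc s ^ n)) (product ps · s ^ n)))
      rhs : + product ps * Qⁿ ≡ + (product ps · suc s ^ n)
      rhs = trans (cong (+ product ps *_) (sym (pos-^ (suc s) n))) (sym (ℤ.pos-* (product ps) _))

    -- The criterion bounds W² Y by Z X, whereas the estimate involves W - 1 and Z - 1. Multiplying
    -- the estimate by W² and inserting the criterion gives W (Z - 1) ≤ (W - 1) Z, that is Z ≤ W.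
    -- Then X ≤ Y turns the criterion into W ≤ 1, which contradicts 2 ≤ Z.
    character : CharacterCriterion (suc s) n (length ps) → L indicator ≢ 0ℤ
    character (r , r≢0 , crit) L≡0 = contradict Z≤W
      where
      X Y w : ℤ
      X = Qⁿ * ((+ r) ℤ.^ n * (+ r) ℤ.^ n)
      Y = (+ (s ℕ.+ r · r)) ℤ.^ n * (+ (s ℕ.+ r · r)) ℤ.^ n
      w = W ps
      instance _ = ℕ.≢-nonZero r≢0
      instance _ = ℕ.>-nonZero (ℕ.<-trans (s≤s z≤n) 1<s)
      instance _ = ℕ.>-nonZero (ℕ.≤-trans (s≤s z≤n) (ℕ.≤-trans 1<s (ℕ.m≤m+n s (r · r))))
      X≡ : X ≡ + ((suc s · (r · r)) ^ n)
      X≡ = sym (trans (pos-^ (suc s · (r · r)) n) (trans (cong (ℤ._^ n) (trans (ℤ.pos-* (suc s) (r · r)) (cong (+ suc s *_) (ℤ.pos-* r r))))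
        (trans (^-distrib-* (+ suc s) (+ r * + r) n) (cong (Qⁿ *_) (^-distrib-* (+ r) (+ r) n)))))
      Y≡ : Y ≡ + (((s ℕ.+ r · r) · (s ℕ.+ r · r)) ^ n)
      Y≡ = sym (trans (pos-^ _ n) (trans (cong (ℤ._^ n) (ℤ.pos-* (s ℕ.+ r · r) (s ℕ.+ r · r))) (^-distrib-* _ _ n)))
      Z≡ : Z ≡ + (s ^ n)
      Z≡ = sym (pos-^ s n)
      w≥1 : 1ℤ ≤ w
      w≥1 = subst (1ℤ ≤_) (sym (W≡ ps)) (+≤+ (ℕ.m^n>0 2 (length ps)))
      Z≥2 : + 2 ≤ Z
      Z≥2 = subst (+ 2 ≤_) (sym Z≡) (+≤+ (ℕ.≤-trans 1<s (subst (ℕ._≤ s ^ n) (ℕ.*-identityʳ s) (ℕ.^-monoʳ-≤ s 0<n))))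
      Z≥0 : 0ℤ ≤ Z
      Z≥0 = ℤ.≤-trans (+≤+ z≤n) Z≥2
      instance _ = ℤ.positive (subst (0ℤ <_) (sym X≡) (ℤ.+<+ (ℕ.m^n>0 (suc s · (r · r)) {{ℕ.m*n≢0 (suc s) (r · r) {{_}} {{ℕ.m*n≢0 r r}}}} n)))
      crit′ : w * w * Y ≤ Z * X
      crit′ = subst₂ _≤_
        (sym (trans (cong₂ _*_ (cong₂ _*_ (W≡ ps) (W≡ ps)) Y≡)
          (trans (cong (_* + (((s ℕ.+ r · r) · (s ℕ.+ r · r)) ^ n)) (sym (ℤ.pos-* (2 ^ length ps) (2 ^ length ps)))) (sym (ℤ.pos-* (2 ^ length ps · 2 ^ length ps) _)))))
        (trans (pos-^ _ n) (trans (cong (ℤ._^ n) (ℤ.pos-* s (suc s · (r · r))))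
          (trans (^-distrib-* (+ s) (+ (suc s · (r · r))) n) (cong (Z *_) (trans (sym (pos-^ _ n)) (sym X≡))))))
        (+≤+ crit)
      X≤Y : X ≤ Y
      X≤Y = subst₂ _≤_ (sym X≡) (sym Y≡) (+≤+ (ℕ.^-monoˡ-≤ n base))
        where
        expand : ∀ s r → (s ℕ.+ r) · (s ℕ.+ r) ≡ r · s ℕ.+ s · r ℕ.+ (s · s ℕ.+ r · r)
        expand = ℕ-solve
        base : suc s · (r · r) ℕ.≤ (s ℕ.+ r · r) · (s ℕ.+ r · r)
        base = subst (suc s · (r · r) ℕ.≤_) (sym (expand s (r · r)))
          (ℕ.≤-trans (ℕ.+-monoˡ-≤ (s · (r · r)) (ℕ.m≤m*n (r · r) s)) (ℕ.m≤m+n _ _))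
      Z≤W : Z ≤ w
      Z≤W = unfold w Z (square-cancel-≤ (0≤* (ℤ.i≤j⇒0≤j-i w≥1) Z≥0)
        (ℤ.*-cancelˡ-≤-pos _ _ X (subst₂ _≤_ (pull w X (Z - 1ℤ)) (pull′ w Z X) (ℤ.≤-trans
          (*-mono-≤ (0≤² w) (0≤* (ℤ.<⇒≤ (ℤ.positive⁻¹ X)) (0≤² (Z - 1ℤ))) ℤ.≤-refl (indicator-vanish-character r L≡0 r≢0))
          (subst (_≤ (w - 1ℤ) ² * Z * (Z * X)) (shuffle w Z Y) (*-mono-≤ (0≤* (0≤² (w - 1ℤ)) Z≥0) (0≤* (0≤² w) (ℤ.≤-trans (ℤ.<⇒≤ (ℤ.positive⁻¹ X)) X≤Y)) ℤ.≤-refl crit′))))))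
        where
        pull : ∀ w x z → w * w * (x * (z * z)) ≡ x * (w * z * (w * z))
        pull = solve-∀
        pull′ : ∀ w z x → (w - 1ℤ) * (w - 1ℤ) * z * (z * x) ≡ x * ((w - 1ℤ) * z * ((w - 1ℤ) * z))
        pull′ = solve-∀
        shuffle : ∀ w z y → (w - 1ℤ) * (w - 1ℤ) * z * (w * w * y) ≡ w * w * ((w - 1ℤ) * (w - 1ℤ) * (z * y))
        shuffle = solve-∀
        difference : ∀ w z → (w - 1ℤ) * z - w * (z - 1ℤ) ≡ w - z
        difference = solve-∀
        unfold : ∀ w z → w * (z - 1ℤ) ≤ (w - 1ℤ) * z → z ≤ w
        unfold w z h = ℤ.0≤i-j⇒j≤i (subst (0ℤ ≤_) (difference w z) (ℤ.i≤j⇒0≤j-i h))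
      contradict : ¬ Z ≤ w
      contradict Z≤w = ℤ.<⇒≱ (ℤ.<-≤-trans (ℤ.+<+ (s≤s (s≤s z≤n))) (ℤ.≤-trans Z≥2 Z≤w))
        (ℤ.*-cancelʳ-≤-pos w 1ℤ w (ℤ.*-cancelʳ-≤-pos (w * w) (1ℤ * w) Y
          (ℤ.≤-trans crit′ (subst (λ y → Z * X ≤ y * Y) (sym (ℤ.*-identityˡ w)) (*-mono-≤ Z≥0 (ℤ.<⇒≤ (ℤ.positive⁻¹ X)) Z≤w X≤Y)))))
        where
        instance _ = ℤ.positive (ℤ.<-≤-trans (ℤ.positive⁻¹ X) X≤Y)
        instance _ = ℤ.positive (ℤ.<-≤-trans (ℤ.+<+ (s≤s z≤n)) w≥1)

    box-contains-generator : CharacterCriterion (suc s) n (length ps) ⊎ CountingCriterion (suc s) n ps →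
      ∃ λ x → InBox bs u x × IsPrimitive K x
    box-contains-generator (inj₁ crit) = found (character crit)
    box-contains-generator (inj₂ crit) = found (counting crit)

-- Hyperplanes in general position

module GeneralPositionBasis (K : FiniteField) (F : Pred K) (subfield : IsSubfield K F) where
  open FieldBasics K
  open IsSubfield subfield

  private
    module R = CommutativeRing ring
    module RP = Algebra.Properties.Ring R.ring

  lincomb-⊕ : ∀ {t} (c d b : Fin t → Carrier) → lincomb K c b ⊕ lincomb K d b ≡ lincomb K (λ i → c i ⊕ d i) b
  lincomb-⊕ {zero}  c d b = R.+-identityʳ 0#
  lincomb-⊕ {suc t} c d b = trans (interchange (c Fin.zero ⊗ b Fin.zero) _ (d Fin.zero ⊗ b Fin.zero) _)
    (cong₂ _⊕_ (sym (R.distribʳ (b Fin.zero) (c Fin.zero) (d Fin.zero))) (lincomb-⊕ (c ∘ Fin.suc) (d ∘ Fin.suc) (b ∘ Fin.suc)))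
    where
    interchange : ∀ a x b y → (a ⊕ x) ⊕ (b ⊕ y) ≡ (a ⊕ b) ⊕ (x ⊕ y)
    interchange a x b y = begin
      (a ⊕ x) ⊕ (b ⊕ y)  ≡⟨ R.+-assoc a x (b ⊕ y) ⟩
      a ⊕ (x ⊕ (b ⊕ y))  ≡⟨ cong (a ⊕_) (R.+-assoc x b y) ⟨
      a ⊕ ((x ⊕ b) ⊕ y)  ≡⟨ cong (λ z → a ⊕ (z ⊕ y)) (R.+-comm x b) ⟩
      a ⊕ ((b ⊕ x) ⊕ y)  ≡⟨ cong (a ⊕_) (R.+-assoc b x y) ⟩
      a ⊕ (b ⊕ (x ⊕ y))  ≡⟨ R.+-assoc a b (x ⊕ y) ⟨
      (a ⊕ b) ⊕ (x ⊕ y)  ∎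
      where open ≡-Reasoning

  lincomb-⊗ : ∀ {t} k (c b : Fin t → Carrier) → k ⊗ lincomb K c b ≡ lincomb K (λ i → k ⊗ c i) b
  lincomb-⊗ {zero}  k c b = R.zeroʳ k
  lincomb-⊗ {suc t} k c b = trans (R.distribˡ k _ _)
    (cong₂ _⊕_ (sym (R.*-assoc k (c Fin.zero) (b Fin.zero))) (lincomb-⊗ k (c ∘ Fin.suc) (b ∘ Fin.suc)))

  lincomb-0 : ∀ {t} (b : Fin t → Carrier) → lincomb K (λ _ → 0#) b ≡ 0#
  lincomb-0 {zero}  b = refl
  lincomb-0 {suc t} b = trans (cong₂ _⊕_ (R.zeroˡ (b Fin.zero)) (lincomb-0 (b ∘ Fin.suc))) (R.+-identityʳ 0#)

  record IsSubspace (V : Pred K) : Set where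
    field
      V-0 : V 0#
      V-⊕ : ∀ {x y} → V x → V y → V (x ⊕ y)
      V-⊗ : ∀ {k x} → F k → V x → V (k ⊗ x)

    V-⊖ : ∀ {x} → V x → V (⊖ x)
    V-⊖ {x} Vx = subst V (RP.-1*x≈-x x) (V-⊗ (neg-closed has-1) Vx)

  isSubspace : ∀ {V t} → IsSubspaceOfDim K F V t → IsSubspace V
  isSubspace {V} (b , V⇔ , _) = record
    { V-0 = from ((λ _ → 0#) , (λ _ → has-0) , sym (lincomb-0 b))
    ; V-⊕ = λ {x} {y} Vx Vy → let c , Fc , x≡ = to Vx ; d , Fd , y≡ = to Vy in
        from ((λ i → c i ⊕ d i) , (λ i → +-closed (Fc i) (Fd i)) , trans (cong₂ _⊕_ x≡ y≡) (lincomb-⊕ c d b))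
    ; V-⊗ = λ {k} Fk Vx → let c , Fc , x≡ = to Vx in
        from ((λ i → k ⊗ c i) , (λ i → *-closed Fk (Fc i)) , trans (cong (k ⊗_) x≡) (lincomb-⊗ k c b))
    }
    where
    to : ∀ {x} → V x → _
    to {x} = Equivalence.to (V⇔ x)
    from : ∀ {x} → _ → V x
    from {x} = Equivalence.from (V⇔ x)

  affine-point : ∀ {P} → IsAffineOfDim K F P 0 → ∃ λ u → P u × (∀ {x} → P x → x ≡ u)
  affine-point {P} (u , V , dim@(b , V⇔ , _) , P⇔) =
    u , Equivalence.from (P⇔ u) (0# , IsSubspace.V-0 (isSubspace dim) , sym (R.+-identityʳ u)) , only
    where
    only : ∀ {x} → P x → x ≡ u
    only {x} Px with v , Vv , x≡ ← Equivalence.to (P⇔ x) Px with _ , _ , v≡0 ← Equivalence.to (V⇔ v) Vv =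
      trans x≡ (trans (cong (u ⊕_) v≡0) (R.+-identityʳ u))

  affine-recentre : ∀ {P t u} → IsAffineOfDim K F P t → P u →
    ∃ λ V → IsSubspaceOfDim K F V t × (∀ {x} → P x → V (x ⊕ ⊖ u)) × (∀ {d} → V d → P (u ⊕ d))
  affine-recentre {P} {t} {u} (o , V , dim , P⇔) Pu with v₀ , Vv₀ , u≡ ← Equivalence.to (P⇔ u) Pu = V , dim , towards , back
    where
    open IsSubspace (isSubspace dim)
    cancel : ∀ o v w → (o ⊕ v) ⊕ ⊖ (o ⊕ w) ≡ v ⊕ ⊖ w
    cancel o v w = begin
      (o ⊕ v) ⊕ ⊖ (o ⊕ w)  ≡⟨ cong₂ _⊕_ (R.+-comm o v) (sym (RP.-‿+-comm o w)) ⟩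
      (v ⊕ o) ⊕ (⊖ o ⊕ ⊖ w)  ≡⟨ R.+-assoc (v ⊕ o) (⊖ o) (⊖ w) ⟨
      ((v ⊕ o) ⊕ ⊖ o) ⊕ ⊖ w  ≡⟨ cong (_⊕ ⊖ w) (⊕-cancel-⊖ʳ v o) ⟩
      v ⊕ ⊖ w  ∎
      where open ≡-Reasoning
    towards : ∀ {x} → P x → V (x ⊕ ⊖ u)
    towards {x} Px with v , Vv , x≡ ← Equivalence.to (P⇔ x) Px =
      subst V (sym (trans (cong₂ (λ y z → y ⊕ ⊖ z) x≡ u≡) (cancel o v v₀))) (V-⊕ Vv (V-⊖ Vv₀))
    back : ∀ {d} → V d → P (u ⊕ d)
    back {d} Vd = Equivalence.from (P⇔ (u ⊕ d)) (v₀ ⊕ d , V-⊕ Vv₀ Vd , trans (cong (_⊕ d) u≡) (R.+-assoc o v₀ d))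

  affine-line : ∀ {P u} → IsAffineOfDim K F P 1 → P u → ∃ λ b → b ≢ 0# × (∀ {c} → F c → P (u ⊕ c ⊗ b))
  affine-line {P} {u} aff Pu with V , (b , V⇔ , independent) , _ , back ← affine-recentre aff Pu =
    b Fin.zero , b≢0 , λ {c} Fc → back (Equivalence.from (V⇔ _) ((λ _ → c) , (λ _ → Fc) , sym (R.+-identityʳ _)))
    where
    b≢0 : b Fin.zero ≢ 0#
    b≢0 b≡0 = 0≢1 (sym (independent (λ _ → 1#) (λ _ → has-1)
      (trans (R.+-identityʳ _) (trans (cong (1# ⊗_) b≡0) (R.zeroʳ 1#))) Fin.zero))

  -- Affine coordinates in which A j lies in the j-th coordinate hyperplane.
  record Frame {n : ℕ} (A : Fin n → Pred K) : Set₁ where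
    field
      origin    : Carrier
      axis      : Fin n → Carrier
      V         : Fin n → Pred K
      subspaces : ∀ i → IsSubspace (V i)
      on-axis   : ∀ {i j c} → i ≢ j → F c → V j (c ⊗ axis i)
      off-axis  : ∀ {j c} → F c → c ≢ 0# → ¬ V j (c ⊗ axis j)
      in-V      : ∀ {j x} → A j x → V j (x ⊕ ⊖ origin)

  -- The axis through the common point u in direction i is the intersection of the hyperplanes A j with j ≠ i.
  frame : ∀ {n} (A : Fin n → Pred K) → 2 ℕ.≤ n → (∀ i → IsAffineOfDim K F (A i) (n ∸ 1)) →
    GeneralPosition K F n A → Frame A
  frame {n} A 2≤n hyper gp = record
    { origin = u
    ; axis = λ i → proj₁ (line i)
    ; V = λ j → proj₁ (centred j)
    ; subspaces = λ j → isSubspace (proj₁ (proj₂ (centred j)))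
    ; on-axis = λ {i} {j} {c} i≢j Fc → subst (proj₁ (centred j)) (⊕-cancel-⊖ˡ u _)
        (proj₁ (proj₂ (proj₂ (centred j))) (proj₂ (proj₂ (line i)) Fc j (others (i≢j ∘ sym))))
    ; off-axis = off
    ; in-V = λ {j} → proj₁ (proj₂ (proj₂ (centred j)))
    }
    where
    ⊕-cancel-⊖ˡ : ∀ u x → (u ⊕ x) ⊕ ⊖ u ≡ x
    ⊕-cancel-⊖ˡ u x = trans (cong (_⊕ ⊖ u) (R.+-comm u x)) (⊕-cancel-⊖ʳ x u)
    point : ∃ λ u → ⋂ K A Sub.⊤ u × (∀ {x} → ⋂ K A Sub.⊤ x → x ≡ u)
    point = affine-point (subst (IsAffineOfDim K F (⋂ K A Sub.⊤)) (ℕ.n∸n≡0 n)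
      (gp Sub.⊤ n (ℕ.≤-trans (s≤s z≤n) 2≤n) (Sub.∣⊤∣≡n n)))
    u = proj₁ point
    u∈ : ∀ i → A i u
    u∈ i = proj₁ (proj₂ point) i Sub.∈⊤
    others : ∀ {i j} → j ≢ i → j Sub.∈ Sub.∁ Sub.⁅ i ⁆
    others j≢i = Sub.x∉p⇒x∈∁p (λ j∈ → j≢i (Sub.x∈⁅y⁆⇒x≡y _ j∈))
    -- The n - 1 remaining hyperplanes meet in dimension n - (n - 1) = 1; n ≥ 2 ensures that there
    -- is at least one of them.
    line : ∀ i → ∃ λ b → b ≢ 0# × (∀ {c} → F c → ⋂ K A (Sub.∁ Sub.⁅ i ⁆) (u ⊕ c ⊗ b))
    line i = affine-line (subst (IsAffineOfDim K F (⋂ K A (Sub.∁ Sub.⁅ i ⁆))) (ℕ.m∸[m∸n]≡n (ℕ.≤-trans (s≤s z≤n) 2≤n))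
      (gp (Sub.∁ Sub.⁅ i ⁆) (n ∸ 1) (ℕ.∸-monoˡ-≤ 1 2≤n)
        (trans (Sub.∣∁p∣≡n∸∣p∣ Sub.⁅ i ⁆) (cong (n ∸_) (Sub.∣⁅x⁆∣≡1 i))))) (λ j _ → u∈ j)
    centred : ∀ j → _
    centred j = affine-recentre (hyper j) (u∈ j)
    -- Otherwise u + c b would lie on all hyperplanes and so coincide with u.
    off : ∀ {j c} → F c → c ≢ 0# → ¬ proj₁ (centred j) (c ⊗ proj₁ (line j))
    off {j} {c} Fc c≢0 Vcb = ⊗≢0 c≢0 (proj₁ (proj₂ (line j)))
      (trans (sym (⊕-cancel-⊖ˡ u _)) (trans (cong (_⊕ ⊖ u) (proj₂ (proj₂ point) everywhere)) (R.-‿inverseʳ u)))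
      where
      everywhere : ⋂ K A Sub.⊤ (u ⊕ c ⊗ proj₁ (line j))
      everywhere i _ with i Fin.≟ j
      ... | yes refl = proj₂ (proj₂ (proj₂ (centred j))) Vcb
      ... | no i≢j   = proj₂ (proj₂ (line j)) Fc i (others i≢j)


Criterion : ℕ → ℕ → Set
Criterion q n = CharacterCriterion q n (length (primeDivisors (pred (q ^ n)))) ⊎
                CountingCriterion q n (primeDivisors (pred (q ^ n)))

-- The box spanned at the common point avoids A j: modulo V j only the step along the j-th axis
-- survives, and its coefficient is nonzero. The condition q ≥ 3 makes (q - 1)ⁿ at least 2.
criterion⇒primitive : ∀ {q n} → 3 ℕ.≤ q → 2 ℕ.≤ n → Criterion q n → PrimitiveInComplement q n
criterion⇒primitive {suc s} {n} 3≤q 2≤n crit K F A card≡ subfield (fs , |fs|≡ , fs-unique , F⇔) hyper gp =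
  conclude (box-contains-generator (map axis indices) (separated indices (Unique.tabulate⁺ id)) |fs|≡
    (trans (List.length-map axis indices) (List.length-tabulate id)) card≡ (ℕ.s≤s⁻¹ 3≤q) (ℕ.≤-trans (s≤s z≤n) 2≤n) origin crit′)
  where
  open FieldBasics K using (_⊕_; _⊗_; ⊖_; 0#; _≟_; ring; ⊕-cancel-⊖ʳ; card≡1+m; m)
  module R = CommutativeRing ring
  open GeneralPositionBasis K F subfield
  open Frame (frame A 2≤n hyper gp)
  open IsSubfield subfield
  γ,γ≢0,full = CyclicGroup.generator K
  F→∈ : ∀ {x} → F x → x ∈ fs
  F→∈ {x} = Equivalence.to (F⇔ x)
  ∈→F : ∀ {x} → x ∈ fs → F x
  ∈→F {x} = Equivalence.from (F⇔ x)
  open BoxPrimitive K (proj₁ γ,γ≢0,full) (proj₁ (proj₂ γ,γ≢0,full)) (proj₂ (proj₂ γ,γ≢0,full)) fs fs-unique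
    (F→∈ has-0) (λ x∈ y∈ → F→∈ (+-closed (∈→F x∈) (∈→F y∈))) (λ x∈ → F→∈ (neg-closed (∈→F x∈)))
    using (box-contains-generator; InBox; stop; step; Separated; []; sep; ps)
  indices : List (Fin n)
  indices = Data.List.Base.tabulate id
    where import Data.List.Base
  crit′ : CharacterCriterion (suc s) n (length ps) ⊎ CountingCriterion (suc s) n ps
  crit′ = subst (λ k → CharacterCriterion (suc s) n (length (primeDivisors k)) ⊎ CountingCriterion (suc s) n (primeDivisors k))
    (sym (cong pred (trans (sym card≡1+m) card≡))) crit
  separated : ∀ is → Unique is → Separated (map axis is)
  separated [] _ = []
  separated (i ∷ is) u@(_ ∷ u′) = sep (V i) V-0 V-⊕ V-⊖ on (λ c∈ → off-axis (∈→F c∈)) (separated is u′)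
    where
    open IsSubspace (subspaces i)
    on : ∀ {d} → d ∈ map axis is → ∀ {c} → c ∈ fs → V i (c ⊗ d)
    on d∈ c∈ with j , j∈ , refl ← Mem.∈-map⁻ axis d∈ = on-axis (≢-of-Unique u j∈ ∘ sym) (∈→F c∈)
  shift : ∀ x z y → (x ⊕ ⊖ (z ⊕ y)) ⊕ y ≡ x ⊕ ⊖ z
  shift x z y = trans (cong (λ t → (x ⊕ t) ⊕ y) (sym (RP.-‿+-comm z y)))
    (trans (cong (_⊕ y) (sym (R.+-assoc x (⊖ z) (⊖ y)))) (FieldBasics.⊖-cancel-⊕ʳ K (x ⊕ ⊖ z) y))
    where module RP = Algebra.Properties.Ring R.ring
  outside : ∀ {is z x} j → j ∉ is → InBox (map axis is) z x → V j (x ⊕ ⊖ z)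
  outside {[]}     {z} j j∉ stop = subst (V j) (sym (R.-‿inverseʳ z)) (IsSubspace.V-0 (subspaces j))
  outside {i ∷ is} {z} {x} j j∉ (step {c = c} c∈ c≢0 rest) = subst (V j) (shift x z (c ⊗ axis i))
    (IsSubspace.V-⊕ (subspaces j) (outside j (j∉ ∘ there) rest) (on-axis (λ i≡j → j∉ (here (sym i≡j))) (∈→F c∈)))
  inside : ∀ {is z x} j → Unique is → j ∈ is → InBox (map axis is) z x → ¬ V j (x ⊕ ⊖ z)
  inside {i ∷ is} {z} {x} .i u (here refl) (step {c = c} c∈ c≢0 rest) V-x =
    off-axis (∈→F c∈) c≢0 (subst (V i) (difference x z (c ⊗ axis i)) (V-⊕ V-x (V-⊖ (outside i (λ i∈ → ≢-of-Unique u i∈ refl) rest))))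
    where
    open IsSubspace (subspaces i)
    difference : ∀ x z y → (x ⊕ ⊖ z) ⊕ ⊖ (x ⊕ ⊖ (z ⊕ y)) ≡ y
    difference x z y = trans (cong (_⊕ ⊖ (x ⊕ ⊖ (z ⊕ y))) (trans (sym (shift x z y)) (R.+-comm (x ⊕ ⊖ (z ⊕ y)) y)))
      (⊕-cancel-⊖ʳ y (x ⊕ ⊖ (z ⊕ y)))
  inside {i ∷ is} {z} {x} j u@(_ ∷ u′) (there j∈) (step {c = c} c∈ c≢0 rest) V-x =
    inside j u′ j∈ rest (subst (V j) (trans (cong (_⊕ ⊖ (c ⊗ axis i)) (sym (shift x z (c ⊗ axis i)))) (⊕-cancel-⊖ʳ _ (c ⊗ axis i)))
      (V-⊕ V-x (V-⊖ (on-axis (≢-of-Unique u j∈) (∈→F c∈)))))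
    where open IsSubspace (subspaces j)
  conclude : (∃ λ x → InBox (map axis indices) origin x × IsPrimitive K x) → ∃ λ g → IsPrimitive K g × (∀ i → ¬ A i g)
  conclude (x , inbox , prim) = x , prim , λ i Ax → inside i (Unique.tabulate⁺ id) (Mem.∈-tabulate⁺ i) inbox (in-V Ax)

-- Bounds for the prime divisors of m

^-*-distrib : ∀ k x y → (x · y) ^ k ≡ x ^ k · y ^ k
^-*-distrib zero    x y = refl
^-*-distrib (suc k) x y = trans (cong (x · y ·_) (^-*-distrib k x y)) (interchange x y (x ^ k) (y ^ k))
  where
  interchange : ∀ a b c d → a · b · (c · d) ≡ a · c · (b · d)
  interchange = ℕ-solve

∏ : (A → ℕ) → List A → ℕ
∏ f xs = product (map f xs)

∏-mono : (f g : A → ℕ) (xs : List A) → (∀ {x} → x ∈ xs → f x ℕ.≤ g x) → ∏ f xs ℕ.≤ ∏ g xs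
∏-mono f g []       h = ℕ.≤-refl
∏-mono f g (x ∷ xs) h = ℕ.*-mono-≤ (h (here refl)) (∏-mono f g xs (h ∘ there))

∏-↭ : (f : A → ℕ) {xs ys : List A} → xs ↭ ys → ∏ f xs ≡ ∏ f ys
∏-↭ f p = product-↭ (Perm.map⁺ f p)

∏-* : (f g : A → ℕ) (xs : List A) → ∏ (λ x → f x · g x) xs ≡ ∏ f xs · ∏ g xs
∏-* f g []       = refl
∏-* f g (x ∷ xs) = trans (cong (f x · g x ·_) (∏-* f g xs)) (interchange (f x) (g x) (∏ f xs) (∏ g xs))
  where
  interchange : ∀ a b c d → a · b · (c · d) ≡ a · c · (b · d)
  interchange = ℕ-solve

∏-const : (k : ℕ) (xs : List A) → ∏ (λ _ → k) xs ≡ k ^ length xs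
∏-const k []       = refl
∏-const k (x ∷ xs) = cong (k ·_) (∏-const k xs)

∏-^ : (f : A → ℕ) (j : ℕ) (xs : List A) → ∏ (λ x → f x ^ j) xs ≡ ∏ f xs ^ j
∏-^ f j []       = sym (ℕ.^-zeroˡ j)
∏-^ f j (x ∷ xs) = trans (cong (f x ^ j ·_) (∏-^ f j xs)) (sym (^-*-distrib j (f x) (∏ f xs)))

∏-pos : (f : A → ℕ) (xs : List A) → (∀ {x} → x ∈ xs → 0 ℕ.< f x) → 0 ℕ.< ∏ f xs
∏-pos f []       h = s≤s z≤n
∏-pos f (x ∷ xs) h = ℕ.*-mono-≤ (h (here refl)) (∏-pos f xs (h ∘ there))

-- In quotients: over xs, a / b exceeds 1 only at members of T, and members of T outside xs have a /
-- b at least 1. So ∏ a / b over xs is at most that over T, which need not consist of elements of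
-- xs.
∏-exchange : (a b : ℕ → ℕ) (T xs : List ℕ) → Unique xs →
  (∀ {x} → x ∈ xs → x ∈ T ⊎ a x ℕ.≤ b x) → (∀ {t} → t ∈ T → b t ℕ.≤ a t) →
  ∏ a xs · ∏ b T ℕ.≤ ∏ b xs · ∏ a T
∏-exchange a b [] xs u cover large = ℕ.*-monoˡ-≤ 1 (∏-mono a b xs outside)
  where
  outside : ∀ {x} → x ∈ xs → a x ℕ.≤ b x
  outside x∈ with cover x∈
  ... | inj₂ a≤b = a≤b
∏-exchange a b (t ∷ T) xs u cover large = cases (Any.any? (t ℕ.≟_) xs)
  where
  open ℕ.≤-Reasoning
  pull : ∀ x y c d → x · c · (y · d) ≡ x · y · (c · d)
  pull = ℕ-solve
  cases : Dec (t ∈ xs) → ∏ a xs · ∏ b (t ∷ T) ℕ.≤ ∏ b xs · ∏ a (t ∷ T)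
  cases (no t∉) = begin
    ∏ a xs · (b t · ∏ b T)  ≡⟨ rotate (∏ a xs) (b t) (∏ b T) ⟩
    b t · (∏ a xs · ∏ b T)  ≤⟨ ℕ.*-mono-≤ (large (here refl)) (∏-exchange a b T xs u cover′ (large ∘ there)) ⟩
    a t · (∏ b xs · ∏ a T)  ≡⟨ rotate (∏ b xs) (a t) (∏ a T) ⟨
    ∏ b xs · (a t · ∏ a T)  ∎
    where
    rotate : ∀ x y z → x · (y · z) ≡ y · (x · z)
    rotate = ℕ-solve
    cover′ : ∀ {x} → x ∈ xs → x ∈ T ⊎ a x ℕ.≤ b x
    cover′ x∈ with cover x∈
    ... | inj₂ a≤b        = inj₂ a≤b
    ... | inj₁ (there x∈T) = inj₁ x∈T
    ... | inj₁ (here refl) = ⊥-elim (t∉ x∈)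
  cases (yes t∈) with ys , xs↭ ← extract t∈ with u′@(_ ∷ uys) ← SetoidPerm.Unique-resp-↭ (setoid ℕ) (↭⇒↭ₛ xs↭) u = begin
    ∏ a xs · (b t · ∏ b T)  ≡⟨ cong (_· (b t · ∏ b T)) (∏-↭ a xs↭) ⟩
    a t · ∏ a ys · (b t · ∏ b T)  ≡⟨ pull (a t) (b t) (∏ a ys) (∏ b T) ⟩
    a t · b t · (∏ a ys · ∏ b T)  ≤⟨ ℕ.*-monoʳ-≤ (a t · b t) (∏-exchange a b T ys uys (cover′ u′) (large ∘ there)) ⟩
    a t · b t · (∏ b ys · ∏ a T)  ≡⟨ cong (_· (∏ b ys · ∏ a T)) (ℕ.*-comm (a t) (b t)) ⟩
    b t · a t · (∏ b ys · ∏ a T)  ≡⟨ pull (b t) (a t) (∏ b ys) (∏ a T) ⟨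
    b t · ∏ b ys · (a t · ∏ a T)  ≡⟨ cong (_· (a t · ∏ a T)) (∏-↭ b xs↭) ⟨
    ∏ b xs · (a t · ∏ a T)  ∎
    where
    cover′ : Unique (t ∷ ys) → ∀ {x} → x ∈ ys → x ∈ T ⊎ a x ℕ.≤ b x
    cover′ u′ x∈ with cover (Perm.∈-resp-↭ (↭-sym xs↭) (there x∈))
    ... | inj₂ a≤b        = inj₂ a≤b
    ... | inj₁ (there x∈T) = inj₁ x∈T
    ... | inj₁ (here refl) = ⊥-elim (≢-of-Unique u′ x∈ refl)

product-of-primes∣ : ∀ ps {n} → Unique ps → All (λ p → Prime p × p ∣ n) ps → product ps ∣ n
product-of-primes∣ []       u _ = ℕ.1∣ _
product-of-primes∣ (p ∷ ps) u@(_ ∷ u′) ((pp , divides n refl) ∷ divs) =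
  subst (_∣ n · p) (ℕ.*-comm (product ps) p) (ℕ.*-monoˡ-∣ p (product-of-primes∣ ps u′ (All.tabulate rest)))
  where
  rest : ∀ {r} → r ∈ ps → Prime r × r ∣ n
  rest {r} r∈ with pr , r∣np ← All.lookup divs r∈ with euclidsLemma n p pr r∣np
  ... | inj₁ r∣n = pr , r∣n
  ... | inj₂ r∣p = ⊥-elim (≢-of-Unique u r∈ (sym (prime∣prime⇒≡ pr pp r∣p)))

product-primeDivisors≤ : ∀ n .{{_ : NonZero n}} → product (primeDivisors n) ℕ.≤ n
product-primeDivisors≤ n = ℕ.∣⇒≤ (product-of-primes∣ (primeDivisors n) (primeDivisors-unique n) (All.tabulate ∈primeDivisors⁻))

^-cancelʳ-≤ : ∀ k {x y} .{{_ : NonZero k}} → x ^ k ℕ.≤ y ^ k → x ℕ.≤ y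
^-cancelʳ-≤ k {x} {y} h with x ℕ.≤? y
... | yes x≤y = x≤y
... | no x≰y  = ⊥-elim (ℕ.<⇒≱ (ℕ.^-monoˡ-< k (ℕ.≰⇒> x≰y)) h)

module _ (q n r : ℕ) where
  shrink grow : ℕ
  shrink = (pred q ℕ.+ r · r) · (pred q ℕ.+ r · r)
  grow   = pred q · (q · (r · r))

-- Bounds the number ω of primes dividing m by 2^(kω) ∏ T ≤ 2^(k|T|) m.
character-criterion : ∀ q n r k (T : List ℕ) .{{_ : NonZero k}} .{{_ : NonZero (pred (q ^ n))}} → r ≢ 0 →
  (∀ {p} → Prime p → p ∣ pred (q ^ n) → p ∈ T ⊎ 2 ^ k ℕ.≤ p) → (∀ {t} → t ∈ T → 0 ℕ.< t × t ℕ.≤ 2 ^ k) →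
  ((2 ^ k) ^ length T · pred (q ^ n)) ^ 2 · (shrink q n r ^ n) ^ k ℕ.≤ product T ^ 2 · (grow q n r ^ n) ^ k →
  CharacterCriterion q n (length (primeDivisors (pred (q ^ n))))
character-criterion q n r k T r≢0 cover range h = r , r≢0 , ^-cancelʳ-≤ k (ℕ.*-cancelˡ-≤ (product T ^ 2) (begin
  ∏T ^ 2 · (2 ^ ω · 2 ^ ω · Vⁿ) ^ k  ≡⟨ cong (∏T ^ 2 ·_) (trans (^-*-distrib k (2 ^ ω · 2 ^ ω) Vⁿ)
                                                          (cong (_· Vⁿ ^ k) (^-*-distrib k (2 ^ ω) (2 ^ ω)))) ⟩
  ∏T ^ 2 · ((2 ^ ω) ^ k · (2 ^ ω) ^ k · Vⁿ ^ k)  ≡⟨ cong (λ x → ∏T ^ 2 · (x · x · Vⁿ ^ k)) swap-^ ⟩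
  ∏T ^ 2 · (a ^ ω · a ^ ω · Vⁿ ^ k)  ≡⟨ regroup ∏T (a ^ ω) (Vⁿ ^ k) ⟩
  (a ^ ω · ∏T) ^ 2 · Vⁿ ^ k  ≤⟨ ℕ.*-monoˡ-≤ (Vⁿ ^ k) (ℕ.^-monoˡ-≤ 2 bound) ⟩
  (a ^ length T · m) ^ 2 · Vⁿ ^ k  ≤⟨ h ⟩
  ∏T ^ 2 · (grow q n r ^ n) ^ k  ∎))
  where
  open ℕ.≤-Reasoning
  m = pred (q ^ n)
  a = 2 ^ k
  ω = length (primeDivisors m)
  ∏T = product T
  Vⁿ = shrink q n r ^ n
  instance _ = ℕ.>-nonZero (ℕ.≤-trans (ℕ.^-monoˡ-≤ 2 (subst (0 ℕ.<_) (cong product (List.map-id T)) (∏-pos id T (proj₁ ∘ range)))) ℕ.≤-refl)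
  swap-^ : (2 ^ ω) ^ k ≡ a ^ ω
  swap-^ = trans (ℕ.^-*-assoc 2 ω k) (trans (cong (2 ^_) (ℕ.*-comm ω k)) (sym (ℕ.^-*-assoc 2 k ω)))
  regroup : ∀ b x v → b · (b · 1) · (x · x · v) ≡ x · b · (x · b · 1) · v
  regroup = ℕ-solve
  bound : a ^ ω · ∏T ℕ.≤ a ^ length T · m
  bound = begin
    a ^ ω · ∏T
      ≡⟨ cong₂ _·_ (∏-const a (primeDivisors m)) (cong product (List.map-id T)) ⟨
    ∏ (λ _ → a) (primeDivisors m) · ∏ id T
      ≤⟨ ∏-exchange (λ _ → a) id T (primeDivisors m) (primeDivisors-unique m)
           (λ p∈ → let pp , p∣m = ∈primeDivisors⁻ {m} p∈ in cover pp p∣m) (proj₂ ∘ range) ⟩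
    ∏ id (primeDivisors m) · ∏ (λ _ → a) T
      ≡⟨ cong₂ _·_ (cong product (List.map-id (primeDivisors m))) (∏-const a T) ⟩
    product (primeDivisors m) · a ^ length T
      ≤⟨ ℕ.*-monoˡ-≤ (a ^ length T) (product-primeDivisors≤ m) ⟩
    m · a ^ length T
      ≡⟨ ℕ.*-comm m (a ^ length T) ⟩
    a ^ length T · m ∎

-- Bounds R/φ(R), R the radical of m, by (R/φ(R))^j ∏ b(T) ≤ m ∏ a(T).
counting-criterion : ∀ q n j (T : List ℕ) .{{_ : NonZero (pred (q ^ n))}} →
  let m = pred (q ^ n); a = λ t → t ^ j; b = λ t → pred t ^ j · t in
  (∀ {p} → Prime p → p ∣ m → p ∈ T ⊎ a p ℕ.≤ b p) → (∀ {t} → t ∈ T → b t ℕ.≤ a t) →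
  ∏ a T · m · (q ^ n ∸ pred q ^ n) ^ j ℕ.< ∏ b T · m ^ j →
  CountingCriterion q n (primeDivisors m)
counting-criterion q n j T cover large h with ℕ.<-≤-connex (product (primeDivisors (pred (q ^ n))) · q ^ n)
  (totient (primeDivisors (pred (q ^ n))) · pred (q ^ n) ℕ.+ product (primeDivisors (pred (q ^ n))) · pred q ^ n)
... | inj₁ lt = lt
... | inj₂ ge = ⊥-elim (ℕ.<⇒≱ h (ℕ.*-cancelˡ-≤ (φR ^ j) (begin
  φR ^ j · (∏ b T · m ^ j)  ≡⟨ regroup (φR ^ j) (∏ b T) (m ^ j) ⟩
  φR ^ j · m ^ j · ∏ b T  ≡⟨ cong (_· ∏ b T) (^-*-distrib j φR m) ⟨
  (φR · m) ^ j · ∏ b T  ≤⟨ ℕ.*-monoˡ-≤ (∏ b T) (ℕ.^-monoˡ-≤ j φm≤RX) ⟩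
  (R · X) ^ j · ∏ b T  ≡⟨ cong (_· ∏ b T) (^-*-distrib j R X) ⟩
  R ^ j · X ^ j · ∏ b T  ≡⟨ swap (R ^ j) (X ^ j) (∏ b T) ⟩
  R ^ j · ∏ b T · X ^ j  ≤⟨ ℕ.*-monoˡ-≤ (X ^ j) bound ⟩
  φR ^ j · m · ∏ a T · X ^ j  ≡⟨ collect (φR ^ j) m (∏ a T) (X ^ j) ⟩
  φR ^ j · (∏ a T · m · X ^ j)  ∎)))
  where
  open ℕ.≤-Reasoning
  m = pred (q ^ n)
  ps = primeDivisors m
  R = product ps
  φR = totient ps
  X = q ^ n ∸ pred q ^ n
  a b : ℕ → ℕ
  a t = t ^ j
  b t = pred t ^ j · t
  regroup : ∀ x b m → x · (b · m) ≡ x · m · b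
  regroup = ℕ-solve
  swap : ∀ r x b → r · x · b ≡ r · b · x
  swap = ℕ-solve
  collect : ∀ f m a x → f · m · a · x ≡ f · (a · m · x)
  collect = ℕ-solve
  φR>0 : 0 ℕ.< φR
  φR>0 = ∏-pos pred ps (λ {p} p∈ → ℕ.pred-mono-≤ (prime>1 (proj₁ (∈primeDivisors⁻ {m} p∈))))
    where
    prime>1 : ∀ {p} → Prime p → 1 ℕ.< p
    prime>1 {p} pp = let instance _ = prime⇒nonTrivial pp in ℕ.nonTrivial⇒n>1 p
  instance _ = ℕ.>-nonZero (ℕ.m^n>0 φR {{ℕ.>-nonZero φR>0}} j)
  φm≤RX : φR · m ℕ.≤ R · X
  φm≤RX = subst (φR · m ℕ.≤_) (sym (ℕ.*-distribˡ-∸ R (q ^ n) (pred q ^ n)))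
    (subst (ℕ._≤ R · q ^ n ∸ R · pred q ^ n) (ℕ.m+n∸n≡m (φR · m) (R · pred q ^ n))
      (ℕ.∸-monoˡ-≤ (R · pred q ^ n) ge))
  bound : R ^ j · ∏ b T ℕ.≤ φR ^ j · m · ∏ a T
  bound = begin
    R ^ j · ∏ b T
      ≡⟨ cong (_· ∏ b T) (trans (∏-^ id j ps) (cong (λ l → product l ^ j) (List.map-id ps))) ⟨
    ∏ a ps · ∏ b T
      ≤⟨ ∏-exchange a b T ps (primeDivisors-unique m) (λ p∈ → let pp , p∣m = ∈primeDivisors⁻ {m} p∈ in cover pp p∣m) large ⟩
    ∏ b ps · ∏ a T
      ≡⟨ cong (_· ∏ a T) (trans (∏-* (λ t → pred t ^ j) id ps) (cong₂ _·_ (∏-^ pred j ps) (cong product (List.map-id ps)))) ⟩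
    φR ^ j · R · ∏ a T
      ≤⟨ ℕ.*-monoˡ-≤ (∏ a T) (ℕ.*-monoʳ-≤ (φR ^ j) (product-primeDivisors≤ m)) ⟩
    φR ^ j · m · ∏ a T ∎

-- Numerical verification

divides? : ℕ → ℕ → Bool
divides? zero    n = false
divides? (suc d) n = n ℕ.% suc d ℕ.≡ᵇ 0

divides?-complete : ∀ {d n} → d ≢ 0 → d ∣ n → T (divides? d n)
divides?-complete {zero}  d≢0 d∣n = d≢0 refl
divides?-complete {suc d} {n} d≢0 d∣n = ℕ.≡⇒≡ᵇ (n ℕ.% suc d) 0 (ℕ.n∣m⇒m%n≡0 n (suc d) d∣n)

divides?-sound : ∀ {d n} → T (divides? d n) → d ∣ n
divides?-sound {suc d} {n} h = ℕ.m%n≡0⇒n∣m n (suc d) (ℕ.≡ᵇ⇒≡ (n ℕ.% suc d) 0 h)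

-- Every prime passes; below 17² nothing else does.
sieved : ℕ → Bool
sieved t = all (λ d → not (divides? d t) ∨ (d ≡ᵇ t)) (2 ∷ 3 ∷ 5 ∷ 7 ∷ 11 ∷ 13 ∷ [])

sieved-prime : ∀ {p} → Prime p → T (sieved p)
sieved-prime {p} pp = pass 2 (λ ()) ⟨∧⟩ pass 3 (λ ()) ⟨∧⟩ pass 5 (λ ()) ⟨∧⟩ pass 7 (λ ()) ⟨∧⟩ pass 11 (λ ()) ⟨∧⟩ pass 13 (λ ()) ⟨∧⟩ _
  where
  infixr 6 _⟨∧⟩_
  _⟨∧⟩_ : ∀ {x y} → T x → T y → T (x ∧ y)
  _⟨∧⟩_ {true} {true} _ _ = _
  pass : ∀ d → d ≢ 1 → T (not (divides? d p) ∨ (d ≡ᵇ p))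
  pass d d≢1 with divides? d p in eq
  ... | false = _
  ... | true with Prime.prime⇒irreducible pp (divides?-sound {d} (subst T (sym eq) _))
  ...   | inj₁ d≡1 = ⊥-elim (d≢1 d≡1)
  ...   | inj₂ d≡p = ℕ.≡⇒≡ᵇ d p d≡p

candidate? : (f : ℕ → Bool) (t : ℕ) → Dec (T (f t ∧ sieved t))
candidate? f t = T? (f t ∧ sieved t)

-- Only has to contain the primes in question. A composite that slips through the sieve weakens the
-- resulting bound but keeps it valid.
candidates : (ℕ → Bool) → ℕ → List ℕ
candidates f M = filter (candidate? f) (applyDownFrom (2 ℕ.+_) (M ∸ 2))

∈candidates⁺ : ∀ f M {p} → Prime p → p ℕ.< M → T (f p) → p ∈ candidates f M
∈candidates⁺ f M {p} pp p<M fp = Mem.∈-filter⁺ (candidate? f) p∈ (Equivalence.from T-∧ (fp , sieved-prime pp))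
  where
  2≤p : 2 ℕ.≤ p
  2≤p = let instance _ = prime⇒nonTrivial pp in ℕ.nonTrivial⇒n>1 p
  p∈ : p ∈ applyDownFrom (2 ℕ.+_) (M ∸ 2)
  p∈ = subst (_∈ applyDownFrom (2 ℕ.+_) (M ∸ 2)) (ℕ.m+[n∸m]≡n 2≤p)
    (Mem.∈-applyDownFrom⁺ (2 ℕ.+_) (ℕ.∸-monoˡ-< p<M 2≤p))

∈candidates⁻ : ∀ f M {t} → t ∈ candidates f M → T (f t) × 1 ℕ.< t × t ℕ.< M
∈candidates⁻ f M {t} t∈ with t∈′ , h ← Mem.∈-filter⁻ (candidate? f) {xs = applyDownFrom (2 ℕ.+_) (M ∸ 2)} t∈
  with i , i<M-2 , refl ← Mem.∈-applyDownFrom⁻ (2 ℕ.+_) t∈′ =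
  proj₁ (Equivalence.to T-∧ h) , s≤s (s≤s z≤n) , unshift M i<M-2
  where
  unshift : ∀ M {i} → i ℕ.< M ∸ 2 → 2 ℕ.+ i ℕ.< M
  unshift (suc (suc M)) i<M = s≤s (s≤s i<M)

-- (x + 1)ⁱ (x − i) ≤ xⁱ⁺¹, that is Bernoulli's inequality for 1/(1 + 1/x).
bernoulli : ∀ x i y → i ℕ.+ y ≡ x → suc x ^ i · y ℕ.≤ x ^ i · x
bernoulli x zero    y refl = ℕ.≤-refl
bernoulli x (suc i) y refl = begin
  suc x · suc x ^ i · y  ≡⟨ rotate (suc x) (suc x ^ i) y ⟩
  suc x ^ i · (suc x · y)  ≤⟨ ℕ.*-monoʳ-≤ (suc x ^ i) (subst (suc x · y ℕ.≤_) (sym (ℕ.*-suc x y)) (ℕ.+-monoˡ-≤ (x · y) (ℕ.m≤n+m y (suc i)))) ⟩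
  suc x ^ i · (x · suc y)  ≡⟨ rotate′ (suc x ^ i) x (suc y) ⟩
  x · (suc x ^ i · suc y)  ≤⟨ ℕ.*-monoʳ-≤ x (bernoulli x i (suc y) (ℕ.+-suc i y)) ⟩
  x · (x ^ i · x)  ≡⟨ ℕ.*-assoc x (x ^ i) x ⟨
  x · x ^ i · x  ∎
  where
  open ℕ.≤-Reasoning
  rotate : ∀ a b c → a · b · c ≡ b · (a · c)
  rotate = ℕ-solve
  rotate′ : ∀ a b c → a · (b · c) ≡ b · (a · c)
  rotate′ = ℕ-solve

-- Since (p / (p - 1))^j ≤ p for p ≥ j + 2, the search for `radical-weight` can stop below j + 2.
^≤pred^* : ∀ j {p} → 2 ℕ.+ j ℕ.≤ p → p ^ j ℕ.≤ pred p ^ j · p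
^≤pred^* j {suc x} (s≤s j<x) = ℕ.*-cancelʳ-≤ (suc x ^ j) (x ^ j · suc x) (suc y) (begin
  suc x ^ j · suc y  ≤⟨ bernoulli x j (suc y) j+y≡x ⟩
  x ^ j · x  ≤⟨ ℕ.*-monoʳ-≤ (x ^ j) (ℕ.≤-trans (ℕ.n≤1+n x) (ℕ.m≤m*n (suc x) (suc y))) ⟩
  x ^ j · (suc x · suc y)  ≡⟨ ℕ.*-assoc (x ^ j) (suc x) (suc y) ⟨
  x ^ j · suc x · suc y  ∎)
  where
  open ℕ.≤-Reasoning
  y = x ∸ suc j
  j+y≡x : j ℕ.+ suc y ≡ x
  j+y≡x = trans (ℕ.+-suc j y) (ℕ.m+[n∸m]≡n j<x)

-- `k` sets the limit 2^k of trial division in the bound on ω, `r` fixes the weights α and β, and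
-- `j` is the exponent in the bound on R / φ(R).
data Certificate : Set where
  character : (k r : ℕ) → Certificate
  counting  : (j : ℕ) → Certificate

-- Holds when the factor (t / (t - 1))^j that t adds to (R / φ(R))^j is at least the factor t that
-- it adds to R; all other primes are absorbed by R ≤ m.
radical-weight : ℕ → ℕ → Bool
radical-weight j t = pred t ^ j · t ≤ᵇ t ^ j

CharacterTest : ℕ → ℕ → ℕ → ℕ → List ℕ → Bool
CharacterTest q n r k T =
  ((2 ^ k) ^ length T · pred (q ^ n)) ^ 2 · (shrink q n r ^ n) ^ k ≤ᵇ product T ^ 2 · (grow q n r ^ n) ^ k

CountingTest : ℕ → ℕ → ℕ → List ℕ → Bool
CountingTest q n j T = ∏ (_^ j) T · pred (q ^ n) · (q ^ n ∸ pred q ^ n) ^ j <ᵇ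
  ∏ (λ t → pred t ^ j · t) T · pred (q ^ n) ^ j

-- Taking m as an argument lets its value be shared between the trial divisions.
divisors : ℕ → ℕ → List ℕ
divisors m M = candidates (λ t → divides? t m) M

weightyDivisors : ℕ → ℕ → ℕ → List ℕ
weightyDivisors m j M = candidates (λ t → divides? t m ∧ radical-weight j t) M

accepts : ℕ → ℕ → Certificate → Bool
accepts q n (character k r) = (1 ≤ᵇ k) ∧ (1 ≤ᵇ r) ∧ CharacterTest q n r k (divisors (pred (q ^ n)) (2 ^ k))
accepts q n (counting j)    = CountingTest q n j (weightyDivisors (pred (q ^ n)) j (2 ℕ.+ j))

1≤ᵇ⇒≢0 : ∀ {k} → T (1 ≤ᵇ k) → k ≢ 0
1≤ᵇ⇒≢0 {suc k} _ ()

prime≢0 : ∀ {p} → Prime p → p ≢ 0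
prime≢0 pp refl = Prime.¬prime[0] pp

pred-power-nonZero : ∀ q n → 2 ℕ.≤ q → 1 ℕ.≤ n → NonZero (pred (q ^ n))
pred-power-nonZero q (suc n) 2≤q _ = ℕ.>-nonZero (ℕ.pred-mono-≤ (ℕ.≤-trans 2≤q (ℕ.m≤m*n q (q ^ n) {{ℕ.>-nonZero (ℕ.m^n>0 q n)}})))
  where instance _ = ℕ.>-nonZero (ℕ.≤-trans (s≤s z≤n) 2≤q)

counting-cover : ∀ f j {p} → Prime p → (T (radical-weight j p) → T (f p)) →
  p ∈ candidates f (2 ℕ.+ j) ⊎ p ^ j ℕ.≤ pred p ^ j · p
counting-cover f j {p} pp ok with ℕ.<-≤-connex p (2 ℕ.+ j) | ℕ.≤-total (p ^ j) (pred p ^ j · p)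
... | inj₂ ge | _       = inj₂ (^≤pred^* j ge)
... | inj₁ _  | inj₁ le = inj₂ le
... | inj₁ lt | inj₂ ge = inj₁ (∈candidates⁺ f (2 ℕ.+ j) pp lt (ok (ℕ.≤⇒≤ᵇ ge)))

accepts-sound : ∀ q n c → 2 ℕ.≤ q → 1 ℕ.≤ n → T (accepts q n c) → Criterion q n
accepts-sound q n (character k r) 2≤q 1≤n h
  with 1≤k , h′ ← Equivalence.to (T-∧ {1 ≤ᵇ k}) h with 1≤r , test ← Equivalence.to (T-∧ {1 ≤ᵇ r}) h′ =
  inj₁ (character-criterion q n r k (divisors m (2 ^ k)) (1≤ᵇ⇒≢0 1≤r) cover
    (λ t∈ → let _ , 1<t , t<M = ∈candidates⁻ (λ t → divides? t m) (2 ^ k) t∈ in ℕ.<⇒≤ 1<t , ℕ.<⇒≤ t<M)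
    (ℕ.≤ᵇ⇒≤ _ _ test))
  where
  m = pred (q ^ n)
  instance _ = ℕ.≢-nonZero (1≤ᵇ⇒≢0 1≤k)
  instance _ = pred-power-nonZero q n 2≤q 1≤n
  cover : ∀ {p} → Prime p → p ∣ m → p ∈ divisors m (2 ^ k) ⊎ 2 ^ k ℕ.≤ p
  cover {p} pp p∣m with ℕ.<-≤-connex p (2 ^ k)
  ... | inj₂ ge = inj₂ ge
  ... | inj₁ lt = inj₁ (∈candidates⁺ (λ t → divides? t m) (2 ^ k) pp lt (divides?-complete (prime≢0 pp) p∣m))
accepts-sound q n (counting j) 2≤q 1≤n h = inj₂ (counting-criterion q n j (weightyDivisors m j (2 ℕ.+ j))
  (λ pp p∣m → counting-cover f j pp (λ weighty → Equivalence.from T-∧ (divides?-complete (prime≢0 pp) p∣m , weighty)))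
  (λ {t} t∈ → ℕ.≤ᵇ⇒≤ _ _ (proj₂ (Equivalence.to (T-∧ {divides? t m}) (proj₁ (∈candidates⁻ f (2 ℕ.+ j) t∈)))))
  (ℕ.<ᵇ⇒< _ _ h))
  where
  m = pred (q ^ n)
  instance _ = pred-power-nonZero q n 2≤q 1≤n
  f : ℕ → Bool
  f t = divides? t m ∧ radical-weight j t

-- Large n for a fixed q

geometric-growth : ∀ {a b x y} N → x ℕ.≤ y → a · x ^ N ℕ.≤ b · y ^ N → ∀ n → N ℕ.≤ n → a · x ^ n ℕ.≤ b · y ^ n
geometric-growth {a} {b} {x} {y} N x≤y base n N≤n = subst (λ n → a · x ^ n ℕ.≤ b · y ^ n) (ℕ.m+[n∸m]≡n N≤n) (begin
  a · x ^ (N ℕ.+ d)  ≡⟨ cong (a ·_) (ℕ.^-distribˡ-+-* x N d) ⟩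
  a · (x ^ N · x ^ d)  ≡⟨ ℕ.*-assoc a (x ^ N) (x ^ d) ⟨
  a · x ^ N · x ^ d  ≤⟨ ℕ.*-mono-≤ base (ℕ.^-monoˡ-≤ d x≤y) ⟩
  b · y ^ N · y ^ d  ≡⟨ ℕ.*-assoc b (y ^ N) (y ^ d) ⟩
  b · (y ^ N · y ^ d)  ≡⟨ cong (b ·_) (ℕ.^-distribˡ-+-* y N d) ⟨
  b · y ^ (N ℕ.+ d)  ∎)
  where
  open ℕ.≤-Reasoning
  d = n ∸ N

-- The character test with m replaced by qⁿ, and T by the candidates not dividing q, so that it
-- becomes a comparison of two geometric progressions in n.
tailPrimes : ℕ → ℕ → List ℕ
tailPrimes q k = candidates (λ t → not (divides? t q)) (2 ^ k)

TailTest : ℕ → ℕ → ℕ → ℕ → Bool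
TailTest q N k r = (1 ≤ᵇ k) ∧ (1 ≤ᵇ r) ∧ (x ≤ᵇ y) ∧
  (((2 ^ k) ^ length (tailPrimes q k)) ^ 2 · x ^ N ≤ᵇ product (tailPrimes q k) ^ 2 · y ^ N)
  where
  x = q ^ 2 · shrink q N r ^ k
  y = grow q N r ^ k

tail-sound : ∀ q N k r → 2 ℕ.≤ q → T (TailTest q N k r) → ∀ n → N ℕ.≤ n → 1 ℕ.≤ n → Criterion q n
tail-sound q N k r 2≤q h n N≤n 1≤n
  with 1≤k , h₁ ← Equivalence.to (T-∧ {1 ≤ᵇ k}) h
  with 1≤r , h₂ ← Equivalence.to (T-∧ {1 ≤ᵇ r}) h₁
  with x≤y , base ← Equivalence.to (T-∧ {q ^ 2 · shrink q N r ^ k ≤ᵇ grow q N r ^ k}) h₂ =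
  inj₁ (character-criterion q n r k T₀ (1≤ᵇ⇒≢0 1≤r) cover
    (λ t∈ → let _ , 1<t , t<M = ∈candidates⁻ (λ t → not (divides? t q)) (2 ^ k) t∈ in ℕ.<⇒≤ 1<t , ℕ.<⇒≤ t<M)
    (begin
      (a · pred (q ^ n)) ^ 2 · (V ^ n) ^ k  ≤⟨ ℕ.*-monoˡ-≤ ((V ^ n) ^ k) (ℕ.^-monoˡ-≤ 2 (ℕ.*-monoʳ-≤ a ℕ.pred[n]≤n)) ⟩
      (a · q ^ n) ^ 2 · (V ^ n) ^ k  ≡⟨ cong₂ _·_ (^-*-distrib 2 a (q ^ n)) (exchange V n k) ⟩
      a ^ 2 · (q ^ n) ^ 2 · (V ^ k) ^ n  ≡⟨ cong (λ z → a ^ 2 · z · (V ^ k) ^ n) (exchange q n 2) ⟩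
      a ^ 2 · (q ^ 2) ^ n · (V ^ k) ^ n  ≡⟨ ℕ.*-assoc (a ^ 2) _ _ ⟩
      a ^ 2 · ((q ^ 2) ^ n · (V ^ k) ^ n)  ≡⟨ cong (a ^ 2 ·_) (^-*-distrib n (q ^ 2) (V ^ k)) ⟨
      a ^ 2 · (q ^ 2 · V ^ k) ^ n  ≤⟨ geometric-growth {a ^ 2} {product T₀ ^ 2} N (ℕ.≤ᵇ⇒≤ _ _ x≤y) (ℕ.≤ᵇ⇒≤ _ _ base) n N≤n ⟩
      product T₀ ^ 2 · (U ^ k) ^ n  ≡⟨ cong (product T₀ ^ 2 ·_) (exchange U n k) ⟨
      product T₀ ^ 2 · (U ^ n) ^ k  ∎))
  where
  open ℕ.≤-Reasoning
  instance _ = ℕ.≢-nonZero (1≤ᵇ⇒≢0 1≤k)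
  instance _ = pred-power-nonZero q n 2≤q 1≤n
  T₀ = tailPrimes q k
  a = (2 ^ k) ^ length T₀
  V = shrink q n r
  U = grow q n r
  exchange : ∀ x i j → (x ^ i) ^ j ≡ (x ^ j) ^ i
  exchange x i j = trans (ℕ.^-*-assoc x i j) (trans (cong (x ^_) (ℕ.*-comm i j)) (sym (ℕ.^-*-assoc x j i)))
  cover : ∀ {p} → Prime p → p ∣ pred (q ^ n) → p ∈ T₀ ⊎ 2 ^ k ℕ.≤ p
  cover {p} pp p∣m with ℕ.<-≤-connex p (2 ^ k)
  ... | inj₂ ge = inj₂ ge
  ... | inj₁ lt = inj₁ (∈candidates⁺ (λ t → not (divides? t q)) (2 ^ k) pp lt p∤q)
    where
    1+m : suc (pred (q ^ n)) ≡ q ^ n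
    1+m = ℕ.suc-pred (q ^ n) {{ℕ.>-nonZero (ℕ.m^n>0 q {{ℕ.>-nonZero (ℕ.≤-trans (s≤s z≤n) 2≤q)}} n)}}
    p∣qⁿ : p ∣ q → p ∣ q ^ n
    p∣qⁿ p∣q = ℕ.∣-trans p∣q (subst (λ n → q ∣ q ^ n) (ℕ.m+[n∸m]≡n 1≤n) (ℕ.m∣m*n (q ^ (n ∸ 1))))
    -- A common prime divisor of q and qⁿ - 1 would divide 1.
    p∤q : T (not (divides? p q))
    p∤q with divides? p q in eq
    ... | false = _
    ... | true = ⊥-elim (Prime.¬prime[1] (subst Prime (ℕ.∣1⇒≡1 (ℕ.∣m+n∣m⇒∣n
            (subst (p ∣_) (trans (sym 1+m) (ℕ.+-comm 1 (pred (q ^ n)))) (p∣qⁿ (divides?-sound {p} (subst T (sym eq) _)))) p∣m)) pp))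

-- `any` stops at the first success, so within each kind the certificates with the shortest trial
-- division come first.
attempts : ℕ → List Certificate
attempts r = map counting (20 ∷ 40 ∷ 80 ∷ []) ++ map (λ k → character k r) (4 ∷ 5 ∷ 6 ∷ 7 ∷ 8 ∷ 9 ∷ 10 ∷ 11 ∷ [])

certified : ℕ → ℕ → ℕ → Bool
certified q r n = any (accepts q n) (attempts r)

settledAt : ℕ → ℕ → List ℕ → ℕ → Bool
settledAt q r exceptions n = any (_≡ᵇ n) exceptions ∨ certified q r n

range : ℕ → ℕ → List ℕ
range a b = applyUpTo (a ℕ.+_) (b ∸ a)

∈range : ∀ {a b n} → a ℕ.≤ n → n ℕ.< b → n ∈ range a b
∈range {a} {b} {n} a≤n n<b = subst (_∈ range a b) (ℕ.m+[n∸m]≡n a≤n)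
  (Mem.∈-applyUpTo⁺ (a ℕ.+_) (ℕ.∸-monoˡ-< n<b a≤n))

all-range : (f : ℕ → Bool) → ∀ a b → T (all f (range a b)) → ∀ {n} → a ℕ.≤ n → n ℕ.< b → T (f n)
all-range f a b h a≤n n<b = All.lookup (All.all⁺ f (range a b) h) (∈range a≤n n<b)

Settled : ℕ → ℕ → ℕ → ℕ → List ℕ → Bool
Settled q r k N exceptions = TailTest q N k r ∧ all (settledAt q r exceptions) (range 2 N)

certified-sound : ∀ q r n → 2 ℕ.≤ q → 2 ℕ.≤ n → T (certified q r n) → Criterion q n
certified-sound q r n 2≤q 2≤n ok = let c , _ , accepted = find (Any.any⁻ (accepts q n) (attempts r) ok) in
  accepts-sound q n c 2≤q (ℕ.≤-trans (s≤s z≤n) 2≤n) accepted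

settled-sound : ∀ q r k N exceptions → 2 ℕ.≤ q → T (Settled q r k N exceptions) → ∀ n → 2 ℕ.≤ n → Criterion q n ⊎ n ∈ exceptions
settled-sound q r k N ex 2≤q h n 2≤n = cases (ℕ.<-≤-connex n N)
  where
  tests : T (TailTest q N k r) × T (all (settledAt q r ex) (range 2 N))
  tests = Equivalence.to (T-∧ {TailTest q N k r} {all (settledAt q r ex) (range 2 N)}) h
  listed⇒∈ : T (any (_≡ᵇ n) ex) → n ∈ ex
  listed⇒∈ listed = Any.map (λ {e} e≡n → sym (ℕ.≡ᵇ⇒≡ e n e≡n)) (Any.any⁻ (_≡ᵇ n) ex listed)
  below : T (any (_≡ᵇ n) ex) ⊎ T (certified q r n) → Criterion q n ⊎ n ∈ ex
  below (inj₁ listed) = inj₂ (listed⇒∈ listed)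
  below (inj₂ ok)     = inj₁ (certified-sound q r n 2≤q 2≤n ok)
  cases : n ℕ.< N ⊎ N ℕ.≤ n → Criterion q n ⊎ n ∈ ex
  cases (inj₂ N≤n) = inj₁ (tail-sound q N k r 2≤q (proj₁ tests) n N≤n (ℕ.≤-trans (s≤s z≤n) 2≤n))
  cases (inj₁ n<N) = below (Equivalence.to (T-∨ {any (_≡ᵇ n) ex} {certified q r n})
    (all-range (settledAt q r ex) 2 N (proj₂ tests) 2≤n n<N))

-- One choice for all 16 ≤ q < 53: with the primes below 2⁵ the tail test holds from n = 15 on.
settled : ℕ → ℕ → Bool
settled r q = Settled q r 5 15 []

settled-range-sound : ∀ r a b → T (all (settled r) (range a b)) → ∀ {q n} → 2 ℕ.≤ a → a ℕ.≤ q → q ℕ.< b → 2 ℕ.≤ n → Criterion q n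
settled-range-sound r a b h {q} {n} 2≤a a≤q q<b 2≤n =
  conclude (settled-sound q r 5 15 [] (ℕ.≤-trans 2≤a a≤q) (all-range (settled r) a b h a≤q q<b) n 2≤n)
  where
  conclude : Criterion q n ⊎ n ∈ [] → Criterion q n
  conclude (inj₁ criterion) = criterion

-- The breakpoints 22, 32 and 44 keep `r` the integer nearest to √(q - 1).
criterion-16≤q<53 : ∀ {q n} → 16 ℕ.≤ q → q ℕ.< 53 → 2 ℕ.≤ n → Criterion q n
criterion-16≤q<53 {q} 16≤q q<53 2≤n with ℕ.<-≤-connex q 22 | ℕ.<-≤-connex q 32 | ℕ.<-≤-connex q 44
... | inj₁ lt | _       | _       = settled-range-sound 4 16 22 _ (s≤s (s≤s z≤n)) 16≤q lt 2≤n
... | inj₂ ge | inj₁ lt | _       = settled-range-sound 5 22 32 _ (s≤s (s≤s z≤n)) ge lt 2≤n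
... | inj₂ _  | inj₂ ge | inj₁ lt = settled-range-sound 6 32 44 _ (s≤s (s≤s z≤n)) ge lt 2≤n
... | inj₂ _  | inj₂ _  | inj₂ ge = settled-range-sound 7 44 53 _ (s≤s (s≤s z≤n)) ge q<53 2≤n

-- All q from 53 on

-- With q = s + 1 this says (qⁿ − sⁿ) q ≤ n (qⁿ − 1).
union-bound : ∀ s n → 1 ℕ.≤ s → suc s · suc s ^ (2 ℕ.+ n) ℕ.+ (2 ℕ.+ n) ℕ.≤ (2 ℕ.+ n) · suc s ^ (2 ℕ.+ n) ℕ.+ suc s · s ^ (2 ℕ.+ n)
union-bound s zero 1≤s = subst₂ ℕ._≤_ (sym (lhs s)) (sym (rhs s)) (ℕ.+-monoʳ-≤ (suc s · (suc s · suc s)) (s≤s 1≤s))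
  where
  lhs : ∀ s → (1 ℕ.+ s) · ((1 ℕ.+ s) · ((1 ℕ.+ s) · 1)) ℕ.+ 2 ≡ (1 ℕ.+ s) · ((1 ℕ.+ s) · (1 ℕ.+ s)) ℕ.+ 2
  lhs = ℕ-solve
  rhs : ∀ s → 2 · ((1 ℕ.+ s) · ((1 ℕ.+ s) · 1)) ℕ.+ (1 ℕ.+ s) · (s · (s · 1)) ≡ (1 ℕ.+ s) · ((1 ℕ.+ s) · (1 ℕ.+ s)) ℕ.+ (1 ℕ.+ s)
  rhs = ℕ-solve
union-bound s (suc n) 1≤s = ℕ.+-cancelʳ-≤ (suc s · y) _ _ (begin
  suc s · (suc s · x) ℕ.+ (3 ℕ.+ n) ℕ.+ suc s · y
    ≤⟨ ℕ.+-monoˡ-≤ (suc s · y) (ℕ.+-monoʳ-≤ (suc s · (suc s · x)) slack) ⟩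
  suc s · (suc s · x) ℕ.+ suc s · (2 ℕ.+ n) ℕ.+ suc s · y
    ≡⟨ gather s x n y ⟩
  suc s · (suc s · x ℕ.+ (2 ℕ.+ n)) ℕ.+ suc s · y
    ≤⟨ ℕ.+-mono-≤ (ℕ.*-monoʳ-≤ (suc s) (union-bound s n 1≤s)) (ℕ.*-monoʳ-≤ (suc s) (ℕ.^-monoˡ-≤ (2 ℕ.+ n) (ℕ.n≤1+n s))) ⟩
  suc s · ((2 ℕ.+ n) · x ℕ.+ suc s · y) ℕ.+ suc s · x
    ≡⟨ redistribute s x n y ⟩
  (3 ℕ.+ n) · (suc s · x) ℕ.+ suc s · (s · y) ℕ.+ suc s · y ∎)
  where
  open ℕ.≤-Reasoning
  x = suc s ^ (2 ℕ.+ n)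
  y = s ^ (2 ℕ.+ n)
  slack : 3 ℕ.+ n ℕ.≤ suc s · (2 ℕ.+ n)
  slack = ℕ.≤-trans (subst (3 ℕ.+ n ℕ.≤_) (double n) (ℕ.m≤m+n (3 ℕ.+ n) (1 ℕ.+ n))) (ℕ.*-monoˡ-≤ (2 ℕ.+ n) (s≤s 1≤s))
    where
    double : ∀ n → 3 ℕ.+ n ℕ.+ (1 ℕ.+ n) ≡ 2 · (2 ℕ.+ n)
    double = ℕ-solve
  gather : ∀ s x n y → (1 ℕ.+ s) · ((1 ℕ.+ s) · x) ℕ.+ (1 ℕ.+ s) · (2 ℕ.+ n) ℕ.+ (1 ℕ.+ s) · y
    ≡ (1 ℕ.+ s) · ((1 ℕ.+ s) · x ℕ.+ (2 ℕ.+ n)) ℕ.+ (1 ℕ.+ s) · y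
  gather = ℕ-solve
  redistribute : ∀ s x n y → (1 ℕ.+ s) · ((2 ℕ.+ n) · x ℕ.+ (1 ℕ.+ s) · y) ℕ.+ (1 ℕ.+ s) · x
    ≡ (3 ℕ.+ n) · ((1 ℕ.+ s) · x) ℕ.+ (1 ℕ.+ s) · (s · y) ℕ.+ (1 ℕ.+ s) · y
  redistribute = ℕ-solve

suc-pred-^ : ∀ s n → suc (pred (suc s ^ n)) ≡ suc s ^ n
suc-pred-^ s n = ℕ.suc-pred (suc s ^ n) {{ℕ.m^n≢0 (suc s) n}}

union-bound′ : ∀ s n → 1 ℕ.≤ s → 2 ℕ.≤ n → (suc s ^ n ∸ s ^ n) · suc s ℕ.≤ n · pred (suc s ^ n)
union-bound′ s (suc zero)    1≤s (s≤s ())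
union-bound′ s (suc (suc i)) 1≤s _ = ℕ.+-cancelʳ-≤ (n ℕ.+ suc s · y) _ _ (begin
  (x ∸ y) · suc s ℕ.+ (n ℕ.+ suc s · y)  ≡⟨ gather (x ∸ y) (suc s) n y ⟩
  suc s · (x ∸ y ℕ.+ y) ℕ.+ n  ≡⟨ cong (λ z → suc s · z ℕ.+ n) (ℕ.m∸n+n≡m (ℕ.^-monoˡ-≤ n (ℕ.n≤1+n s))) ⟩
  suc s · x ℕ.+ n  ≤⟨ union-bound s i 1≤s ⟩
  n · x ℕ.+ suc s · y  ≡⟨ cong (λ z → n · z ℕ.+ suc s · y) (suc-pred-^ s n) ⟨
  n · suc (pred x) ℕ.+ suc s · y  ≡⟨ spread n (pred x) (suc s · y) ⟩
  n · pred x ℕ.+ (n ℕ.+ suc s · y)  ∎)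
  where
  open ℕ.≤-Reasoning
  n = suc (suc i)
  x = suc s ^ n
  y = s ^ n
  gather : ∀ d q n y → d · q ℕ.+ (n ℕ.+ q · y) ≡ q · (d ℕ.+ y) ℕ.+ n
  gather = ℕ-solve
  spread : ∀ n p z → n · (1 ℕ.+ p) ℕ.+ z ≡ n · p ℕ.+ (n ℕ.+ z)
  spread = ℕ-solve

-- By `union-bound′` the points outside the box number at most n m / q, and (R / φ(R))^j ≤ m a / b <
-- qⁿ a / b. Together these reduce the counting criterion to a n^j ≤ b q^(j - n), which is hardest
-- at the least q.
criterion-counting : ∀ {q} Q j n → 2 ℕ.≤ Q → Q ℕ.≤ q → 2 ℕ.≤ n → n ℕ.≤ j →
  ∏ (_^ j) (candidates (radical-weight j) (2 ℕ.+ j)) · n ^ j ℕ.≤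
    ∏ (λ t → pred t ^ j · t) (candidates (radical-weight j) (2 ℕ.+ j)) · Q ^ (j ∸ n) →
  Criterion q n
criterion-counting {zero} Q j n 2≤Q Q≤q = ⊥-elim (ℕ.n≮0 (ℕ.≤-trans 2≤Q Q≤q))
criterion-counting {suc s} Q j n 2≤Q Q≤q 2≤n n≤j h = inj₂ (counting-criterion q n j T₀
  (λ pp _ → counting-cover (radical-weight j) j pp id)
  (λ t∈ → ℕ.≤ᵇ⇒≤ _ _ (proj₁ (∈candidates⁻ (radical-weight j) (2 ℕ.+ j) t∈)))
  (ℕ.*-cancelʳ-< (q ^ j) _ _ (begin-strict
    a · m · X ^ j · q ^ j  ≡⟨ trans (ℕ.*-assoc (a · m) (X ^ j) (q ^ j)) (cong (a · m ·_) (sym (^-*-distrib j X q))) ⟩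
    a · m · (X · q) ^ j  ≤⟨ ℕ.*-monoʳ-≤ (a · m) (ℕ.^-monoˡ-≤ j (union-bound′ s n 1≤s 2≤n)) ⟩
    a · m · (n · m) ^ j  ≡⟨ cong (a · m ·_) (^-*-distrib j n m) ⟩
    a · m · (n ^ j · m ^ j)  ≡⟨ rotate a m (n ^ j) (m ^ j) ⟩
    m · (a · n ^ j) · m ^ j  ≤⟨ ℕ.*-monoˡ-≤ (m ^ j) (ℕ.*-monoʳ-≤ m (ℕ.≤-trans h (ℕ.*-monoʳ-≤ b (ℕ.^-monoˡ-≤ (j ∸ n) Q≤q)))) ⟩
    m · (b · q ^ (j ∸ n)) · m ^ j  <⟨ ℕ.*-monoˡ-< (m ^ j) (ℕ.*-monoˡ-< (b · q ^ (j ∸ n)) (ℕ.≤-reflexive (suc-pred-^ s n))) ⟩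
    q ^ n · (b · q ^ (j ∸ n)) · m ^ j  ≡⟨ rotate′ (q ^ n) b (q ^ (j ∸ n)) (m ^ j) ⟩
    b · m ^ j · (q ^ n · q ^ (j ∸ n))  ≡⟨ cong (b · m ^ j ·_) (trans (sym (ℕ.^-distribˡ-+-* q n (j ∸ n))) (cong (q ^_) (ℕ.m+[n∸m]≡n n≤j))) ⟩
    b · m ^ j · q ^ j  ∎)))
  where
  open ℕ.≤-Reasoning
  q = suc s
  m = pred (q ^ n)
  X = q ^ n ∸ s ^ n
  T₀ = candidates (radical-weight j) (2 ℕ.+ j)
  a = ∏ (_^ j) T₀
  b = ∏ (λ t → pred t ^ j · t) T₀
  1≤s : 1 ℕ.≤ s
  1≤s = ℕ.s≤s⁻¹ (ℕ.≤-trans 2≤Q Q≤q)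
  instance m-nz = pred-power-nonZero q n (s≤s 1≤s) (ℕ.≤-trans (s≤s z≤n) 2≤n)
  instance mʲ-nz = ℕ.m^n≢0 m j
  b>0 : 0 ℕ.< b
  b>0 = ∏-pos (λ t → pred t ^ j · t) T₀ (λ t∈ → positive (proj₁ (proj₂ (∈candidates⁻ (radical-weight j) (2 ℕ.+ j) t∈))))
    where
    positive : ∀ {t} → 1 ℕ.< t → 0 ℕ.< pred t ^ j · t
    positive {t} 1<t = ℕ.*-mono-≤ (ℕ.m^n>0 (pred t) {{ℕ.>-nonZero (ℕ.pred-mono-≤ 1<t)}} j) (ℕ.<⇒≤ 1<t)
  instance b-nz = ℕ.m*n≢0 b (q ^ (j ∸ n)) {{ℕ.>-nonZero b>0}} {{ℕ.m^n≢0 q (j ∸ n)}}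
  rotate : ∀ a m n k → a · m · (n · k) ≡ m · (a · n) · k
  rotate = ℕ-solve
  rotate′ : ∀ x b y k → x · (b · y) · k ≡ b · k · (x · y)
  rotate′ = ℕ-solve

integer-sqrt : ∀ s → ∃ λ r → r · r ℕ.≤ s × s ℕ.< suc r · suc r
integer-sqrt zero = 0 , z≤n , s≤s z≤n
integer-sqrt (suc s) with r , lo , hi ← integer-sqrt s with suc r · suc r ℕ.≤? suc s
... | yes le = suc r , le , s≤s (ℕ.≤-trans hi (subst (suc r · suc r ℕ.≤_) (sym (expand r)) (ℕ.m≤m+n _ _)))
  where
  expand : ∀ r → (1 ℕ.+ r) ℕ.+ (1 ℕ.+ r) · (2 ℕ.+ r) ≡ (1 ℕ.+ r) · (1 ℕ.+ r) ℕ.+ (2 ℕ.+ 2 · r)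
  expand = ℕ-solve
... | no gt = r , ℕ.m≤n⇒m≤1+n lo , ℕ.≰⇒> gt

-- For r = ⌊√s⌋ ≥ 7 the character criterion is within a factor 48/49 of its optimum r = √s.
grow≥shrink : ∀ s n → 52 ℕ.≤ s → ∃ λ r → r ≢ 0 × 12 · (suc s · shrink (suc s) n r) ℕ.≤ 49 · grow (suc s) n r
grow≥shrink s n 52≤s with r , lo , hi ← integer-sqrt s =
  r , (λ { refl → ℕ.<⇒≱ hi (ℕ.≤-trans (s≤s z≤n) 52≤s) }) , (begin
    12 · (suc s · ((s ℕ.+ r · r) · (s ℕ.+ r · r)))
      ≡⟨ factor (suc s) ((s ℕ.+ r · r) · (s ℕ.+ r · r)) ⟩
    suc s · (12 · ((s ℕ.+ r · r) · (s ℕ.+ r · r)))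
      ≤⟨ ℕ.*-monoʳ-≤ (suc s) (subst (λ s → 12 · ((s ℕ.+ r · r) · (s ℕ.+ r · r)) ℕ.≤ 49 · (s · (r · r))) (ℕ.m+[n∸m]≡n lo) core) ⟩
    suc s · (49 · (s · (r · r)))
      ≡⟨ factor′ (suc s) s (r · r) ⟩
    49 · (s · (suc s · (r · r))) ∎)
  where
  open ℕ.≤-Reasoning
  d = s ∸ r · r
  factor : ∀ q v → 12 · (q · v) ≡ q · (12 · v)
  factor = ℕ-solve
  factor′ : ∀ q s r → q · (49 · (s · r)) ≡ 49 · (s · (q · r))
  factor′ = ℕ-solve
  7≤r : 7 ℕ.≤ r
  7≤r = ℕ.≮⇒≥ (λ r<7 → ℕ.<⇒≱ hi (ℕ.≤-trans (ℕ.*-mono-≤ r<7 r<7) (ℕ.≤-trans (ℕ.m≤m+n 49 3) 52≤s)))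
  d≤2r : d ℕ.≤ 2 · r
  d≤2r = ℕ.m≤n+o⇒m∸n≤o s (r · r) (ℕ.s≤s⁻¹ (subst (s ℕ.<_) (square r) hi))
    where
    square : ∀ r → (1 ℕ.+ r) · (1 ℕ.+ r) ≡ 1 ℕ.+ (r · r ℕ.+ 2 · r)
    square = ℕ-solve
  12d²≤r⁴ : 12 · (d · d) ℕ.≤ r · r · (r · r)
  12d²≤r⁴ = begin
    12 · (d · d)  ≤⟨ ℕ.*-monoʳ-≤ 12 (ℕ.*-mono-≤ d≤2r d≤2r) ⟩
    12 · (2 · r · (2 · r))  ≡⟨ collect r ⟩
    48 · (r · r)  ≤⟨ ℕ.*-monoˡ-≤ (r · r) (ℕ.≤-trans (ℕ.n≤1+n 48) (ℕ.*-mono-≤ 7≤r 7≤r)) ⟩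
    r · r · (r · r)  ∎
    where
    collect : ∀ r → 12 · (2 · r · (2 · r)) ≡ 48 · (r · r)
    collect = ℕ-solve
  core : 12 · ((r · r ℕ.+ d ℕ.+ r · r) · (r · r ℕ.+ d ℕ.+ r · r)) ℕ.≤ 49 · ((r · r ℕ.+ d) · (r · r))
  core = begin
    12 · ((R ℕ.+ d ℕ.+ R) · (R ℕ.+ d ℕ.+ R))  ≡⟨ expand R d ⟩
    48 · (R · R ℕ.+ R · d) ℕ.+ 12 · (d · d)  ≤⟨ ℕ.+-monoʳ-≤ _ 12d²≤r⁴ ⟩
    48 · (R · R ℕ.+ R · d) ℕ.+ R · R  ≤⟨ ℕ.m≤m+n _ (R · d) ⟩
    48 · (R · R ℕ.+ R · d) ℕ.+ R · R ℕ.+ R · d  ≡⟨ expand′ R d ⟩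
    49 · ((R ℕ.+ d) · R)  ∎
    where
    R = r · r
    expand : ∀ R d → 12 · ((R ℕ.+ d ℕ.+ R) · (R ℕ.+ d ℕ.+ R)) ≡ 48 · (R · R ℕ.+ R · d) ℕ.+ 12 · (d · d)
    expand = ℕ-solve
    expand′ : ∀ R d → 48 · (R · R ℕ.+ R · d) ℕ.+ R · R ℕ.+ R · d ≡ 49 · ((R ℕ.+ d) · R)
    expand′ = ℕ-solve

-- The character test for k = 4 is a square; its root a P x² ≤ b y² follows by using the second
-- comparison twice, which leaves one factor Q to absorb P.
fourth-powers : ∀ {a b c d P Q x y} .{{_ : NonZero c}} → P ℕ.≤ Q → a · (c · c) ℕ.≤ b · (d · d · Q) →
  d · (Q · x) ℕ.≤ c · y → (a · P) ^ 2 · x ^ 4 ℕ.≤ b ^ 2 · y ^ 4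
fourth-powers {a} {b} {c} {d} {P} {Q} {x} {y} P≤Q h₁ h₂ =
  subst₂ ℕ._≤_ (square (a · P) x) (square b y) (ℕ.^-monoˡ-≤ 2 (ℕ.*-cancelʳ-≤ (a · P · (x · x)) (b · (y · y)) (c · c) (begin
    a · P · (x · x) · (c · c)  ≤⟨ ℕ.*-monoˡ-≤ (c · c) (ℕ.*-monoˡ-≤ (x · x) (ℕ.*-monoʳ-≤ a P≤Q)) ⟩
    a · Q · (x · x) · (c · c)  ≡⟨ pull a Q (x · x) (c · c) ⟩
    a · (c · c) · (Q · (x · x))  ≤⟨ ℕ.*-monoˡ-≤ (Q · (x · x)) h₁ ⟩
    b · (d · d · Q) · (Q · (x · x))  ≡⟨ pair b d Q x ⟩
    b · (d · (Q · x) · (d · (Q · x)))  ≤⟨ ℕ.*-monoʳ-≤ b (ℕ.*-mono-≤ h₂ h₂) ⟩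
    b · (c · y · (c · y))  ≡⟨ push b c y ⟩
    b · (y · y) · (c · c)  ∎)))
  where
  open ℕ.≤-Reasoning
  instance cc-nz = ℕ.m*n≢0 c c
  fourth : ∀ x → x · x · (x · x · 1) ≡ x · (x · (x · (x · 1)))
  fourth = ℕ-solve
  square : ∀ a x → (a · (x · x)) ^ 2 ≡ a ^ 2 · x ^ 4
  square a x = trans (^-*-distrib 2 a (x · x)) (cong (a ^ 2 ·_) (fourth x))
  pull : ∀ a q x c → a · q · x · c ≡ a · c · (q · x)
  pull = ℕ-solve
  pair : ∀ b d q x → b · (d · d · q) · (q · (x · x)) ≡ b · (d · (q · x) · (d · (q · x)))
  pair = ℕ-solve
  push : ∀ b c y → b · (c · y · (c · y)) ≡ b · (y · y) · (c · c)
  push = ℕ-solve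

-- The ratio u / v stands for q · `shrink` / `grow`, which is 4 at the optimum r² = q - 1. In these
-- terms the test compares a (u²)ⁿ with b (v² q)ⁿ, so it passes from Q₀ and N to all larger q and n.
character-from-ratio : ∀ q n r u v Q₀ N (T : List ℕ) → 2 ℕ.≤ q → 1 ℕ.≤ n → r ≢ 0 → .{{_ : NonZero u}} →
  (∀ {p} → Prime p → p ∈ T ⊎ 2 ^ 4 ℕ.≤ p) → (∀ {t} → t ∈ T → 0 ℕ.< t × t ℕ.≤ 2 ^ 4) →
  v · (q · shrink q n r) ℕ.≤ u · grow q n r → Q₀ ℕ.≤ q → u · u ℕ.≤ v · v · Q₀ →
  (2 ^ 4) ^ length T · (u · u) ^ N ℕ.≤ product T · (v · v · Q₀) ^ N → N ℕ.≤ n → Criterion q n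
character-from-ratio q n r u v Q₀ N T 2≤q 1≤n r≢0 cover between ratio Q₀≤q step base N≤n =
  inj₁ (character-criterion q n r 4 T r≢0 (λ pp _ → cover pp) between
    (fourth-powers {a} {b} {u ^ n} {v ^ n} {pred Q} {Q} {shrink q n r ^ n} {grow q n r ^ n} ℕ.pred[n]≤n growth powered))
  where
  Q = q ^ n
  a = (2 ^ 4) ^ length T
  b = product T
  instance m-nz = pred-power-nonZero q n 2≤q 1≤n
  instance u-nz = ℕ.m^n≢0 u n
  powered : v ^ n · (Q · shrink q n r ^ n) ℕ.≤ u ^ n · grow q n r ^ n
  powered = subst₂ ℕ._≤_ (trans (^-*-distrib n v (q · shrink q n r)) (cong (v ^ n ·_) (^-*-distrib n q (shrink q n r))))
    (^-*-distrib n u (grow q n r)) (ℕ.^-monoˡ-≤ n ratio)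
  Q₀≤ : v · v · Q₀ ℕ.≤ v · v · q
  Q₀≤ = ℕ.*-monoʳ-≤ (v · v) Q₀≤q
  growth : a · (u ^ n · u ^ n) ℕ.≤ b · (v ^ n · v ^ n · Q)
  growth = subst₂ ℕ._≤_ (cong (a ·_) (^-*-distrib n u u))
    (cong (b ·_) (trans (^-*-distrib n (v · v) q) (cong (_· Q) (^-*-distrib n v v))))
    (geometric-growth {a} {b} N (ℕ.≤-trans step Q₀≤) (ℕ.≤-trans base (ℕ.*-monoʳ-≤ b (ℕ.^-monoˡ-≤ N Q₀≤))) n N≤n)

smallPrimes : List ℕ
smallPrimes = candidates (λ _ → true) (2 ^ 4)

smallPrimes-cover : ∀ {p} → Prime p → p ∈ smallPrimes ⊎ 2 ^ 4 ℕ.≤ p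
smallPrimes-cover {p} pp with ℕ.<-≤-connex p (2 ^ 4)
... | inj₂ ge = inj₂ ge
... | inj₁ lt = inj₁ (∈candidates⁺ (λ _ → true) (2 ^ 4) pp lt _)

smallPrimes-between : ∀ {t} → t ∈ smallPrimes → 0 ℕ.< t × t ℕ.≤ 2 ^ 4
smallPrimes-between t∈ = let _ , 1<t , t<M = ∈candidates⁻ (λ _ → true) (2 ^ 4) t∈ in ℕ.<⇒≤ 1<t , ℕ.<⇒≤ t<M

smallPrimes-base : (2 ^ 4) ^ length smallPrimes · (49 · 49) ^ 6 ℕ.≤ product smallPrimes · (12 · 12 · 53) ^ 6
smallPrimes-base = ℕ.≤ᵇ⇒≤ ((2 ^ 4) ^ length smallPrimes · (49 · 49) ^ 6) (product smallPrimes · (12 · 12 · 53) ^ 6) _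

criterion-character : ∀ {q} n → 53 ℕ.≤ q → 6 ℕ.≤ n → Criterion q n
criterion-character {suc s} n 53≤q 6≤n = conclude (grow≥shrink s n (ℕ.s≤s⁻¹ 53≤q))
  where
  conclude : (∃ λ r → r ≢ 0 × 12 · (suc s · shrink (suc s) n r) ℕ.≤ 49 · grow (suc s) n r) → Criterion (suc s) n
  conclude (r , r≢0 , ratio) = character-from-ratio (suc s) n r 49 12 53 6 smallPrimes
    (ℕ.≤-trans (ℕ.m≤m+n 2 51) 53≤q) (ℕ.≤-trans (ℕ.m≤m+n 1 5) 6≤n) r≢0 smallPrimes-cover smallPrimes-between
    ratio 53≤q (ℕ.≤ᵇ⇒≤ (49 · 49) (12 · 12 · 53) _) smallPrimes-base 6≤n

-- 6 is the least exponent for which the comparison in `smallPrimes-base` is true, so n ≤ 5 is left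
-- to counting.
criterion-53≤q : ∀ {q} n → 53 ℕ.≤ q → 2 ℕ.≤ n → Criterion q n
criterion-53≤q 1 _ (s≤s ())
criterion-53≤q 2 53≤q 2≤n = criterion-counting 53 20 2 (s≤s (s≤s z≤n)) 53≤q 2≤n (ℕ.m≤m+n 2 18) (ℕ.≤ᵇ⇒≤ _ _ _)
criterion-53≤q 3 53≤q 2≤n = criterion-counting 53 20 3 (s≤s (s≤s z≤n)) 53≤q 2≤n (ℕ.m≤m+n 3 17) (ℕ.≤ᵇ⇒≤ _ _ _)
criterion-53≤q 4 53≤q 2≤n = criterion-counting 53 20 4 (s≤s (s≤s z≤n)) 53≤q 2≤n (ℕ.m≤m+n 4 16) (ℕ.≤ᵇ⇒≤ _ _ _)
criterion-53≤q 5 53≤q 2≤n = criterion-counting 53 20 5 (s≤s (s≤s z≤n)) 53≤q 2≤n (ℕ.m≤m+n 5 15) (ℕ.≤ᵇ⇒≤ _ _ _)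
criterion-53≤q n@(suc (suc (suc (suc (suc (suc i)))))) 53≤q 2≤n = criterion-character n 53≤q (ℕ.m≤m+n 6 i)

-- The cases q = 13 and q = 11, and the theorem

character-criterion-⊆ : ∀ q n r T → r ≢ 0 → (∀ {p} → Prime p → p ∣ pred (q ^ n) → p ∈ T) →
  2 ^ length T · 2 ^ length T · shrink q n r ^ n ℕ.≤ grow q n r ^ n → Criterion q n
character-criterion-⊆ q n r T r≢0 cover h = inj₁ (r , r≢0 ,
  ℕ.≤-trans (ℕ.*-monoˡ-≤ (shrink q n r ^ n) (ℕ.*-mono-≤ fewer fewer)) h)
  where
  m = pred (q ^ n)
  fewer : 2 ^ length (primeDivisors m) ℕ.≤ 2 ^ length T
  fewer = ℕ.^-monoʳ-≤ 2 (unique-⊆⇒length≤ (primeDivisors-unique m) (λ p∈ → let pp , p∣m = ∈primeDivisors⁻ {m} p∈ in cover pp p∣m))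

-- The margin is too small here for the generic bound on the number of prime divisors.
criterion-13-6 : Criterion 13 6
criterion-13-6 = character-criterion-⊆ 13 6 3 support (λ ())
  (λ pp p∣m → All.lookup factors⊆ (prime∣product⇒∈ factors pp factors-prime p∣m))
  (ℕ.≤ᵇ⇒≤ (2 ^ length support · 2 ^ length support · shrink 13 6 3 ^ 6) (grow 13 6 3 ^ 6) _)
  where
  factors support : List ℕ
  -- The factorisation of 13⁶ - 1 with multiplicities, so that its product evaluates to m; ω = 5 is
  -- thus known exactly.
  factors = 2 ∷ 2 ∷ 2 ∷ 3 ∷ 3 ∷ 7 ∷ 61 ∷ 157 ∷ []
  support = 2 ∷ 3 ∷ 7 ∷ 61 ∷ 157 ∷ []
  factors-prime : All Prime factors
  factors-prime = from-yes (All.all? prime? factors)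
  factors⊆ : All (_∈ support) factors
  factors⊆ = from-yes (All.all? (λ p → Any.any? (p ℕ.≟_) support) factors)

criterion-13 : ∀ n → 2 ℕ.≤ n → n ≢ 4 → Criterion 13 n
criterion-13 n 2≤n n≢4 with settled-sound 13 3 6 23 (4 ∷ 6 ∷ []) (s≤s (s≤s z≤n)) _ n 2≤n
... | inj₁ criterion           = criterion
... | inj₂ (here n≡4)          = ⊥-elim (n≢4 n≡4)
... | inj₂ (there (here n≡6))  = subst (Criterion 13) (sym n≡6) criterion-13-6

criterion-11 : ∀ n → 2 ℕ.≤ n → n ≢ 4 → n ≢ 6 → n ≢ 12 → Criterion 11 n
criterion-11 n 2≤n n≢4 n≢6 n≢12 with settled-sound 11 3 6 32 (4 ∷ 6 ∷ 12 ∷ []) (s≤s (s≤s z≤n)) _ n 2≤n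
... | inj₁ criterion                   = criterion
... | inj₂ (here n≡4)                  = ⊥-elim (n≢4 n≡4)
... | inj₂ (there (here n≡6))          = ⊥-elim (n≢6 n≡6)
... | inj₂ (there (there (here n≡12))) = ⊥-elim (n≢12 n≡12)

theorem1p1 : (∀ (q n : ℕ) → IsPrimePower q → 2 ℕ.≤ n →
    (16 ℕ.≤ q
    ⊎ (q ≡ 13 × n ≢ 4)
    ⊎ (q ≡ 11 × n ≢ 4 × n ≢ 6 × n ≢ 12)) →
    PrimitiveInComplement q n)
    × (∀ (q : ℕ) → (q ≡ 7 ⊎ q ≡ 8 ⊎ q ≡ 9) →
    ∃ λ (N : ℕ) → ∀ (n : ℕ) → N ℕ.≤ n → 2 ℕ.≤ n → PrimitiveInComplement q n)
theorem1p1 = concrete , asymptotic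
  where
  3≤3+ : ∀ k → 3 ℕ.≤ 3 ℕ.+ k
  3≤3+ k = ℕ.m≤m+n 3 k
  concrete : ∀ q n → IsPrimePower q → 2 ℕ.≤ n → (16 ℕ.≤ q ⊎ (q ≡ 13 × n ≢ 4) ⊎ (q ≡ 11 × n ≢ 4 × n ≢ 6 × n ≢ 12)) →
    PrimitiveInComplement q n
  concrete q n _ 2≤n (inj₁ 16≤q) = criterion⇒primitive (ℕ.≤-trans (3≤3+ 13) 16≤q) 2≤n criterion
    where
    criterion : Criterion q n
    criterion with ℕ.<-≤-connex q 53
    ... | inj₁ q<53 = criterion-16≤q<53 16≤q q<53 2≤n
    ... | inj₂ 53≤q = criterion-53≤q n 53≤q 2≤n
  concrete q n _ 2≤n (inj₂ (inj₁ (refl , n≢4))) = criterion⇒primitive (3≤3+ 10) 2≤n (criterion-13 n 2≤n n≢4)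
  concrete q n _ 2≤n (inj₂ (inj₂ (refl , n≢4 , n≢6 , n≢12))) =
    criterion⇒primitive (3≤3+ 8) 2≤n (criterion-11 n 2≤n n≢4 n≢6 n≢12)
  eventually : ∀ q N k r → 3 ℕ.≤ q → T (TailTest q N k r) → ∃ λ N → ∀ n → N ℕ.≤ n → 2 ℕ.≤ n → PrimitiveInComplement q n
  eventually q N k r 3≤q h = N , λ n N≤n 2≤n → criterion⇒primitive 3≤q 2≤n
    (tail-sound q N k r (ℕ.≤-trans (s≤s (s≤s z≤n)) 3≤q) h n N≤n (ℕ.≤-trans (s≤s z≤n) 2≤n))
  asymptotic : ∀ q → (q ≡ 7 ⊎ q ≡ 8 ⊎ q ≡ 9) → ∃ λ N → ∀ n → N ℕ.≤ n → 2 ℕ.≤ n → PrimitiveInComplement q n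
  -- For q = 7 and r = 2 the tail test requires 7² · 100^k ≤ 168^k, and k = 8 is the least such k.
  -- The narrow margin explains the large starting point.
  asymptotic q (inj₁ refl)        = eventually 7 493 8 2 (3≤3+ 4) _
  asymptotic q (inj₂ (inj₁ refl)) = eventually 8 100 8 3 (3≤3+ 5) _
  asymptotic q (inj₂ (inj₂ refl)) = eventually 9 61 8 3 (3≤3+ 6) _
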